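{- Let $\mathcal{P}$ be a program in the language described in the context. If $\mathcal{P}$ is write atomic, then $\mathcal{P}$ is robust, i.e., for every TSO execution $\pi$ of $\mathcal{P}$ there exists an SC execution $\pi'$ of $\mathcal{P}$ with $Tr(\pi) = Tr(\pi')$.
   Context: Programs. A program $\mathcal{P}$ has a finite set $X$ of shared variables and a finite set of threads; each thread $t$ has a finite set of local registers $\vec r_t$, a start label, and a finite set of labelled instructions of the form "$\ell: \mathit{inst};\ \texttt{goto}\ \ell'$" (several instructions may carry the same label, which allows nondeterminism). An instruction $\mathit{inst}$ is one of: $x := e$ with $x\in X$ (a write instruction), $r := e$, $r := x$ with $x \in X$ (a read instruction), $\texttt{fence}$, $r := \texttt{cas}(x, e_1, e_2)$, $\texttt{skip}$, or $\texttt{assume}\ b$, where $r$ is a register of the thread, $e,e_1,e_2$ are arithmetic expressions and $b$ a boolean expression over the thread's registers. Values range over a domain $\mathcal{D}$ containing $0$; all shared variables and registers are initially $0$. TSO semantics. A state is $(pc, mem, buf)$: $pc$ maps each thread to a label, $mem$ maps shared variables and registers to values, $buf$ maps each thread to a FIFO sequence of pairs $(x,v)\in X\times\mathcal{D}$ (initially empty). Transitions are labelled by actions. A write $x := e$ by $t$ appends $(x,v)$ ($v$ the value of $e$) to $buf(t)$ and advances $pc(t)$, labelled $(t,isu)$. At any time the oldest entry $(x,v)$ of $buf(t)$ may be removed and $mem(x)$ set to $v$, labelled $(t,com,x,v)$. $r := e$ updates $r$, labelled $(t,\tau)$. $r := x$ sets $r$ to the value $v$ of the most recent entry for $x$ in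 $buf(t)$ if one exists, else to $mem(x)$, labelled $(t,rd,x,v)$. $\texttt{fence}$ is enabled only if $buf(t)$ is empty, labelled $(t,\tau)$. $r := \texttt{cas}(x,e_1,e_2)$ is enabled only if $buf(t)$ is empty; if $mem(x)$ equals the value of $e_1$ it sets $mem(x)$ to the value $v$ of $e_2$ and $r:=1$, labelled $(t,isu)(t,com,x,v)$; otherwise it sets $r:=0$, labelled $(t,rd,x,mem(x))$. $\texttt{skip}$ is labelled $(t,\tau)$; $\texttt{assume}\ b$ is enabled only when $b$ holds and is labelled $(t,\tau)$. Each instruction step moves $pc(t)$ to the goto target. A TSO execution is a sequence of actions labelling a path from the initial state, with all buffers empty at the end. SC semantics. States are $(pc, mem)$; reads read $mem$ directly, writes update $mem$ directly, and each write generates $(t,isu)$ immediately followed by its corresponding $(t,com,x,v)$; fences have no effect. An SC execution is defined analogously. Traces. For an execution $\pi$, the trace $Tr(\pi)$ is the graph whose nodes are the non-$\tau$ actions of $\pi$, where each $isu$ action and its corresponding $com$ action are merged into one node, and whose edges form the happens-before relation $hb = po \cup so \cup rf \cup fr$: $po$ orders actions of the same thread in program (execution) order, excluding $com$ actions; $so$ orders, in execution order, $com$ actions on the same variable that write different values; $rf$ relates a $com$ action to a $rd$ action reading its value; $fr$ is the composition of $rf$ followed by $so$. $\mathcal{P}$ is robust if every TSO execution has the same trace as some SC execution. Movers. In an SC execution $\pi=\pi_1\ldots\pi_n$ an issue action and its immediately following commit are treated as a single step. $\pi_i$ moves right (resp. left) in $\pi$ if swapping $\pi_i$ with $\pi_{i+1}$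 (resp. $\pi_{i-1}$) yields a valid SC execution of $\mathcal{P}$, the thread of $\pi_i$ differs from that of $\pi_{i+1}$ (resp. $\pi_{i-1}$), and both executions reach the same final state. For an action $\pi_i$, $\mathsf{instOf}_\pi(\pi_i)$ is the labelled instruction that generated it. A labelled instruction $\ell$ is a right (resp. left) mover if for every SC execution $\pi$ and every action $\pi_i$ with $\mathsf{instOf}_\pi(\pi_i)=\ell$, $\pi_i$ moves right (resp. left) in $\pi$. Buffer-free reachability. For a write instruction $\ell$ and a read instruction $\ell'$ of the same thread $t$, $\ell'$ is buffer-free reachable from $\ell$ if there is an SC execution $\pi$ and indices $i<j$ with $\mathsf{instOf}_\pi(\pi_i)=\ell$, $\mathsf{instOf}_\pi(\pi_j)=\ell'$, such that for all $i<k<j$, $\pi_k$ is neither an action generated by a $\texttt{fence}$ instruction of $t$ nor a write action on the shared variable that $\ell'$ reads. Write atomicity. A write instruction $\ell_w$ is atomic if it is a left mover or every read instruction buffer-free reachable from $\ell_w$ is a right mover. $\mathcal{P}$ is write atomic if every write instruction of $\mathcal{P}$ is atomic.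
   Formalization: With last-writer rf the claim fails when equal values are written; here a read of v may be attributed to any earlier commit of v not followed by another value, Tr(π)=Tr(π') means every such trace of π is one of π', and movers need commute only with an existing neighbour of another thread. -}

module Defs where

open import Data.Bool using (Bool; true)
open import Data.Fin using (Fin; toℕ; _<_; _≤_)
open import Data.Fin.Properties using (_≟_)
open import Data.List using (List; []; _∷_; _++_; _∷ʳ_; map; concat; length; lookup; take)
open import Data.List.Membership.Propositional using (_∈_)
open import Data.List.Relation.Unary.All using (All)
open import Data.Maybe using (Maybe; just; nothing; fromMaybe; _<∣>_)
open import Data.Nat using (ℕ; zero; suc)
open import Data.Product using (Σ; ∃; ∃-syntax; Σ-syntax; _×_; _,_; proj₁)
open import Data.Sum using (_⊎_)
open import Data.Vec using (Vec; replicate; _[_]≔_)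
open import Function.Bundles using (_↔_; _⇔_; Inverse)
open import Relation.Binary.Definitions using (DecidableEquality)
open import Relation.Binary.PropositionalEquality using (_≡_; _≢_; refl)
open import Relation.Nullary using (¬_; yes; no)

-- 1# is the value a successful cas stores in its register.
record ValueDomain : Set₁ where
  field
    D   : Set
    0#  : D
    1#  : D
    _≟ᴰ_ : DecidableEquality D

Label : Set
Label = ℕ

-- Expressions over the registers are represented by their denotations.
data Inst (D : Set) (nVar nReg : ℕ) : Set where
  write  : Fin nVar → (Vec D nReg → D) → Inst D nVar nReg
  assign : Fin nReg → (Vec D nReg → D) → Inst D nVar nReg
  read   : Fin nReg → Fin nVar → Inst D nVar nReg
  fence  : Inst D nVar nReg
  cas    : Fin nReg → Fin nVar → (Vec D nReg → D) → (Vec D nReg → D) → Inst D nVar nReg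
  skip   : Inst D nVar nReg
  assume : (Vec D nReg → Bool) → Inst D nVar nReg

record LabelledInst (D : Set) (nVar nReg : ℕ) : Set where
  constructor _∶_⨟goto_
  field
    source : Label
    inst   : Inst D nVar nReg
    target : Label

record Program (V : ValueDomain) : Set where
  open ValueDomain V
  field
    nVar    : ℕ
    nThread : ℕ
    nReg    : Fin nThread → ℕ
    start   : Fin nThread → Label
    nInst   : Fin nThread → ℕ
    instr   : (t : Fin nThread) → Fin (nInst t) → LabelledInst D nVar (nReg t)

_⟨_↦_⟩ : ∀ {n} {B : Fin n → Set} → ((i : Fin n) → B i) → (i : Fin n) → B i → (j : Fin n) → B j
(f ⟨ i ↦ b ⟩) j with i ≟ j
... | yes refl = b
... | no  _    = f j

module _ {V : ValueDomain} (P : Program V) where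
  open ValueDomain V
  open Program P

  Thread Var : Set
  Thread = Fin nThread
  Var    = Fin nVar

  Src Tgt : (t : Thread) → Fin (nInst t) → Label
  Src t i = LabelledInst.source (instr t i)
  Tgt t i = LabelledInst.target (instr t i)

  InstAt : (t : Thread) → Fin (nInst t) → Inst D nVar (nReg t)
  InstAt t i = LabelledInst.inst (instr t i)

  data Action : Set where
    isu : Thread → Action
    com : Thread → Var → D → Action
    rd  : Thread → Var → D → Action
    tau : Thread → Action

  PC Mem Regs Buf : Set
  PC   = Thread → Label
  Mem  = Var → D
  Regs = (t : Thread) → Vec D (nReg t)
  Buf  = Thread → List (Var × D)

  record TSOState : Set where
    constructor ⟪_,_,_,_⟫
    field
      pc  : PC
      mem : Mem
      reg : Regs
      buf : Buf

  initTSO : TSOState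
  initTSO = ⟪ start , (λ _ → 0#) , (λ t → replicate (nReg t) 0#) , (λ _ → []) ⟫

  -- Buffers are listed oldest entry first.
  newest : Var → List (Var × D) → Maybe D
  newest x []            = nothing
  newest x ((y , v) ∷ b) with y ≟ x
  ... | yes _ = newest x b <∣> just v
  ... | no  _ = newest x b

  data TSOStep : TSOState → List Action → TSOState → Set where
    write : ∀ {pc mem reg buf t} i {x e} → pc t ≡ Src t i → InstAt t i ≡ write x e →
      TSOStep ⟪ pc , mem , reg , buf ⟫
              (isu t ∷ [])
              ⟪ pc ⟨ t ↦ Tgt t i ⟩ , mem , reg , buf ⟨ t ↦ buf t ∷ʳ (x , e (reg t)) ⟩ ⟫
    commit : ∀ {pc mem reg buf t x v b} → buf t ≡ (x , v) ∷ b →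
      TSOStep ⟪ pc , mem , reg , buf ⟫
              (com t x v ∷ [])
              ⟪ pc , mem ⟨ x ↦ v ⟩ , reg , buf ⟨ t ↦ b ⟩ ⟫
    assign : ∀ {pc mem reg buf t} i {r e} → pc t ≡ Src t i → InstAt t i ≡ assign r e →
      TSOStep ⟪ pc , mem , reg , buf ⟫
              (tau t ∷ [])
              ⟪ pc ⟨ t ↦ Tgt t i ⟩ , mem , reg ⟨ t ↦ reg t [ r ]≔ e (reg t) ⟩ , buf ⟫
    read : ∀ {pc mem reg buf t} i {r x v} → pc t ≡ Src t i → InstAt t i ≡ read r x →
      v ≡ fromMaybe (mem x) (newest x (buf t)) →
      TSOStep ⟪ pc , mem , reg , buf ⟫
              (rd t x v ∷ [])
              ⟪ pc ⟨ t ↦ Tgt t i ⟩ , mem , reg ⟨ t ↦ reg t [ r ]≔ v ⟩ , buf ⟫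
    fence : ∀ {pc mem reg buf t} i → pc t ≡ Src t i → InstAt t i ≡ fence →
      buf t ≡ [] →
      TSOStep ⟪ pc , mem , reg , buf ⟫
              (tau t ∷ [])
              ⟪ pc ⟨ t ↦ Tgt t i ⟩ , mem , reg , buf ⟫
    cas-success : ∀ {pc mem reg buf t} i {r x e₁ e₂} → pc t ≡ Src t i → InstAt t i ≡ cas r x e₁ e₂ →
      buf t ≡ [] → mem x ≡ e₁ (reg t) →
      TSOStep ⟪ pc , mem , reg , buf ⟫
              (isu t ∷ com t x (e₂ (reg t)) ∷ [])
              ⟪ pc ⟨ t ↦ Tgt t i ⟩ , mem ⟨ x ↦ e₂ (reg t) ⟩ , reg ⟨ t ↦ reg t [ r ]≔ 1# ⟩ , buf ⟫
    cas-failure : ∀ {pc mem reg buf t} i {r x e₁ e₂} → pc t ≡ Src t i → InstAt t i ≡ cas r x e₁ e₂ →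
      buf t ≡ [] → mem x ≢ e₁ (reg t) →
      TSOStep ⟪ pc , mem , reg , buf ⟫
              (rd t x (mem x) ∷ [])
              ⟪ pc ⟨ t ↦ Tgt t i ⟩ , mem , reg ⟨ t ↦ reg t [ r ]≔ 0# ⟩ , buf ⟫
    skip : ∀ {pc mem reg buf t} i → pc t ≡ Src t i → InstAt t i ≡ skip →
      TSOStep ⟪ pc , mem , reg , buf ⟫
              (tau t ∷ [])
              ⟪ pc ⟨ t ↦ Tgt t i ⟩ , mem , reg , buf ⟫
    assume : ∀ {pc mem reg buf t} i {b} → pc t ≡ Src t i → InstAt t i ≡ assume b →
      b (reg t) ≡ true →
      TSOStep ⟪ pc , mem , reg , buf ⟫
              (tau t ∷ [])
              ⟪ pc ⟨ t ↦ Tgt t i ⟩ , mem , reg , buf ⟫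

  data TSOPath : TSOState → List Action → TSOState → Set where
    []  : ∀ {s} → TSOPath s [] s
    _∷_ : ∀ {s s′ s″ as π} → TSOStep s as s′ → TSOPath s′ π s″ → TSOPath s (as ++ π) s″

  TSOExecution : List Action → Set
  TSOExecution π = ∃[ s ] TSOPath initTSO π s × (∀ t → TSOState.buf s t ≡ [])

  record SCState : Set where
    constructor ⟪_,_,_⟫
    field
      pc  : PC
      mem : Mem
      reg : Regs

  initSC : SCState
  initSC = ⟪ start , (λ _ → 0#) , (λ t → replicate (nReg t) 0#) ⟫

  -- States contain functions, so equality of states is pointwise.
  record _≈_ (s s′ : SCState) : Set where
    field
      pc-≡  : ∀ t → SCState.pc s t ≡ SCState.pc s′ t
      mem-≡ : ∀ x → SCState.mem s x ≡ SCState.mem s′ x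
      reg-≡ : ∀ t → SCState.reg s t ≡ SCState.reg s′ t

  data SCStep : SCState → (t : Thread) → Fin (nInst t) → List Action → SCState → Set where
    write : ∀ {pc mem reg t i x e} → pc t ≡ Src t i → InstAt t i ≡ write x e →
      SCStep ⟪ pc , mem , reg ⟫ t i
             (isu t ∷ com t x (e (reg t)) ∷ [])
             ⟪ pc ⟨ t ↦ Tgt t i ⟩ , mem ⟨ x ↦ e (reg t) ⟩ , reg ⟫
    assign : ∀ {pc mem reg t i r e} → pc t ≡ Src t i → InstAt t i ≡ assign r e →
      SCStep ⟪ pc , mem , reg ⟫ t i
             (tau t ∷ [])
             ⟪ pc ⟨ t ↦ Tgt t i ⟩ , mem , reg ⟨ t ↦ reg t [ r ]≔ e (reg t) ⟩ ⟫
    read : ∀ {pc mem reg t i r x} → pc t ≡ Src t i → InstAt t i ≡ read r x →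
      SCStep ⟪ pc , mem , reg ⟫ t i
             (rd t x (mem x) ∷ [])
             ⟪ pc ⟨ t ↦ Tgt t i ⟩ , mem , reg ⟨ t ↦ reg t [ r ]≔ mem x ⟩ ⟫
    fence : ∀ {pc mem reg t i} → pc t ≡ Src t i → InstAt t i ≡ fence →
      SCStep ⟪ pc , mem , reg ⟫ t i
             (tau t ∷ [])
             ⟪ pc ⟨ t ↦ Tgt t i ⟩ , mem , reg ⟫
    cas-success : ∀ {pc mem reg t i r x e₁ e₂} → pc t ≡ Src t i → InstAt t i ≡ cas r x e₁ e₂ →
      mem x ≡ e₁ (reg t) →
      SCStep ⟪ pc , mem , reg ⟫ t i
             (isu t ∷ com t x (e₂ (reg t)) ∷ [])
             ⟪ pc ⟨ t ↦ Tgt t i ⟩ , mem ⟨ x ↦ e₂ (reg t) ⟩ , reg ⟨ t ↦ reg t [ r ]≔ 1# ⟩ ⟫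
    cas-failure : ∀ {pc mem reg t i r x e₁ e₂} → pc t ≡ Src t i → InstAt t i ≡ cas r x e₁ e₂ →
      mem x ≢ e₁ (reg t) →
      SCStep ⟪ pc , mem , reg ⟫ t i
             (rd t x (mem x) ∷ [])
             ⟪ pc ⟨ t ↦ Tgt t i ⟩ , mem , reg ⟨ t ↦ reg t [ r ]≔ 0# ⟩ ⟫
    skip : ∀ {pc mem reg t i} → pc t ≡ Src t i → InstAt t i ≡ skip →
      SCStep ⟪ pc , mem , reg ⟫ t i
             (tau t ∷ [])
             ⟪ pc ⟨ t ↦ Tgt t i ⟩ , mem , reg ⟫
    assume : ∀ {pc mem reg t i b} → pc t ≡ Src t i → InstAt t i ≡ assume b →
      b (reg t) ≡ true →
      SCStep ⟪ pc , mem , reg ⟫ t i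
             (tau t ∷ [])
             ⟪ pc ⟨ t ↦ Tgt t i ⟩ , mem , reg ⟫

  -- A step of an SC execution together with the labelled instruction that
  -- generated it (instOf).  An issue and its commit form a single step.
  record Event : Set where
    constructor event
    field
      thread : Thread
      index  : Fin (nInst thread)
      label  : List Action

  open Event

  instOf : Event → Σ Thread (λ t → Fin (nInst t))
  instOf a = thread a , index a

  data SCPath : SCState → List Event → SCState → Set where
    []  : ∀ {s} → SCPath s [] s
    _∷_ : ∀ {s s′ s″ t i as es} → SCStep s t i as s′ → SCPath s′ es s″ →
          SCPath s (event t i as ∷ es) s″

  labels : List Event → List (List Action)
  labels = map label

  -- Some path with these step labels leads from the initial state to s.  As
  -- programs are nondeterministic, the labels do not determine the path.
  SCReaches : List (List Action) → SCState → Set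
  SCReaches π s = ∃[ es ] ∃[ s′ ] SCPath initSC es s′ × labels es ≡ π × s′ ≈ s

  SCExecution : List Action → Set
  SCExecution π = ∃[ es ] ∃[ s ] SCPath initSC es s × concat (labels es) ≡ π

  -- s is the final state of the execution before ++ a ∷ after.  Commutation is
  -- required only with an existing neighbour of another thread: were its
  -- existence part of the conclusion, no instruction that occurs in an
  -- execution would be a right mover, since it occurs last in some execution.
  MovesRight MovesLeft : (before : List Event) (a : Event) (after : List Event) → SCState → Set
  MovesRight before a after s = ∀ b after′ → after ≡ b ∷ after′ → thread a ≢ thread b →
    SCReaches (labels (before ++ b ∷ a ∷ after′)) s
  MovesLeft before a after s = ∀ before′ b → before ≡ before′ ∷ʳ b → thread a ≢ thread b →
    SCReaches (labels (before′ ++ a ∷ b ∷ after)) s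

  RightMover LeftMover : (t : Thread) → Fin (nInst t) → Set
  RightMover t i = ∀ before a after s → SCPath initSC (before ++ a ∷ after) s →
    instOf a ≡ (t , i) → MovesRight before a after s
  LeftMover t i = ∀ before a after s → SCPath initSC (before ++ a ∷ after) s →
    instOf a ≡ (t , i) → MovesLeft before a after s

  IsWrite : (t : Thread) → Fin (nInst t) → Set
  IsWrite t i = ∃[ x ] ∃[ e ] InstAt t i ≡ write x e

  IsReadOf : (t : Thread) → Fin (nInst t) → Var → Set
  IsReadOf t i x = ∃[ r ] InstAt t i ≡ read r x

  FenceOf : Thread → Event → Set
  FenceOf t a = thread a ≡ t × InstAt (thread a) (index a) ≡ fence

  WriteOn : Var → Event → Set
  WriteOn x a = ∃[ t ] ∃[ v ] com t x v ∈ label a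

  -- i is a write instruction and j a read instruction of x, both of thread t.
  BufferFreeReachable : (t : Thread) (i j : Fin (nInst t)) → Var → Set
  BufferFreeReachable t i j x =
    ∃[ before ] ∃[ a ] ∃[ between ] ∃[ b ] ∃[ after ] ∃[ s ]
      SCPath initSC (before ++ a ∷ between ++ b ∷ after) s ×
      instOf a ≡ (t , i) × instOf b ≡ (t , j) ×
      All (λ c → ¬ FenceOf t c × ¬ WriteOn x c) between

  Atomic : (t : Thread) → Fin (nInst t) → Set
  Atomic t i = LeftMover t i ⊎
    (∀ j x → IsReadOf t j x → BufferFreeReachable t i j x → RightMover t j)

  WriteAtomic : Set
  WriteAtomic = ∀ t i → IsWrite t i → Atomic t i

  #isu #com : Thread → List Action → ℕ
  #isu t []           = zero
  #isu t (isu u ∷ π) with t ≟ u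
  ... | yes _ = suc (#isu t π)
  ... | no  _ = #isu t π
  #isu t (_ ∷ π)      = #isu t π
  #com t []           = zero
  #com t (com u _ _ ∷ π) with t ≟ u
  ... | yes _ = suc (#com t π)
  ... | no  _ = #com t π
  #com t (_ ∷ π)      = #com t π

  data IsNode : Action → Set where
    com : ∀ {t x v} → IsNode (com t x v)
    rd  : ∀ {t x v} → IsNode (rd t x v)

  threadOf : Action → Thread
  threadOf (isu t)     = t
  threadOf (com t _ _) = t
  threadOf (rd t _ _)  = t
  threadOf (tau t)     = t

  module _ (π : List Action) where

    Pos : Set
    Pos = Fin (length π)

    infix 5 _at_
    _at_ : Action → Pos → Set
    a at i = lookup π i ≡ a

    -- Position i is the one at which the action at j takes its place in the
    -- program order.  For a commit this is the corresponding issue: buffers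
    -- being FIFO, the k-th commit of a thread corresponds to its k-th issue.
    data IssuedAt (j : Pos) : Pos → Set where
      rd  : ∀ {t x v} → rd t x v at j → IssuedAt j j
      com : ∀ {t x v i} → com t x v at j → isu t at i →
            #isu t (take (toℕ i) π) ≡ #com t (take (toℕ j) π) → IssuedAt j i

    -- The write committed at c is in the buffer of t, and is on x, at r.
    Pending : Thread → Var → (c r : Pos) → Set
    Pending t x c r = ∃[ v ] ∃[ i ] com t x v at c × IssuedAt c i × i < r × r < c

    NoPending : Thread → Var → Pos → Set
    NoPending t x r = ∀ c → ¬ Pending t x c r

    -- ReadsFrom t x v r c : the read of v from x by t at position r reads the
    -- value of the commit c, or the initial value if c is nothing.  Since so
    -- does not order commits of equal values, a read of v from the memory may
    -- be attributed to any preceding commit of v to x that has not been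
    -- followed by a commit of another value.  If no two commits on a variable
    -- write the same value and none writes 0#, then this is just the last
    -- commit on x.
    data ReadsFrom (t : Thread) (x : Var) (v : D) (r : Pos) : Maybe Pos → Set where
      buffer : ∀ {c} → com t x v at c → Pending t x c r →
        (∀ c′ → Pending t x c′ r → c′ ≤ c) →
        ReadsFrom t x v r (just c)
      memory : ∀ {c u} → NoPending t x r → com u x v at c → c < r →
        (∀ d u′ v′ → com u′ x v′ at d → c < d → d < r → v′ ≡ v) →
        ReadsFrom t x v r (just c)
      initial : NoPending t x r → v ≡ 0# →
        (∀ d u′ v′ → com u′ x v′ at d → d < r → v′ ≡ v) →
        ReadsFrom t x v r nothing

    record Sources : Set where
      field
        source  : Pos → Maybe Pos
        correct : ∀ {r t x v} → rd t x v at r → ReadsFrom t x v r (source r)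

    -- nothing stands for the initial store of 0#, which precedes all commits.
    data Store (x : Var) : D → Maybe Pos → Set where
      init : Store x 0# nothing
      com  : ∀ {t v c} → com t x v at c → Store x v (just c)

    data Precedes : Maybe Pos → Pos → Set where
      init : ∀ {d} → Precedes nothing d
      com  : ∀ {c d} → c < d → Precedes (just c) d

    StoreOrder : Maybe Pos → Pos → Set
    StoreOrder c d = ∃[ x ] ∃[ v ] ∃[ v′ ]
      Store x v c × Store x v′ (just d) × v ≢ v′ × Precedes c d

    module _ (ρ : Sources) where
      open Sources ρ

      po so rf fr hb : Pos → Pos → Set
      po i j = threadOf (lookup π i) ≡ threadOf (lookup π j) ×
               (∃[ i′ ] ∃[ j′ ] IssuedAt i i′ × IssuedAt j j′ × i′ < j′)
      so c d = StoreOrder (just c) d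
      rf c r = (∃[ t ] ∃[ x ] ∃[ v ] rd t x v at r) × source r ≡ just c
      -- The inverse of rf (extended to the initial stores) followed by so.
      fr r d = ∃[ t ] ∃[ x ] ∃[ v ] (rd t x v at r × Store x v (source r) × StoreOrder (source r) d)
      hb i j = po i j ⊎ so i j ⊎ rf i j ⊎ fr i j

  record Trace : Set₁ where
    field
      Node   : Set
      action : Node → Action
      edge   : Node → Node → Set

  -- A merged issue and commit is represented by the commit.
  Tr : (π : List Action) → Sources π → Trace
  Tr π ρ = record
    { Node   = Σ[ i ∈ Pos π ] IsNode (lookup π i)
    ; action = λ n → lookup π (proj₁ n)
    ; edge   = λ n m → hb π ρ (proj₁ n) (proj₁ m)
    }

  -- Equality of traces: isomorphism of graphs with labelled nodes.
  record _≅_ (G H : Trace) : Set where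
    module G = Trace G
    module H = Trace H
    field
      nodes   : G.Node ↔ H.Node
    open Inverse nodes using (to)
    field
      actions : ∀ n → H.action (to n) ≡ G.action n
      edges   : ∀ n m → G.edge n m ⇔ H.edge (to n) (to m)

  -- Every trace of π, in particular the one given by the last writers, is a
  -- trace of π′; traces are unique when commits on a variable differ in value.
  SameTrace : List Action → List Action → Set
  SameTrace π π′ = (ρ : Sources π) → Σ[ ρ′ ∈ Sources π′ ] Tr π ρ ≅ Tr π′ ρ′

  Robust : Set
  Robust = ∀ π → TSOExecution π → ∃[ π′ ] SCExecution π′ × SameTrace π π′

{-# OPTIONS --safe #-}
-- A TSO execution is turned into an SC execution as follows.  A write that is a
-- left mover is performed in the SC execution when it is issued.  Any other
-- write is performed when it is committed, and all later steps of its thread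
-- wait for it.  While such a write w is pending, a waiting read that does not
-- read from the buffer is buffer-free reachable from w, hence a right mover, so
-- no other thread can change the value that is read.  A left mover w commutes with all steps of
-- other threads between its issue and its commit: freezing its thread just
-- before w gives a shorter execution, at the end of which w can be performed
-- and from where it moves left to its place.  Since labels do not determine
-- the instructions (a write and a successful cas have the same label), moving
-- w may change the instructions of the other threads, but not their states.
-- The traces agree because the SC execution is obtained by swapping neighbouring
-- actions that are not related by happens-before.
module Submission where

open import Defs
open import Data.Bool using (true)
open import Data.Empty using (⊥-elim)
open import Data.Fin using (Fin; zero; suc; toℕ)
open import Data.Fin.Properties using (_≟_; any?; toℕ-injective)
open import Data.List using (List; []; _∷_; _++_; _∷ʳ_; map; concat; length; lookup; take; initLast; _∷ʳ′_)
open import Data.List.Membership.Propositional using (_∈_)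
open import Data.List.Properties using (++-assoc; ++-identityʳ; length-++; map-++; concat-++; ∷-injective; ∷ʳ-injective)
open import Data.List.Relation.Unary.All as All using (All; []; _∷_)
open import Data.List.Relation.Unary.All.Properties using (map⁺; ++⁺; ++⁻)
open import Data.List.Relation.Unary.Any using (here; there)
open import Data.Maybe as Maybe using (Maybe; just; nothing; fromMaybe; _<∣>_)
open import Data.Nat as ℕ using (ℕ; zero; suc; _+_; z≤n; s≤s; z<s; s<s)
open import Data.Nat.Induction using (Acc; acc; <-wellFounded)
open import Data.Nat.Properties as ℕₚ using (+-comm; +-assoc; +-identityʳ; +-monoʳ-<; n<1+n; m<n⇒m<1+n; m<m+n; m≤m+n; ≤-refl; ≤-trans; ≤-<-trans; <-trans; <⇒≤)
open import Data.Product using (Σ; ∃-syntax; _×_; _,_; proj₁; proj₂)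
open import Data.Sum as Sum using (_⊎_; inj₁; inj₂)
open import Data.Unit using (⊤; tt)
open import Data.Vec using (Vec; replicate; _[_]≔_)
open import Function.Base using (_∘_; id)
open import Function.Bundles using (mk⇔; mk↔ₛ′; Equivalence)
open import Function.Properties.Inverse using (↔-refl; ↔-trans)
open import Relation.Binary.PropositionalEquality using (_≡_; _≢_; refl; sym; trans; cong; cong₂; subst; subst₂)
open import Relation.Nullary using (¬_; Dec; yes; no; ¬?; _×-dec_)

-- The difficulty is circular. A mover can be applied only inside an SC execution, but that the
-- reordered steps form an SC execution is what the movers are to show. The circle is broken by
-- induction on the number of steps of an intermediate machine (`Reach`), which carries the TSO
-- memory and the SC history side by side. The fields of `Inv` depend on each other and are proved
-- by one induction: a waiting read keeps its value only because the history can be run, and the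
-- history can be run only because the waiting reads are valid and its memory is the TSO memory
-- updated by the early writes. Traces are handled apart from this. `SameTrace` ranges over all
-- attributions of reads to commits, so every swap has to transport an arbitrary attribution.
-- Commits on one variable may be swapped only if they write the same value, and moving a commit
-- left past a read may turn a read from the buffer into a read from memory.

-- Swapping neighbouring actions without changing the trace

module Reordering {V : ValueDomain} (P : Program V) where
  open import Data.Fin using (_<_; _≤_)
  open ValueDomain V
  open Program P

  private
    Act : Set
    Act = Action P

  SameTrace-refl : ∀ π → SameTrace P π π
  SameTrace-refl π ρ = ρ , record
    { nodes = ↔-refl ; actions = λ _ → refl ; edges = λ _ _ → mk⇔ id id }

  ≅-trans : ∀ {G H K : Trace P} → _≅_ P G H → _≅_ P H K → _≅_ P G K
  ≅-trans p q = record
    { nodes   = ↔-trans (_≅_.nodes p) (_≅_.nodes q)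
    ; actions = λ n → trans (_≅_.actions q _) (_≅_.actions p n)
    ; edges   = λ n m → mk⇔
        (Equivalence.to (_≅_.edges q _ _) ∘ Equivalence.to (_≅_.edges p n m))
        (Equivalence.from (_≅_.edges p n m) ∘ Equivalence.from (_≅_.edges q _ _))
    }

  SameTrace-trans : ∀ {π₁ π₂ π₃} → SameTrace P π₁ π₂ → SameTrace P π₂ π₃ → SameTrace P π₁ π₃
  SameTrace-trans p q ρ with p ρ
  ... | ρ′ , iso with q ρ′
  ... | ρ″ , iso′ = ρ″ , ≅-trans iso iso′

  -- Issues and commits are matched by counting them in prefixes. Additivity is all that is needed
  -- to follow such counts through a swap.
  record Additive (f : List Act → ℕ) : Set where
    field
      on-[] : f [] ≡ 0
      on-∷  : ∀ c π → f (c ∷ π) ≡ f (c ∷ []) + f π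

    on-++ : ∀ π π′ → f (π ++ π′) ≡ f π + f π′
    on-++ []      π′ = sym (cong (_+ f π′) on-[])
    on-++ (c ∷ π) π′ = trans (on-∷ c (π ++ π′)) (trans (cong (f (c ∷ []) +_) (on-++ π π′))
      (trans (sym (+-assoc (f (c ∷ [])) (f π) (f π′))) (cong (_+ f π′) (sym (on-∷ c π)))))

  #isu-additive : ∀ t → Additive (#isu P t)
  #isu-additive t = record { on-[] = refl ; on-∷ = on-∷ }
    where
    on-∷ : ∀ c π → #isu P t (c ∷ π) ≡ #isu P t (c ∷ []) + #isu P t π
    on-∷ (isu u) π with t ≟ u
    ... | yes _ = refl
    ... | no  _ = refl
    on-∷ (com _ _ _) π = refl
    on-∷ (rd _ _ _)  π = refl
    on-∷ (tau _)     π = refl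

  #com-additive : ∀ t → Additive (#com P t)
  #com-additive t = record { on-[] = refl ; on-∷ = on-∷ }
    where
    on-∷ : ∀ c π → #com P t (c ∷ π) ≡ #com P t (c ∷ []) + #com P t π
    on-∷ (com u _ _) π with t ≟ u
    ... | yes _ = refl
    ... | no  _ = refl
    on-∷ (isu _)    π = refl
    on-∷ (rd _ _ _) π = refl
    on-∷ (tau _)    π = refl

  #isu-own : ∀ t → #isu P t (isu t ∷ []) ≡ 1
  #isu-own t with t ≟ t
  ... | yes _  = refl
  ... | no t≢t = ⊥-elim (t≢t refl)

  #com-own : ∀ t {x v} → #com P t (com t x v ∷ []) ≡ 1
  #com-own t with t ≟ t
  ... | yes _  = refl
  ... | no t≢t = ⊥-elim (t≢t refl)

  #isu-other : ∀ t c → c ≢ isu t → #isu P t (c ∷ []) ≡ 0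
  #isu-other t (isu u) c≢ with t ≟ u
  ... | yes refl = ⊥-elim (c≢ refl)
  ... | no  _    = refl
  #isu-other t (com _ _ _) _ = refl
  #isu-other t (rd _ _ _)  _ = refl
  #isu-other t (tau _)     _ = refl

  #com-other : ∀ t c → (∀ x v → c ≢ com t x v) → #com P t (c ∷ []) ≡ 0
  #com-other t (com u _ _) c≢ with t ≟ u
  ... | yes refl = ⊥-elim (c≢ _ _ refl)
  ... | no  _    = refl
  #com-other t (isu _)    _ = refl
  #com-other t (rd _ _ _) _ = refl
  #com-other t (tau _)    _ = refl

  data NonCom : Act → Set where
    isu : ∀ {t} → NonCom (isu t)
    rd  : ∀ {t x v} → NonCom (rd t x v)
    tau : ∀ {t} → NonCom (tau t)

  swapped : List Act → Act → Act → List Act → List Act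
  swapped A a b C = A ++ a ∷ b ∷ C

  swapPos : ∀ A a b C → Pos P (swapped A a b C) → Pos P (swapped A b a C)
  swapPos []      a b C zero          = suc zero
  swapPos []      a b C (suc zero)    = zero
  swapPos []      a b C (suc (suc i)) = suc (suc i)
  swapPos (c ∷ A) a b C zero          = zero
  swapPos (c ∷ A) a b C (suc i)       = suc (swapPos A a b C i)

  swapPos-involutive : ∀ A a b C i → swapPos A b a C (swapPos A a b C i) ≡ i
  swapPos-involutive []      a b C zero          = refl
  swapPos-involutive []      a b C (suc zero)    = refl
  swapPos-involutive []      a b C (suc (suc i)) = refl
  swapPos-involutive (c ∷ A) a b C zero          = refl
  swapPos-involutive (c ∷ A) a b C (suc i)       = cong suc (swapPos-involutive A a b C i)

  lookup-swapPos : ∀ A a b C i → lookup (swapped A b a C) (swapPos A a b C i) ≡ lookup (swapped A a b C) i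
  lookup-swapPos []      a b C zero          = refl
  lookup-swapPos []      a b C (suc zero)    = refl
  lookup-swapPos []      a b C (suc (suc i)) = refl
  lookup-swapPos (c ∷ A) a b C zero          = refl
  lookup-swapPos (c ∷ A) a b C (suc i)       = lookup-swapPos A a b C i

  lookup-first : ∀ A a π (i : Pos P (A ++ a ∷ π)) → toℕ i ≡ length A → lookup (A ++ a ∷ π) i ≡ a
  lookup-first []      a π zero    _ = refl
  lookup-first (c ∷ A) a π (suc i) e = lookup-first A a π i (ℕₚ.suc-injective e)

  lookup-second : ∀ A a b C (i : Pos P (swapped A a b C)) → toℕ i ≡ suc (length A) → lookup (swapped A a b C) i ≡ b
  lookup-second []      a b C (suc zero) _ = refl
  lookup-second (c ∷ A) a b C (suc i)    e = lookup-second A a b C i (ℕₚ.suc-injective e)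

  swapPos-first : ∀ A a b C i → toℕ i ≡ length A → toℕ (swapPos A a b C i) ≡ suc (length A)
  swapPos-first []      a b C zero    _ = refl
  swapPos-first (c ∷ A) a b C (suc i) e = cong suc (swapPos-first A a b C i (ℕₚ.suc-injective e))

  swapPos-second : ∀ A a b C i → toℕ i ≡ suc (length A) → toℕ (swapPos A a b C i) ≡ length A
  swapPos-second []      a b C (suc zero) _ = refl
  swapPos-second (c ∷ A) a b C (suc i)    e = cong suc (swapPos-second A a b C i (ℕₚ.suc-injective e))

  -- Only the swapped pair itself can change its order, so each preservation proof below reduces to
  -- excluding or treating this one pair.
  swapPos-mono : ∀ A a b C {i j} → i < j →
    (toℕ i ≡ length A × toℕ j ≡ suc (length A)) ⊎ swapPos A a b C i < swapPos A a b C j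
  swapPos-mono []      a b C {zero}          {suc zero}    _ = inj₁ (refl , refl)
  swapPos-mono []      a b C {zero}          {suc (suc j)} _ = inj₂ (s<s z<s)
  swapPos-mono []      a b C {suc zero}      {suc zero}    (s≤s ())
  swapPos-mono []      a b C {suc zero}      {suc (suc j)} _ = inj₂ z<s
  swapPos-mono []      a b C {suc (suc i)}   {suc zero}    (s≤s ())
  swapPos-mono []      a b C {suc (suc i)}   {suc (suc j)} p = inj₂ p
  swapPos-mono (c ∷ A) a b C {zero}          {suc j}       _ = inj₂ z<s
  swapPos-mono (c ∷ A) a b C {suc i}         {suc j}       (s≤s p) =
    Sum.map (λ (e , e′) → cong suc e , cong suc e′) s≤s (swapPos-mono A a b C p)

  -- The prefix before a swapped position gains or loses exactly the other swapped action, on which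
  -- `f` must therefore vanish.
  count-swapPos : ∀ {f} → Additive f → ∀ A a b C i →
    (toℕ i ≡ length A → f (b ∷ []) ≡ 0) → (toℕ i ≡ suc (length A) → f (a ∷ []) ≡ 0) →
    f (take (toℕ (swapPos A a b C i)) (swapped A b a C)) ≡ f (take (toℕ i) (swapped A a b C))
  count-swapPos {f} add [] a b C zero p q = trans (p refl) (sym (Additive.on-[] add))
  count-swapPos {f} add [] a b C (suc zero) p q = trans (Additive.on-[] add) (sym (q refl))
  count-swapPos {f} add [] a b C (suc (suc i)) p q = trans (two b a)
    (trans (cong (_+ f (take (toℕ i) C)) (+-comm (f (b ∷ [])) (f (a ∷ [])))) (sym (two a b)))
    where
    two : ∀ c d → f (c ∷ d ∷ take (toℕ i) C) ≡ f (c ∷ []) + f (d ∷ []) + f (take (toℕ i) C)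
    two c d = trans (Additive.on-∷ add c _) (trans (cong (f (c ∷ []) +_) (Additive.on-∷ add d _))
      (sym (+-assoc (f (c ∷ [])) (f (d ∷ [])) _)))
  count-swapPos add (c ∷ A) a b C zero p q = refl
  count-swapPos {f} add (c ∷ A) a b C (suc i) p q = trans (Additive.on-∷ add c _)
    (trans (cong (f (c ∷ []) +_) (count-swapPos add A a b C i (p ∘ cong suc) (q ∘ cong suc)))
      (sym (Additive.on-∷ add c _)))

  -- The symmetric part of the conditions under which neighbours may be swapped.
  record Independent (a b : Act) : Set where
    field
      local≢  : NonCom a → NonCom b → threadOf P a ≢ threadOf P b
      commit≢ : ∀ {t x v y w} → a ≡ com t x v → b ≢ com t y w
      store≡  : ∀ {t u x v w} → a ≡ com t x v → b ≡ com u x w → v ≡ w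

  Independent-sym : ∀ {a b} → Independent a b → Independent b a
  Independent-sym ind = record
    { local≢  = λ nb na e → local≢ na nb (sym e)
    ; commit≢ = λ eb ea → commit≢ ea eb
    ; store≡  = λ eb ea → sym (store≡ ea eb)
    } where open Independent ind

  module _ {A : List Act} {a b : Act} {C : List Act} (ind : Independent a b) where
    open Independent ind
    private
      L L′ : List Act
      L  = swapped A a b C
      L′ = swapped A b a C
      f : Pos P L → Pos P L′
      f = swapPos A a b C
      at′ : ∀ {c i} → lookup L i ≡ c → lookup L′ (f i) ≡ c
      at′ {i = i} = trans (lookup-swapPos A a b C i)

    #isu-swapPos : ∀ {t} i → lookup L i ≡ isu t → #isu P t (take (toℕ (f i)) L′) ≡ #isu P t (take (toℕ i) L)
    #isu-swapPos {t} i ei = count-swapPos (#isu-additive t) A a b C i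
      (λ e → #isu-other t b (λ { refl → clash (trans (sym (lookup-first A a _ i e)) ei) refl }))
      (λ e → #isu-other t a (λ { refl → clash refl (trans (sym (lookup-second A a b C i e)) ei) }))
      where
      clash : a ≡ isu t → b ≢ isu t
      clash refl refl = local≢ isu isu refl

    #com-swapPos : ∀ {t x v} i → lookup L i ≡ com t x v → #com P t (take (toℕ (f i)) L′) ≡ #com P t (take (toℕ i) L)
    #com-swapPos {t} i ei = count-swapPos (#com-additive t) A a b C i
      (λ e → #com-other t b (λ y w eb → commit≢ (trans (sym (lookup-first A a _ i e)) ei) eb))
      (λ e → #com-other t a (λ y w ea → commit≢ ea (trans (sym (lookup-second A a b C i e)) ei)))

    -- The matching depends only on the numbers of earlier issues and commits of the thread, and
    -- `Independent` rules out swapping two issues or two commits of one thread. No order between an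
    -- issue and its commit is involved.
    IssuedAt-swapPos : ∀ {j i} → IssuedAt P L j i → IssuedAt P L′ (f j) (f i)
    IssuedAt-swapPos (rd e) = rd (at′ e)
    IssuedAt-swapPos {j} {i} (com ej ei n) = com (at′ ej) (at′ ei)
      (trans (#isu-swapPos i ei) (trans n (sym (#com-swapPos j ej))))

    local-mono : ∀ {i j} → NonCom (lookup L i) → NonCom (lookup L j) →
      threadOf P (lookup L i) ≡ threadOf P (lookup L j) → i < j → f i < f j
    local-mono {i} {j} ni nj e i<j with swapPos-mono A a b C i<j
    ... | inj₂ p = p
    ... | inj₁ (ei , ej) with lookup L i | lookup-first A a (b ∷ C) i ei | lookup L j | lookup-second A a b C j ej
    ... | _ | refl | _ | refl = ⊥-elim (local≢ ni nj e)

    IssuedAt-local : ∀ {j i} → IssuedAt P L j i → NonCom (lookup L i) × threadOf P (lookup L i) ≡ threadOf P (lookup L j)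
    IssuedAt-local {j} (rd e) rewrite e = rd , refl
    IssuedAt-local {j} {i} (com ej ei n) rewrite ej | ei = isu , refl

    po-swapPos : ∀ {ρ ρ′ i j} → po P L ρ i j → po P L′ ρ′ (f i) (f j)
    po-swapPos {i = i} {j} (e , i′ , j′ , ii , jj , i<j) =
      trans (cong (threadOf P) (lookup-swapPos A a b C i)) (trans e (cong (threadOf P) (sym (lookup-swapPos A a b C j)))) ,
      f i′ , f j′ , IssuedAt-swapPos ii , IssuedAt-swapPos jj ,
      local-mono (proj₁ (IssuedAt-local ii)) (proj₁ (IssuedAt-local jj))
        (trans (proj₂ (IssuedAt-local ii)) (trans e (sym (proj₂ (IssuedAt-local jj))))) i<j

    Store-swapPos : ∀ {x v c} → Store P L x v c → Store P L′ x v (Maybe.map f c)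
    Store-swapPos init    = init
    Store-swapPos (com e) = com (at′ e)

    StoreOrder-swapPos : ∀ {c d} → StoreOrder P L c d → StoreOrder P L′ (Maybe.map f c) (f d)
    StoreOrder-swapPos (x , v , v′ , sc , sd , v≢ , pre) =
      x , v , v′ , Store-swapPos sc , Store-swapPos sd , v≢ , precedes sc sd pre
      where
      precedes : ∀ {c d} → Store P L x v c → Store P L x v′ (just d) → Precedes P L c d → Precedes P L′ (Maybe.map f c) (f d)
      precedes _ _ init = init
      precedes (com {c = c} ec) (com {c = d} ed) (com c<d) with swapPos-mono A a b C c<d
      ... | inj₂ p = com p
      ... | inj₁ (e₁ , e₂) = ⊥-elim (v≢ (store≡
        (trans (sym (lookup-first A a _ c e₁)) ec) (trans (sym (lookup-second A a b C d e₂)) ed)))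

  IsNode-irrelevant : ∀ {a} (p q : IsNode P a) → p ≡ q
  IsNode-irrelevant com com = refl
  IsNode-irrelevant rd  rd  = refl

  -- A commit is never moved to the right of a read, as the read might read from it.
  record Swappable (A : List Act) (a b : Act) (C : List Act) : Set where
    field
      independent : Independent a b
      com-rd      : ∀ {t x v u y w} → a ≡ com t x v → b ≢ rd u y w
      rd-com      : ∀ {t x v u w} → a ≡ rd t x v → b ≡ com u x w → v ≡ w ⊎
                    (∀ r → toℕ r ≡ length A → ∃[ c ] Pending P (swapped A a b C) t x c r)

  module _ {A : List Act} {a b : Act} {C : List Act} (sw : Swappable A a b C) where
    open Swappable sw
    private
      L L′ : List Act
      L  = swapped A a b C
      L′ = swapped A b a C
      f : Pos P L → Pos P L′
      f = swapPos A a b C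
      g : Pos P L′ → Pos P L
      g = swapPos A b a C
      fg : ∀ i → f (g i) ≡ i
      fg = swapPos-involutive A b a C
      gf : ∀ i → g (f i) ≡ i
      gf = swapPos-involutive A a b C
      at′ : ∀ {c i} → lookup L i ≡ c → lookup L′ (f i) ≡ c
      at′ {i = i} = trans (lookup-swapPos A a b C i)
      at″ : ∀ {c i} → lookup L′ i ≡ c → lookup L (g i) ≡ c
      at″ {i = i} = trans (lookup-swapPos A b a C i)
      ind′ : Independent b a
      ind′ = Independent-sym independent

    -- Only this direction holds: a commit that moves left past the read is no longer pending there,
    -- while the move that would make a commit pending is excluded by `com-rd`.
    Pending-unswap : ∀ {t x v c r} → lookup L′ r ≡ rd t x v → Pending P L′ t x c r → Pending P L t x (g c) (g r)
    Pending-unswap {t} {x} {v} {c} {r} er (w , i , ec , ci , i<r , r<c) =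
      w , g i , at″ ec , IssuedAt-swapPos ind′ ci , i<r′ , r<c′
      where
      i<r′ : g i < g r
      i<r′ with IssuedAt-local ind′ ci
      ... | ni , ti = local-mono ind′ ni (subst NonCom (sym er) rd)
            (trans ti (trans (cong (threadOf P) ec) (cong (threadOf P) (sym er)))) i<r
      r<c′ : g r < g c
      r<c′ with swapPos-mono A b a C r<c
      ... | inj₂ p = p
      ... | inj₁ (e₁ , e₂) = ⊥-elim (com-rd (trans (sym (lookup-second A b a C c e₂)) ec)
                                            (trans (sym (lookup-first A b _ r e₁)) er))

    -- The read keeps the same commit as its source, but not always the same constructor: `buffer`
    -- becomes `memory` when the read is swapped with the very commit it reads from.
    ReadsFrom-swap : ∀ {t x v r c} → lookup L r ≡ rd t x v → ReadsFrom P L t x v r c →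
      ReadsFrom P L′ t x v (f r) (Maybe.map f c)
    ReadsFrom-swap {t} {x} {v} {r} er = go
      where
      unpend : ∀ {c} → Pending P L′ t x c (f r) → Pending P L t x (g c) r
      unpend p = subst (Pending P L t x _) (gf r) (Pending-unswap (at′ er) p)

      noPending : NoPending P L t x r → NoPending P L′ t x (f r)
      noPending np c p = np (g c) (unpend p)

      -- The only commit that can newly precede the read is the one swapped with it. By `rd-com` it
      -- writes the value read, since the alternative, a pending commit, contradicts `np`.
      before : NoPending P L t x r → ∀ {d u w} → lookup L d ≡ com u x w → f d < f r → d < r ⊎ w ≡ v
      before np {d} ed fd<fr with swapPos-mono A b a C fd<fr
      ... | inj₂ p = inj₁ (subst₂ _<_ (gf d) (gf r) p)
      ... | inj₁ (e₁ , e₂) with trans (cong toℕ (sym (gf d))) (swapPos-first A b a C (f d) e₁)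
                              | trans (cong toℕ (sym (gf r))) (swapPos-second A b a C (f r) e₂)
      ... | d2 | r1 with rd-com (trans (sym (lookup-first A a _ r r1)) er) (trans (sym (lookup-second A a b C d d2)) ed)
      ... | inj₁ v≡w = inj₂ (sym v≡w)
      ... | inj₂ pend = ⊥-elim (np _ (proj₂ (pend r r1)))

      after : ∀ {c d u u′ w} → lookup L c ≡ com u x v → lookup L d ≡ com u′ x w → f c < f d → c < d ⊎ w ≡ v
      after {c} {d} ec ed fc<fd with swapPos-mono A b a C fc<fd
      ... | inj₂ p = inj₁ (subst₂ _<_ (gf c) (gf d) p)
      ... | inj₁ (e₁ , e₂) = inj₂ (Independent.store≡ independent
          (trans (sym (lookup-second A b a C (f d) e₂)) (at′ ed)) (trans (sym (lookup-first A b _ (f c) e₁)) (at′ ec)))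

      c≤ : ∀ {c c′ v v′} → lookup L c ≡ com t x v → lookup L c′ ≡ com t x v′ → c′ ≤ c → f c′ ≤ f c
      c≤ {c} {c′} ec ec′ le with ℕₚ.m≤n⇒m<n∨m≡n le
      ... | inj₂ e = ℕₚ.≤-reflexive (cong (λ i → toℕ (f i)) (toℕ-injective e))
      ... | inj₁ lt with swapPos-mono A a b C lt
      ... | inj₂ p = ℕₚ.<⇒≤ p
      ... | inj₁ (e₁ , e₂) = ⊥-elim (Independent.commit≢ independent
          (trans (sym (lookup-first A a _ c′ e₁)) ec′) (trans (sym (lookup-second A a b C c e₂)) ec))

      go : ∀ {c} → ReadsFrom P L t x v r c → ReadsFrom P L′ t x v (f r) (Maybe.map f c)
      go (memory {c} {u} np ec c<r all) = memory (noPending np) (at′ ec) fc<fr all′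
        where
        fc<fr : f c < f r
        fc<fr with swapPos-mono A a b C c<r
        ... | inj₂ p = p
        ... | inj₁ (e₁ , e₂) = ⊥-elim (com-rd (trans (sym (lookup-first A a _ c e₁)) ec)
                                              (trans (sym (lookup-second A a b C r e₂)) er))
        all′ : ∀ d u′ v′ → lookup L′ d ≡ com u′ x v′ → f c < d → d < f r → v′ ≡ v
        all′ d u′ v′ ed c<d d<r with before np (at″ ed) (subst (_< f r) (sym (fg d)) d<r)
                                   | after ec (at″ ed) (subst (f c <_) (sym (fg d)) c<d)
        ... | inj₂ e | _      = e
        ... | inj₁ _ | inj₂ e = e
        ... | inj₁ p | inj₁ q = all (g d) u′ v′ (at″ ed) q p
      go (initial np v≡0 all) = initial (noPending np) v≡0 all′
        where
        all′ : ∀ d u′ v′ → lookup L′ d ≡ com u′ x v′ → d < f r → v′ ≡ v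
        all′ d u′ v′ ed d<r with before np (at″ ed) (subst (_< f r) (sym (fg d)) d<r)
        ... | inj₂ e = e
        ... | inj₁ p = all (g d) u′ v′ (at″ ed) p
      go (buffer {c} ec (w , i , ec′ , ci , i<r , r<c) max) with swapPos-mono A a b C r<c
      ... | inj₂ fr<fc = buffer (at′ ec)
            (w , f i , at′ ec′ , IssuedAt-swapPos independent ci , fi<fr , fr<fc)
            max′
        where
        fi<fr : f i < f r
        fi<fr with IssuedAt-local independent ci
        ... | ni , ti = local-mono independent ni (subst NonCom (sym er) rd)
              (trans ti (trans (cong (threadOf P) ec) (cong (threadOf P) (sym er)))) i<r
        max′ : ∀ c′ → Pending P L′ t x c′ (f r) → c′ ≤ f c
        max′ c′ p@(_ , _ , ec″ , _) = subst (_≤ f c) (fg c′) (c≤ ec (at″ ec″) (max (g c′) (unpend p)))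
      -- Here `c` directly follows `r` and is the last pending commit, hence the only one. After the
      -- swap it directly precedes the read, so nothing is pending and no commit lies in between.
      ... | inj₁ (e₁ , e₂) = memory none (at′ ec)
            (subst₂ ℕ._<_ (sym (swapPos-second A a b C c e₂)) (sym (swapPos-first A a b C r e₁)) (ℕₚ.n<1+n _))
            λ d _ _ _ c<d d<r → ⊥-elim (ℕₚ.<-irrefl refl (ℕₚ.<-≤-trans
                (subst (ℕ._< toℕ d) (swapPos-second A a b C c e₂) c<d)
                (ℕₚ.≤-pred (subst (toℕ d ℕ.<_) (swapPos-first A a b C r e₁) d<r))))
        where
        none : NoPending P L′ t x (f r)
        none c′ p@(_ , _ , _ , _ , _ , fr<c′) with unpend p
        ... | q@(_ , _ , _ , _ , _ , r<gc′) with toℕ-injective (ℕₚ.≤-antisym (max (g c′) q)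
                (subst (ℕ._≤ toℕ (g c′)) (trans (cong suc e₁) (sym e₂)) r<gc′))
        ... | refl = ℕₚ.<-asym fr<c′ (subst (_< f r) (fg c′)
            (subst₂ ℕ._<_ (sym (swapPos-second A a b C c e₂)) (sym (swapPos-first A a b C r e₁)) (ℕₚ.n<1+n _)))

    SameTrace-swap : SameTrace P (swapped A a b C) (swapped A b a C)
    SameTrace-swap ρ = ρ′ , record
      { nodes   = mk↔ₛ′ to from to∘from from∘to
      ; actions = λ (i , _) → lookup-swapPos A a b C i
      ; edges   = λ (i , _) (j , _) → mk⇔ edge→ edge←
      }
      where
      open Sources ρ
      ρ′ : Sources P L′
      ρ′ = record
        { source  = λ r → Maybe.map f (source (g r))
        ; correct = λ {r} er → subst (λ r′ → ReadsFrom P L′ _ _ _ r′ (Maybe.map f (source (g r)))) (fg r) (ReadsFrom-swap (at″ er) (correct (at″ er)))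
        }
      to : Trace.Node (Tr P L ρ) → Trace.Node (Tr P L′ ρ′)
      to (i , n) = f i , subst (IsNode P) (sym (lookup-swapPos A a b C i)) n
      from : Trace.Node (Tr P L′ ρ′) → Trace.Node (Tr P L ρ)
      from (i , n) = g i , subst (IsNode P) (sym (lookup-swapPos A b a C i)) n
      node≡ : ∀ {π} {i j : Pos P π} {n : IsNode P (lookup π i)} {m : IsNode P (lookup π j)} →
              i ≡ j → _≡_ {A = Σ (Pos P π) (λ k → IsNode P (lookup π k))} (i , n) (j , m)
      node≡ {n = n} {m} refl = cong (_ ,_) (IsNode-irrelevant n m)
      to∘from : ∀ n → to (from n) ≡ n
      to∘from (i , _) = node≡ {L′} (fg i)
      from∘to : ∀ n → from (to n) ≡ n
      from∘to (i , _) = node≡ {L} (gf i)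

      map-gf : ∀ (c : Maybe (Pos P L)) → Maybe.map g (Maybe.map f c) ≡ c
      map-gf nothing  = refl
      map-gf (just c) = cong just (gf c)

      source-gf : ∀ r → source (g (f r)) ≡ source r
      source-gf r = cong source (gf r)

      edge→ : ∀ {i j} → hb P L ρ i j → hb P L′ ρ′ (f i) (f j)
      edge→ (inj₁ e) = inj₁ (po-swapPos independent {ρ} {ρ′} e)
      edge→ (inj₂ (inj₁ e)) = inj₂ (inj₁ (StoreOrder-swapPos independent e))
      edge→ {i} {j} (inj₂ (inj₂ (inj₁ ((t , x , v , ej) , e)))) =
        inj₂ (inj₂ (inj₁ ((t , x , v , at′ ej) , cong (Maybe.map f) (trans (source-gf j) e))))
      edge→ {i} {j} (inj₂ (inj₂ (inj₂ (t , x , v , ei , st , so)))) = inj₂ (inj₂ (inj₂ (t , x , v , at′ ei ,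
        subst (λ c → Store P L′ x v (Maybe.map f c)) (sym (source-gf i)) (Store-swapPos independent st) ,
        subst (λ c → StoreOrder P L′ (Maybe.map f c) (f j)) (sym (source-gf i)) (StoreOrder-swapPos independent so))))

      edge←′ : ∀ {i j} → hb P L′ ρ′ i j → hb P L ρ (g i) (g j)
      edge←′ (inj₁ e) = inj₁ (po-swapPos ind′ {ρ′} {ρ} e)
      edge←′ (inj₂ (inj₁ e)) = inj₂ (inj₁ (StoreOrder-swapPos ind′ e))
      edge←′ {i} {j} (inj₂ (inj₂ (inj₁ ((t , x , v , ej) , e)))) =
        inj₂ (inj₂ (inj₁ ((t , x , v , at″ ej) , trans (sym (map-gf (source (g j)))) (cong (Maybe.map g) e))))
      edge←′ {i} {j} (inj₂ (inj₂ (inj₂ (t , x , v , ei , st , so)))) = inj₂ (inj₂ (inj₂ (t , x , v , at″ ei ,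
        subst (Store P L x v) (map-gf (source (g i))) (Store-swapPos ind′ st) ,
        subst (λ c → StoreOrder P L c (g j)) (map-gf (source (g i))) (StoreOrder-swapPos ind′ so))))

      edge← : ∀ {i j} → hb P L′ ρ′ (f i) (f j) → hb P L ρ i j
      edge← {i} {j} e = subst₂ (hb P L ρ) (gf i) (gf j) (edge←′ e)

  isu-position : ∀ t A π {m} → m ℕ.< #isu P t A → ∃[ i ]
    toℕ i ℕ.< length A × lookup (A ++ π) i ≡ isu t × #isu P t (take (toℕ i) (A ++ π)) ≡ m
  isu-position t (c ∷ A) π {m} m< with c
  isu-position t (_ ∷ A) π {m} m< | isu u with t ≟ u
  isu-position t (_ ∷ A) π {zero} m< | isu .t | yes refl = zero , z<s , refl , refl
  isu-position t (_ ∷ A) π {suc m} (s≤s m<) | isu .t | yes refl with isu-position t A π m<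
  ... | i , i< , ei , e = suc i , s<s i< , ei ,
        trans (Additive.on-∷ (#isu-additive t) (isu t) _) (cong₂ _+_ (#isu-own t) e)
  isu-position t (_ ∷ A) π {m} m< | isu u | no t≢u with isu-position t A π m<
  ... | i , i< , ei , e = suc i , s<s i< , ei ,
        trans (Additive.on-∷ (#isu-additive t) (isu u) _)
          (cong₂ _+_ (#isu-other t (isu u) (λ { refl → t≢u refl })) e)
  isu-position t (_ ∷ A) π m< | com _ _ _ with isu-position t A π m<
  ... | i , i< , ei , e = suc i , s<s i< , ei , e
  isu-position t (_ ∷ A) π m< | rd _ _ _ with isu-position t A π m<
  ... | i , i< , ei , e = suc i , s<s i< , ei , e
  isu-position t (_ ∷ A) π m< | tau _ with isu-position t A π m<
  ... | i , i< , ei , e = suc i , s<s i< , ei , e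

  split-position : ∀ (A : List Act) a π → Σ (Pos P (A ++ a ∷ π)) λ i →
    toℕ i ≡ length A × lookup (A ++ a ∷ π) i ≡ a × take (toℕ i) (A ++ a ∷ π) ≡ A
  split-position []      a π = zero , refl , refl , refl
  split-position (c ∷ A) a π with split-position A a π
  ... | i , e₁ , e₂ , e₃ = suc i , cong suc e₁ , e₂ , cong (c ∷_) e₃

  -- The commit after `A ++ B` has as many commits of `t` before it as `A` and `B` contain. This
  -- number is below that of the issues in `A`, so the matching issue lies in `A`, before `r`; as
  -- `B` is not empty, the commit comes after `r`.
  Pending-intro : ∀ {t x w} A B {π} C → π ≡ A ++ B ++ com t x w ∷ C → 0 ℕ.< length B →
    #com P t A + #com P t B ℕ.< #isu P t A → ∀ r → toℕ r ≡ length A → ∃[ c ] Pending P π t x c r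
  Pending-intro {t} {x} {w} A B C refl 0<B n< r er
    with split-position (A ++ B) (com t x w) C | isu-position t A (B ++ com t x w ∷ C) n<
  ... | c , ec₁ , ec₂ , ec₃ | i , i< , ei , e
    with subst (λ π → Σ (Pos P π) λ c → toℕ c ≡ length (A ++ B) × lookup π c ≡ com t x w × take (toℕ c) π ≡ A ++ B)
           (++-assoc A B (com t x w ∷ C)) (c , ec₁ , ec₂ , ec₃)
  ... | c′ , l₁ , l₂ , l₃ = c′ , w , i , l₂ ,
    com l₂ ei (trans e (sym (trans (cong (#com P t) l₃) (Additive.on-++ (#com-additive t) A B)))) ,
    subst (toℕ i ℕ.<_) (sym er) i< ,
    subst₂ ℕ._<_ (trans (+-identityʳ _) (sym er)) (sym (trans l₁ (length-++ A))) (ℕₚ.+-monoʳ-< (length A) 0<B)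

  Independent-com : ∀ {a t x v} → NonCom a → Independent a (com t x v)
  Independent-com isu = record { local≢ = λ _ () ; commit≢ = λ () ; store≡ = λ () }
  Independent-com rd  = record { local≢ = λ _ () ; commit≢ = λ () ; store≡ = λ () }
  Independent-com tau = record { local≢ = λ _ () ; commit≢ = λ () ; store≡ = λ () }

  swap-local : ∀ {A a b C} → NonCom a → NonCom b → threadOf P a ≢ threadOf P b →
    SameTrace P (A ++ a ∷ b ∷ C) (A ++ b ∷ a ∷ C)
  swap-local {A} {a} {b} {C} na nb t≢ = SameTrace-swap record
    { independent = record
      { local≢  = λ _ _ → t≢
      ; commit≢ = λ { refl → ⊥-elim (¬com na) }
      ; store≡  = λ { refl → ⊥-elim (¬com na) } }
    ; com-rd = λ { refl → ⊥-elim (¬com na) }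
    ; rd-com = λ { _ refl → ⊥-elim (¬com nb) }
    }
    where
    ¬com : ∀ {t x v} → ¬ NonCom (com t x v)
    ¬com ()

  swap-com : ∀ {A t x v u y w C} → t ≢ u → (x ≡ y → v ≡ w) →
    SameTrace P (A ++ com t x v ∷ com u y w ∷ C) (A ++ com u y w ∷ com t x v ∷ C)
  swap-com t≢u v≡w = SameTrace-swap record
    { independent = record
      { local≢ = λ () ; commit≢ = λ { refl refl → t≢u refl } ; store≡ = λ { refl refl → v≡w refl } }
    ; com-rd = λ _ ()
    ; rd-com = λ ()
    }

  swap-rd-com : ∀ {A t x v u y w C} → (x ≡ y → v ≡ w ⊎
      (∀ r → toℕ r ≡ length A → ∃[ c ] Pending P (A ++ rd t x v ∷ com u y w ∷ C) t x c r)) →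
    SameTrace P (A ++ rd t x v ∷ com u y w ∷ C) (A ++ com u y w ∷ rd t x v ∷ C)
  swap-rd-com cond = SameTrace-swap record
    { independent = Independent-com rd ; com-rd = λ () ; rd-com = λ { refl refl → cond refl } }

  swap-isu-com : ∀ {A t u y w C} → SameTrace P (A ++ isu t ∷ com u y w ∷ C) (A ++ com u y w ∷ isu t ∷ C)
  swap-isu-com = SameTrace-swap record { independent = Independent-com isu ; com-rd = λ () ; rd-com = λ () }

  swap-tau-com : ∀ {A t u y w C} → SameTrace P (A ++ tau t ∷ com u y w ∷ C) (A ++ com u y w ∷ tau t ∷ C)
  swap-tau-com = SameTrace-swap record { independent = Independent-com tau ; com-rd = λ () ; rd-com = λ () }

-- SC executions as histories, and left movers

module Histories {V : ValueDomain} (P : Program V) where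
  open ValueDomain V
  open Program P

  update-same : ∀ {n} {B : Fin n → Set} (f : (i : Fin n) → B i) i b → _⟨_↦_⟩ {B = B} f i b i ≡ b
  update-same f i b with i ≟ i
  ... | yes refl = refl
  ... | no  i≢i  = ⊥-elim (i≢i refl)

  update-other : ∀ {n} {B : Fin n → Set} (f : (i : Fin n) → B i) i b {j} → j ≢ i → _⟨_↦_⟩ {B = B} f i b j ≡ f j
  update-other f i b {j} j≢i with i ≟ j
  ... | yes refl = ⊥-elim (j≢i refl)
  ... | no  _    = refl

  -- States are functions without extensional equality, so an update is a pointwise relation that
  -- any function with the right values satisfies.
  record Update {n} {B : Fin n → Set} (f : (i : Fin n) → B i) (i : Fin n) (b : B i) (f′ : (i : Fin n) → B i) : Set where
    constructor upd
    field
      at  : f′ i ≡ b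
      off : ∀ j → j ≢ i → f′ j ≡ f j

  open Update public

  update : ∀ {n} {B : Fin n → Set} {f : (i : Fin n) → B i} {i b} → Update {B = B} f i b (_⟨_↦_⟩ {B = B} f i b)
  update {f = f} {i} {b} = upd (update-same f i b) (λ j → update-other f i b)

  Loc : Thread P → Set
  Loc t = Label × Vec D (nReg t)

  loc₁-same : ∀ (pc : PC P) (reg : Regs P) t {q} → _≡_ {A = Loc t} ((pc ⟨ t ↦ q ⟩) t , reg t) (q , reg t)
  loc₁-same pc reg t = cong (_, reg t) (update-same pc t _)

  loc₁-other : ∀ (pc : PC P) (reg : Regs P) t {q} s → s ≢ t → _≡_ {A = Loc s} ((pc ⟨ t ↦ q ⟩) s , reg s) (pc s , reg s)
  loc₁-other pc reg t s s≢t = cong (_, reg s) (update-other pc t _ s≢t)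

  loc₂-same : ∀ (pc : PC P) (reg : Regs P) t {q ρ} → _≡_ {A = Loc t} ((pc ⟨ t ↦ q ⟩) t , (reg ⟨ t ↦ ρ ⟩) t) (q , ρ)
  loc₂-same pc reg t = cong₂ _,_ (update-same pc t _) (update-same reg t _)

  loc₂-other : ∀ (pc : PC P) (reg : Regs P) t {q ρ} s → s ≢ t →
    _≡_ {A = Loc s} ((pc ⟨ t ↦ q ⟩) s , (reg ⟨ t ↦ ρ ⟩) s) (pc s , reg s)
  loc₂-other pc reg t s s≢t = cong₂ _,_ (update-other pc t _ s≢t) (update-other reg t _ s≢t)

  -- Exactly what a label reveals about a step: `wr` covers writes and successful cas, `rd` covers
  -- reads and failed cas.
  data Op : Set where
    tau : Op
    rd  : Var P → D → Op
    wr  : Var P → D → Op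

  data NonWrite : Op → Set where
    tau : NonWrite tau
    rd  : ∀ {x v} → NonWrite (rd x v)

  label : Thread P → Op → List (Action P)
  label t tau      = tau t ∷ []
  label t (rd x v) = rd t x v ∷ []
  label t (wr x v) = isu t ∷ com t x v ∷ []

  label-injective : ∀ {t o u o′} → label t o ≡ label u o′ → (t , o) ≡ (u , o′)
  label-injective {o = tau}    {o′ = tau}    refl = refl
  label-injective {o = rd _ _} {o′ = rd _ _} refl = refl
  label-injective {o = wr _ _} {o′ = wr _ _} refl = refl

  apply : Op → Mem P → Mem P
  apply (wr x v) M = M ⟨ x ↦ v ⟩
  apply tau      M = M
  apply (rd _ _) M = M

  apply-cong : ∀ o {M M′ : Mem P} → (∀ x → M x ≡ M′ x) → ∀ x → apply o M x ≡ apply o M′ x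
  apply-cong tau      e = e
  apply-cong (rd _ _) e = e
  apply-cong (wr y v) e x with y ≟ x
  ... | yes refl = refl
  ... | no  _    = e x

  apply-nonWrite : ∀ {o M} → NonWrite o → apply o M ≡ M
  apply-nonWrite tau = refl
  apply-nonWrite rd  = refl

  -- Histories list the steps of an SC execution, newest first.
  History : Set
  History = List (Thread P × Op)

  eval : History → Mem P
  eval []            = λ _ → 0#
  eval ((_ , o) ∷ E) = apply o (eval E)

  labelsOf : History → List (List (Action P))
  labelsOf []            = []
  labelsOf ((t , o) ∷ E) = labelsOf E ∷ʳ label t o

  data LStep (t : Thread P) (M : Mem P) : Loc t → Fin (nInst t) → Op → Loc t → Set where
    write : ∀ {pc ρ i x e} → pc ≡ Src P t i → InstAt P t i ≡ write x e →
      LStep t M (pc , ρ) i (wr x (e ρ)) (Tgt P t i , ρ)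
    assign : ∀ {pc ρ i r e} → pc ≡ Src P t i → InstAt P t i ≡ assign r e →
      LStep t M (pc , ρ) i tau (Tgt P t i , ρ [ r ]≔ e ρ)
    read : ∀ {pc ρ i r x v} → pc ≡ Src P t i → InstAt P t i ≡ read r x → M x ≡ v →
      LStep t M (pc , ρ) i (rd x v) (Tgt P t i , ρ [ r ]≔ v)
    fence : ∀ {pc ρ i} → pc ≡ Src P t i → InstAt P t i ≡ fence →
      LStep t M (pc , ρ) i tau (Tgt P t i , ρ)
    cas-success : ∀ {pc ρ i r x e₁ e₂} → pc ≡ Src P t i → InstAt P t i ≡ cas r x e₁ e₂ → M x ≡ e₁ ρ →
      LStep t M (pc , ρ) i (wr x (e₂ ρ)) (Tgt P t i , ρ [ r ]≔ 1#)
    cas-failure : ∀ {pc ρ i r x e₁ e₂ v} → pc ≡ Src P t i → InstAt P t i ≡ cas r x e₁ e₂ → M x ≡ v → v ≢ e₁ ρ →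
      LStep t M (pc , ρ) i (rd x v) (Tgt P t i , ρ [ r ]≔ 0#)
    skip : ∀ {pc ρ i} → pc ≡ Src P t i → InstAt P t i ≡ skip →
      LStep t M (pc , ρ) i tau (Tgt P t i , ρ)
    assume : ∀ {pc ρ i b} → pc ≡ Src P t i → InstAt P t i ≡ assume b → b ρ ≡ true →
      LStep t M (pc , ρ) i tau (Tgt P t i , ρ)

  LStep-cong : ∀ {t M M′ l i o l′} → (∀ x → M x ≡ M′ x) → LStep t M l i o l′ → LStep t M′ l i o l′
  LStep-cong e (write p q)           = write p q
  LStep-cong e (assign p q)          = assign p q
  LStep-cong e (read p q r)          = read p q (trans (sym (e _)) r)
  LStep-cong e (fence p q)           = fence p q
  LStep-cong e (cas-success p q r)   = cas-success p q (trans (sym (e _)) r)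
  LStep-cong e (cas-failure p q r s) = cas-failure p q (trans (sym (e _)) r) s
  LStep-cong e (skip p q)            = skip p q
  LStep-cong e (assume p q r)        = assume p q r

  LStep-rd : ∀ {t M l i x v l′} → LStep t M l i (rd x v) l′ → M x ≡ v
  LStep-rd (read _ _ r)          = r
  LStep-rd (cas-failure _ _ r _) = r

  Locs : Set
  Locs = (t : Thread P) → Loc t

  initLoc : Locs
  initLoc t = start t , replicate (nReg t) 0#

  -- Only the operations are recorded: the instructions that generate them may
  -- differ between two runs of the same history.
  data Run : History → Locs → Set where
    []   : ∀ {l} → (∀ t → l t ≡ initLoc t) → Run [] l
    step : ∀ {E l t i o lt l′} → Run E l → LStep t (eval E) (l t) i o lt → Update l t lt l′ → Run ((t , o) ∷ E) l′

  Run-cong : ∀ {E l l′} → (∀ t → l′ t ≡ l t) → Run E l → Run E l′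
  Run-cong e ([] p)       = [] (λ t → trans (e t) (p t))
  Run-cong e (step r s u) = step r s (upd (trans (e _) (at u)) (λ j j≢ → trans (e j) (off u j j≢)))

  -- Correspondence with the given SC semantics

  locOf : SCState P → Locs
  locOf s t = SCState.pc s t , SCState.reg s t

  record Represents (s : SCState P) (l : Locs) (M : Mem P) : Set where
    constructor rep
    field
      locs : ∀ t → locOf s t ≡ l t
      mems : ∀ x → SCState.mem s x ≡ M x

  open Represents

  SCStep⇒LStep : ∀ {s t i as s′} → SCStep P s t i as s′ → ∃[ o ]
    as ≡ label t o × LStep t (SCState.mem s) (locOf s t) i o (locOf s′ t) ×
    (∀ u → u ≢ t → locOf s′ u ≡ locOf s u) × SCState.mem s′ ≡ apply o (SCState.mem s)
  SCStep⇒LStep {⟪ pc , mem , reg ⟫} {t} st = go st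
    where
    res : ∀ {i o l l′} → l ≡ l′ → LStep t mem (pc t , reg t) i o l′ → LStep t mem (pc t , reg t) i o l
    res refl s = s
    go : ∀ {i as s′} → SCStep P ⟪ pc , mem , reg ⟫ t i as s′ → ∃[ o ]
      as ≡ label t o × LStep t mem (pc t , reg t) i o (locOf s′ t) ×
      (∀ u → u ≢ t → locOf s′ u ≡ (pc u , reg u)) × SCState.mem s′ ≡ apply o mem
    go (write p q)         = _ , refl , res (loc₁-same pc reg t) (write p q) , loc₁-other pc reg t , refl
    go (assign p q)        = _ , refl , res (loc₂-same pc reg t) (assign p q) , loc₂-other pc reg t , refl
    go (read p q)          = _ , refl , res (loc₂-same pc reg t) (read p q refl) , loc₂-other pc reg t , refl
    go (fence p q)         = _ , refl , res (loc₁-same pc reg t) (fence p q) , loc₁-other pc reg t , refl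
    go (cas-success p q r) = _ , refl , res (loc₂-same pc reg t) (cas-success p q r) , loc₂-other pc reg t , refl
    go (cas-failure p q r) = _ , refl , res (loc₂-same pc reg t) (cas-failure p q refl r) , loc₂-other pc reg t , refl
    go (skip p q)          = _ , refl , res (loc₁-same pc reg t) (skip p q) , loc₁-other pc reg t , refl
    go (assume p q r)      = _ , refl , res (loc₁-same pc reg t) (assume p q r) , loc₁-other pc reg t , refl

  LStep⇒SCStep : ∀ s {t i o lt} → LStep t (SCState.mem s) (locOf s t) i o lt → ∃[ s′ ]
    SCStep P s t i (label t o) s′ × locOf s′ t ≡ lt ×
    (∀ u → u ≢ t → locOf s′ u ≡ locOf s u) × SCState.mem s′ ≡ apply o (SCState.mem s)
  LStep⇒SCStep ⟪ pc , mem , reg ⟫ {t} = go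
    where
    go : ∀ {i o lt} → LStep t mem (pc t , reg t) i o lt → ∃[ s′ ]
      SCStep P ⟪ pc , mem , reg ⟫ t i (label t o) s′ × locOf s′ t ≡ lt ×
      (∀ u → u ≢ t → locOf s′ u ≡ (pc u , reg u)) × SCState.mem s′ ≡ apply o mem
    go (write p q)              = _ , write p q , loc₁-same pc reg t , loc₁-other pc reg t , refl
    go (assign p q)             = _ , assign p q , loc₂-same pc reg t , loc₂-other pc reg t , refl
    go (read p q refl)          = _ , read p q , loc₂-same pc reg t , loc₂-other pc reg t , refl
    go (fence p q)              = _ , fence p q , loc₁-same pc reg t , loc₁-other pc reg t , refl
    go (cas-success p q r)      = _ , cas-success p q r , loc₂-same pc reg t , loc₂-other pc reg t , refl
    go (cas-failure p q refl r) = _ , cas-failure p q r , loc₂-same pc reg t , loc₂-other pc reg t , refl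
    go (skip p q)               = _ , skip p q , loc₁-same pc reg t , loc₁-other pc reg t , refl
    go (assume p q r)           = _ , assume p q r , loc₁-same pc reg t , loc₁-other pc reg t , refl

  infixr 5 _++ₚ_
  _++ₚ_ : ∀ {s s′ s″ es es′} → SCPath P s es s′ → SCPath P s′ es′ s″ → SCPath P s (es ++ es′) s″
  []      ++ₚ q = q
  (s ∷ p) ++ₚ q = s ∷ (p ++ₚ q)

  extend : ∀ {s l M t i o lt l′} → Represents s l M → LStep t M (l t) i o lt → Update l t lt l′ →
    ∃[ s′ ] SCPath P s (event t i (label t o) ∷ []) s′ × Represents s′ l′ (apply o M)
  extend {s} {t = t} {i} {o} {lt} (rep ls ms) st u
    with LStep⇒SCStep s (subst (λ l → LStep t (SCState.mem s) l i o lt) (sym (ls t)) (LStep-cong (λ x → sym (ms x)) st))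
  ... | s′ , st′ , on , away , em = s′ , st′ ∷ [] , rep locs′ (λ x → trans (cong (λ f → f x) em) (apply-cong o ms x))
    where
    locs′ : ∀ u′ → locOf s′ u′ ≡ _
    locs′ u′ with u′ ≟ t
    ... | yes refl = trans on (sym (at u))
    ... | no  u≢   = trans (away u′ u≢) (trans (ls u′) (sym (off u u′ u≢)))

  Run⇒SCPath : ∀ {E l} → Run E l → ∃[ es ] ∃[ s ]
    SCPath P (initSC P) es s × labels P es ≡ labelsOf E × Represents s l (eval E)
  Run⇒SCPath ([] e) = [] , _ , [] , refl , rep (λ t → sym (e t)) (λ _ → refl)
  Run⇒SCPath (step {t = t} {i} {o} r st u) with Run⇒SCPath r
  ... | es , s , p , e , rs with extend rs st u
  ... | s′ , q , rs′ = es ∷ʳ event t i (label t o) , s′ , p ++ₚ q ,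
        trans (map-++ Event.label es _) (cong (_∷ʳ label t o) e) , rs′

  SCPath⇒Run : ∀ {E l s es s′} → Run E l → Represents s l (eval E) → SCPath P s es s′ → ∃[ E′ ] ∃[ l′ ]
    Run E′ l′ × labelsOf E′ ≡ labelsOf E ++ labels P es × Represents s′ l′ (eval E′)
  SCPath⇒Run r rs [] = _ , _ , r , sym (++-identityʳ _) , rs
  SCPath⇒Run {E} {l} r (rep ls ms) (_∷_ {s′ = s′} {t = t} {i} {as} {es} st p) with SCStep⇒LStep st
  ... | o , refl , st′ , away , em
    with SCPath⇒Run
           (step {l′ = locOf s′} r (subst (λ l → LStep t (eval E) l i o _) (ls t) (LStep-cong ms st′))
             (upd refl (λ u u≢ → trans (away u u≢) (ls u))))
           (rep (λ _ → refl) (λ x → trans (cong (λ f → f x) em) (apply-cong o ms x))) p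
  ... | E′ , l′ , r′ , e , rs = E′ , l′ , r′ , trans e (++-assoc (labelsOf E) _ _) , rs

  SCReaches⇒Run : ∀ {π s} → SCReaches P π s → ∃[ E ] Run E (locOf s) × labelsOf E ≡ π × (∀ x → eval E x ≡ SCState.mem s x)
  SCReaches⇒Run (es , s′ , p , e , s′≈s) with SCPath⇒Run {[]} {initLoc} ([] (λ _ → refl)) (rep (λ _ → refl) (λ _ → refl)) p
  ... | E , l , r , e′ , rep ls ms = E ,
        Run-cong (λ t → trans (cong₂ _,_ (sym (_≈_.pc-≡ s′≈s t)) (sym (_≈_.reg-≡ s′≈s t))) (ls t)) r ,
        trans e′ e , λ x → trans (sym (ms x)) (_≈_.mem-≡ s′≈s x)

  labelsOf-snoc : ∀ {E π t o} → labelsOf E ≡ π ∷ʳ label t o → ∃[ E′ ] E ≡ (t , o) ∷ E′ × labelsOf E′ ≡ π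
  labelsOf-snoc {[]} {[]} ()
  labelsOf-snoc {[]} {_ ∷ _} ()
  labelsOf-snoc {(u , o′) ∷ E} {π} e with ∷ʳ-injective (labelsOf E) π e
  ... | e₁ , e₂ with label-injective {u} {o′} e₂
  ... | refl = E , refl , e₁

  -- This makes the movers usable: the swapped execution they provide is known only by its step
  -- labels, and these determine its history, although not its instructions.
  labelsOf-injective : ∀ {E E′} → labelsOf E ≡ labelsOf E′ → E ≡ E′
  labelsOf-injective {E} {[]} e with E
  ... | [] = refl
  ... | (u , o) ∷ E₀ with labelsOf E₀ | e
  ...   | []    | ()
  ...   | _ ∷ _ | ()
  labelsOf-injective {E} {(t , o) ∷ E′} e with labelsOf-snoc {E} e
  ... | E₀ , refl , e₀ = cong ((t , o) ∷_) (labelsOf-injective e₀)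

  leftMover-swap : ∀ {E l u j o lu l₁ t i w lt l₂} → LeftMover P t i → t ≢ u →
    Run E l → LStep u (eval E) (l u) j o lu → Update l u lu l₁ →
    LStep t (eval ((u , o) ∷ E)) (l₁ t) i w lt → Update l₁ t lt l₂ →
    Run ((u , o) ∷ (t , w) ∷ E) l₂ ×
    (∀ x → eval ((u , o) ∷ (t , w) ∷ E) x ≡ eval ((t , w) ∷ (u , o) ∷ E) x)
  leftMover-swap {E} {u = u} {j} {o} {t = t} {i} {w} lm t≢u r sb ub sw uw with Run⇒SCPath r
  ... | es , s , p , e , rs with extend rs sb ub
  ... | s₁ , p₁ , rs₁ with extend rs₁ sw uw
  ... | s₂ , p₂ , rs₂
    with SCReaches⇒Run (lm (es ∷ʳ b) a [] s₂ ((p ++ₚ p₁) ++ₚ p₂) refl es b refl t≢u)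
    where
    a b : Event P
    a = event t i (label t w)
    b = event u j (label u o)
  ... | E′ , r′ , e′ , ms with labelsOf-injective {E′} {(u , o) ∷ (t , w) ∷ E} (trans e′ (trans (map-++ Event.label es _)
          (trans (cong (_++ _) e) (sym (++-assoc (labelsOf E) _ _)))))
  ... | refl = Run-cong (λ v → sym (locs rs₂ v)) r′ , λ x → trans (ms x) (mems rs₂ x)

  -- Moving writes of left movers to the left

  data Inserts (t : Thread P) : History → History → Set where
    []   : Inserts t [] []
    keep : ∀ {b E E′} → Inserts t E E′ → Inserts t (b ∷ E) (b ∷ E′)
    add  : ∀ {o E E′} → NonWrite o → Inserts t E E′ → Inserts t ((t , o) ∷ E) E′

  Inserts-refl : ∀ {t} E → Inserts t E E
  Inserts-refl []      = []
  Inserts-refl (b ∷ E) = keep (Inserts-refl E)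

  eval-Inserts : ∀ {t E E′} → Inserts t E E′ → ∀ x → eval E x ≡ eval E′ x
  eval-Inserts []                 x = refl
  eval-Inserts (keep {_ , o} ins) x = apply-cong o (eval-Inserts ins) x
  eval-Inserts (add nw ins)       x = trans (cong (λ f → f x) (apply-nonWrite nw)) (eval-Inserts ins x)

  -- Threads interact only through the memory, which the history determines.
  merge : ∀ {t E E′ p q} → Inserts t E E′ → Run E p → Run E′ q →
    ∃[ l ] Run E l × l t ≡ p t × (∀ u → u ≢ t → l u ≡ q u)
  merge {t} {p = p} {q} [] ([] ep) ([] eq) = p , [] ep , refl , λ u _ → trans (ep u) (sym (eq u))
  merge {t} (add nw ins) (step rp sp up) rq with merge ins rp rq
  ... | l , r , et , eo = _ , step r (subst (λ k → LStep t _ k _ _ _) (sym et) sp) update ,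
        trans (update-same l t _) (sym (at up)) , λ u u≢ → trans (update-other l t _ u≢) (eo u u≢)
  merge {t} {(u , o) ∷ E} (keep ins) (step rp sp up) (step rq sq uq) with merge ins rp rq | u ≟ t
  ... | l , r , et , eo | yes refl = _ , step r (subst (λ k → LStep t _ k _ _ _) (sym et) sp) update ,
        trans (update-same l t _) (sym (at up)) ,
        λ u u≢ → trans (update-other l t _ u≢) (trans (eo u u≢) (sym (off uq u u≢)))
  ... | l , r , et , eo | no u≢t = _ ,
        step r (subst (λ k → LStep u _ k _ _ _) (sym (eo u u≢t)) (LStep-cong (λ x → sym (eval-Inserts ins x)) sq)) update ,
        trans (update-other l u _ (λ e → u≢t (sym e))) (trans et (sym (off up t (λ e → u≢t (sym e))))) ,
        other
    where
    other : ∀ v → v ≢ t → (l ⟨ u ↦ _ ⟩) v ≡ _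
    other v v≢ with v ≟ u
    ... | yes refl = trans (update-same l u _) (sym (at uq))
    ... | no  v≢u  = trans (update-other l u _ v≢u) (trans (eo v v≢) (sym (off uq v v≢u)))

  -- The condition under which a commit of `v` to `x` may pass an action of another thread: store
  -- order relates only different values, and a read of `v` may be attributed to any suitable commit
  -- of `v`.
  Agrees : Var P → D → Op → Set
  Agrees x v tau      = ⊤
  Agrees x v (rd y w) = y ≡ x → w ≡ v
  Agrees x v (wr y w) = y ≡ x → w ≡ v

  -- Cut t x v n E E′ : the history E′ is E without all steps of t since one of
  -- its writes, of v to x, which is followed by n further writes of t.
  data Cut (t : Thread P) (x : Var P) (v : D) : ℕ → History → History → Set where
    root   : ∀ {E} → Cut t x v 0 ((t , wr x v) ∷ E) E
    other  : ∀ {n u o E E′} → u ≢ t → Cut t x v n E E′ → Cut t x v n ((u , o) ∷ E) ((u , o) ∷ E′)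
    silent : ∀ {n o E E′} → NonWrite o → Cut t x v n E E′ → Cut t x v n ((t , o) ∷ E) E′
    write  : ∀ {n y w E E′} → Cut t x v n E E′ → Cut t x v (suc n) ((t , wr y w) ∷ E) E′

  -- The cut write is back in its place, but the later steps of `t` are still missing.
  restore : ∀ {t x v n E E′} → Cut t x v n E E′ → History
  restore {E = E}   root                    = E
  restore {t} (other {u = u} {o} _ c) = (u , o) ∷ restore c
  restore (silent _ c)                      = restore c
  restore (write c)                         = restore c

  -- With index 0 no write of `t` follows the cut one, so the missing steps are all silent and the
  -- memories along both histories coincide.
  Inserts-restore : ∀ {t x v E E′} (c : Cut t x v 0 E E′) → Inserts t E (restore c)
  Inserts-restore root          = Inserts-refl _
  Inserts-restore (other _ c)   = keep (Inserts-restore c)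
  Inserts-restore (silent nw c) = add nw (Inserts-restore c)

  AllAgree : ∀ {t x v n E E′} → Cut t x v n E E′ → Set
  AllAgree root                            = ⊤
  AllAgree {x = x} {v} (other {o = o} _ c) = Agrees x v o × AllAgree c
  AllAgree (silent _ c)                    = AllAgree c
  AllAgree (write c)                       = AllAgree c

  record Restored {t x v n E E′} (c : Cut t x v n E E′) (l : Locs) : Set where
    constructor restored
    field
      run    : Run (restore c) l
      mem≗ : ∀ y → eval (restore c) y ≡ eval ((t , wr x v) ∷ E′) y
      agree  : AllAgree c

  -- Being possible in every memory distinguishes a write instruction from a successful cas with the
  -- same operation, so the step can be postponed to the end of a frozen run.
  IsWriteStep : (t : Thread P) → Loc t → Fin (nInst t) → Op → Loc t → Set
  IsWriteStep t l i o l′ = ∀ M → LStep t M l i o l′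

  -- Once the write of `v` precedes `o`, a read of `x` by `o` must return `v`. If `o` writes `x`, it
  -- comes last in one order and first in the other, so equal final memories force equal values.
  step-agrees : ∀ {x v u M k j o k′} → LStep u (apply (wr x v) M) k j o k′ →
    apply o (apply (wr x v) M) x ≡ apply (wr x v) (apply o M) x → Agrees x v o
  step-agrees {x} {v} {M = M} {o = tau}    s e      = tt
  step-agrees {x} {v} {M = M} {o = rd y w} s e refl = trans (sym (LStep-rd s)) (update-same M x v)
  step-agrees {x} {v} {M = M} {o = wr y w} s e refl =
    trans (sym (update-same (M ⟨ x ↦ v ⟩) x w)) (trans e (update-same (M ⟨ x ↦ w ⟩) x v))

  record Commuted (t : Thread P) (x : Var P) (v : D) (u : Thread P) (o : Op) (E : History) (l l′ : Locs) : Set where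
    field
      {before} : Locs
      {index}  : Fin (nInst u)
      run      : Run E before
      own      : before t ≡ l t
      step′    : LStep u (eval ((t , wr x v) ∷ E)) (before u) index o (l′ u)
      others   : ∀ w → w ≢ u → w ≢ t → l′ w ≡ before w
      mem≗     : ∀ y → eval ((u , o) ∷ (t , wr x v) ∷ E) y ≡ eval ((t , wr x v) ∷ (u , o) ∷ E) y

  -- The swapped run may reach the end of `E` by other instructions. Merging keeps `t` as in the
  -- original run, so that the same write is enabled at the same location and can move further, and
  -- takes all other threads from the swapped run.
  commute : ∀ {t x v u o E i l lt l′} → LeftMover P t i → u ≢ t → Run ((u , o) ∷ E) l →
    IsWriteStep t (l t) i (wr x v) lt → Update l t lt l′ → Commuted t x v u o E l l′
  commute {t} {x} {v} {u} {o} {E} {l = l} {lt} {l′} lm u≢t (step {l = l₀} r sb ub) st ut =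
    recombine (leftMover-swap lm (λ e → u≢t (sym e)) r sb ub (st _) ut)
    where
    recombine : Run ((u , o) ∷ (t , wr x v) ∷ E) l′ ×
      (∀ y → eval ((u , o) ∷ (t , wr x v) ∷ E) y ≡ eval ((t , wr x v) ∷ (u , o) ∷ E) y) → Commuted t x v u o E l l′
    recombine (step (step q sw uw) sb′ ub′ , ms) with merge (Inserts-refl E) r q
    ... | k , r′ , et , eo = record
      { run    = r′
      ; own    = trans et (sym (off ub t (λ e → u≢t (sym e))))
      ; step′  = subst₂ (λ a b → LStep u (eval ((t , wr x v) ∷ E)) a _ o b)
                   (trans (off uw u u≢t) (sym (eo u u≢t))) (sym (at ub′)) sb′
      ; others = λ w w≢u w≢t → trans (off ub′ w w≢u) (trans (off uw w w≢t) (sym (eo w w≢t)))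
      ; mem≗   = ms
      }

  -- The cut history has no steps of `t` after the cut. The write, performed at its end, therefore
  -- meets only steps of other threads on the way to its place and passes one of them at each
  -- `other`.
  moveLeft : ∀ {t x v n E E′ i l lt l′} (c : Cut t x v n E E′) → LeftMover P t i → Run E′ l →
    IsWriteStep t (l t) i (wr x v) lt → Update l t lt l′ → Restored c l′
  moveLeft root lm r st u = restored (step r (st _) u) (λ _ → refl) tt
  moveLeft (silent _ c) lm r st u = restored (Restored.run R) (Restored.mem≗ R) (Restored.agree R)
    where R = moveLeft c lm r st u
  moveLeft (write c) lm r st u = restored (Restored.run R) (Restored.mem≗ R) (Restored.agree R)
    where R = moveLeft c lm r st u
  moveLeft {t} {x} {v} {i = i} {l = l} {lt} {l′} (other {u = u} {o} {E′ = E′} u≢t c) lm r st ut = restored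
    (step (Restored.run R)
      (subst (λ k → LStep u _ k index o (l′ u)) (sym (update-other before t lt u≢t)) (LStep-cong (λ y → sym (Restored.mem≗ R y)) step′))
      (upd refl unchanged))
    (λ y → trans (apply-cong o (Restored.mem≗ R) y) (mem≗ y))
    (step-agrees step′ (mem≗ x) , Restored.agree R)
    where
    open Commuted (commute {E = E′} lm u≢t r st ut)
    st₀ : IsWriteStep t (before t) i (wr x v) lt
    st₀ M = subst (λ k → LStep t M k i (wr x v) lt) (sym own) (st M)
    R : Restored c (before ⟨ t ↦ lt ⟩)
    R = moveLeft c lm run st₀ update
    unchanged : ∀ w → w ≢ u → l′ w ≡ (before ⟨ t ↦ lt ⟩) w
    unchanged w w≢u with w ≟ t
    ... | yes refl = trans (at ut) (sym (update-same before t lt))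
    ... | no  w≢t  = trans (others w w≢u w≢t) (sym (update-other before t lt w≢t))

-- The intermediate machine with early and late writes

module Machine {V : ValueDomain} (P : Program V) where
  open import Data.Nat using (_<_; _≤_)
  open ValueDomain V
  open Program P
  open Histories P

  Buffer : Set
  Buffer = List (Var P × D)

  -- The memory as it is seen by a thread whose buffer is `b`.
  over : Mem P → Buffer → Mem P
  over M b x = fromMaybe (M x) (newest P x b)

  over-∷ : ∀ M y v b x → over M ((y , v) ∷ b) x ≡ over (M ⟨ y ↦ v ⟩) b x
  over-∷ M y v b x with y ≟ x
  ... | no _ = refl
  ... | yes refl with newest P y b
  ...   | just _  = refl
  ...   | nothing = refl

  over-∷ʳ : ∀ M b y v x → over M (b ∷ʳ (y , v)) x ≡ (over M b ⟨ y ↦ v ⟩) x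
  over-∷ʳ M [] y v x = over-∷ M y v [] x
  over-∷ʳ M ((z , w) ∷ b) y v x = trans (over-∷ M z w (b ∷ʳ (y , v)) x) (trans (over-∷ʳ (M ⟨ z ↦ w ⟩) b y v x)
    (apply-cong (wr y v) (λ x′ → sym (over-∷ M z w b x′)) x))

  newest-∷ʳ-same : ∀ x b v → newest P x (b ∷ʳ (x , v)) ≡ just v
  newest-∷ʳ-same x [] v with x ≟ x
  ... | yes _  = refl
  ... | no x≢x = ⊥-elim (x≢x refl)
  newest-∷ʳ-same x ((z , _) ∷ b) v with z ≟ x
  ... | yes _ = cong (_<∣> _) (newest-∷ʳ-same x b v)
  ... | no  _ = newest-∷ʳ-same x b v

  newest-∷ʳ-other : ∀ {x y} b v → y ≢ x → newest P x (b ∷ʳ (y , v)) ≡ newest P x b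
  newest-∷ʳ-other {x} {y} [] v y≢x with y ≟ x
  ... | yes e = ⊥-elim (y≢x e)
  ... | no  _ = refl
  newest-∷ʳ-other {x} ((z , _) ∷ b) v y≢x with z ≟ x
  ... | yes _ = cong (_<∣> _) (newest-∷ʳ-other b v y≢x)
  ... | no  _ = newest-∷ʳ-other b v y≢x

  -- The steps a thread can take while its buffer is not empty, except that the
  -- value of a read is left open.
  data DStep (t : Thread P) : Loc t → Fin (nInst t) → Op → Loc t → Set where
    write : ∀ {pc ρ i x e} → pc ≡ Src P t i → InstAt P t i ≡ write x e →
      DStep t (pc , ρ) i (wr x (e ρ)) (Tgt P t i , ρ)
    assign : ∀ {pc ρ i r e} → pc ≡ Src P t i → InstAt P t i ≡ assign r e →
      DStep t (pc , ρ) i tau (Tgt P t i , ρ [ r ]≔ e ρ)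
    read : ∀ {pc ρ i r x v} → pc ≡ Src P t i → InstAt P t i ≡ read r x →
      DStep t (pc , ρ) i (rd x v) (Tgt P t i , ρ [ r ]≔ v)
    skip : ∀ {pc ρ i} → pc ≡ Src P t i → InstAt P t i ≡ skip →
      DStep t (pc , ρ) i tau (Tgt P t i , ρ)
    assume : ∀ {pc ρ i b} → pc ≡ Src P t i → InstAt P t i ≡ assume b → b ρ ≡ true →
      DStep t (pc , ρ) i tau (Tgt P t i , ρ)

  Ok : Mem P → Op → Set
  Ok M tau      = ⊤
  Ok M (rd x v) = M x ≡ v
  Ok M (wr _ _) = ⊤

  Ok-cong : ∀ {M M′ : Mem P} o → (∀ x → M x ≡ M′ x) → Ok M o → Ok M′ o
  Ok-cong tau      e _ = tt
  Ok-cong (rd x v) e p = trans (sym (e x)) p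
  Ok-cong (wr _ _) e _ = tt

  DStep⇒LStep : ∀ {t l i o l′ M} → DStep t l i o l′ → Ok M o → LStep t M l i o l′
  DStep⇒LStep (write p q)    ok = write p q
  DStep⇒LStep (assign p q)   ok = assign p q
  DStep⇒LStep (read p q)     ok = read p q ok
  DStep⇒LStep (skip p q)     ok = skip p q
  DStep⇒LStep (assume p q r) ok = assume p q r

  DStep-not-fence : ∀ {t l i o l′} → DStep t l i o l′ → InstAt P t i ≢ fence
  DStep-not-fence (write _ q)    e with trans (sym q) e
  ... | ()
  DStep-not-fence (assign _ q)   e with trans (sym q) e
  ... | ()
  DStep-not-fence (read _ q)     e with trans (sym q) e
  ... | ()
  DStep-not-fence (skip _ q)     e with trans (sym q) e
  ... | ()
  DStep-not-fence (assume _ q _) e with trans (sym q) e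
  ... | ()

  DStep-read : ∀ {t l i x v l′} → DStep t l i (rd x v) l′ → IsReadOf P t i x
  DStep-read (read _ q) = _ , q

  record Item (t : Thread P) : Set where
    constructor item
    field
      {src} : Loc t
      idx   : Fin (nInst t)
      op    : Op
      {tgt} : Loc t
      dstep : DStep t src idx op tgt

  open Item public

  end : ∀ {t} → Loc t → List (Item t) → Loc t
  end l []         = l
  end l (it ∷ its) = end (tgt it) its

  end-∷ʳ : ∀ {t} (l : Loc t) its it → end l (its ∷ʳ it) ≡ tgt it
  end-∷ʳ l []         it = refl
  end-∷ʳ l (_ ∷ its) it = end-∷ʳ _ its it

  Chain : ∀ {t} → Loc t → List (Item t) → Set
  Chain l []         = ⊤
  Chain l (it ∷ its) = src it ≡ l × Chain (tgt it) its

  Chain-∷ʳ : ∀ {t} {l : Loc t} its {it} → Chain l its → src it ≡ end l its → Chain l (its ∷ʳ it)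
  Chain-∷ʳ []         c       e = e , tt
  Chain-∷ʳ (_ ∷ its) (e′ , c) e = e′ , Chain-∷ʳ its c e

  Chain-++ˡ : ∀ {t} {l : Loc t} its {its′} → Chain l (its ++ its′) → Chain l its
  Chain-++ˡ []         c       = tt
  Chain-++ˡ (_ ∷ its) (e , c) = e , Chain-++ˡ its c

  applyAll : ∀ {t} → Mem P → List (Item t) → Mem P
  applyAll M []         = M
  applyAll M (it ∷ its) = applyAll (apply (op it) M) its

  applyAll-cong : ∀ {t} {M M′ : Mem P} (its : List (Item t)) → (∀ x → M x ≡ M′ x) → ∀ x → applyAll M its x ≡ applyAll M′ its x
  applyAll-cong []         e = e
  applyAll-cong (it ∷ its) e = applyAll-cong its (apply-cong (op it) e)

  Valid : ∀ {t} → Mem P → List (Item t) → Set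
  Valid M []         = ⊤
  Valid M (it ∷ its) = Ok M (op it) × Valid (apply (op it) M) its

  Valid-cong : ∀ {t} {M M′ : Mem P} (its : List (Item t)) → (∀ x → M x ≡ M′ x) → Valid M its → Valid M′ its
  Valid-cong []         e v        = tt
  Valid-cong (it ∷ its) e (ok , v) = Ok-cong (op it) e ok , Valid-cong its (apply-cong (op it) e) v

  Valid-∷ʳ : ∀ {t} {M : Mem P} (its : List (Item t)) {it} → Valid M its → Ok (applyAll M its) (op it) → Valid M (its ∷ʳ it)
  Valid-∷ʳ []        v        ok = ok , tt
  Valid-∷ʳ (_ ∷ its) (o , v) ok = o , Valid-∷ʳ its v ok

  Valid-++ˡ : ∀ {t} {M : Mem P} (its : List (Item t)) {its′} → Valid M (its ++ its′) → Valid M its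
  Valid-++ˡ []        v       = tt
  Valid-++ˡ (_ ∷ its) (o , v) = o , Valid-++ˡ its v

  wrote : Op → Buffer
  wrote (wr x v) = (x , v) ∷ []
  wrote tau      = []
  wrote (rd _ _) = []

  writes : ∀ {t} → List (Item t) → Buffer
  writes []         = []
  writes (it ∷ its) = wrote (op it) ++ writes its

  over-writes : ∀ {t} M b (its : List (Item t)) x → applyAll (over M b) its x ≡ over M (b ++ writes its) x
  over-writes M b [] x = cong (λ c → over M c x) (sym (++-identityʳ b))
  over-writes M b (it ∷ its) x with op it
  ... | tau    = over-writes M b its x
  ... | rd _ _ = over-writes M b its x
  ... | wr y v = trans (applyAll-cong its (λ z → sym (over-∷ʳ M b y v z)) x)
      (trans (over-writes M (b ∷ʳ (y , v)) its x) (cong (λ c → over M c x) (++-assoc b ((y , v) ∷ []) (writes its))))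

  NoWrite : ∀ {t} → Var P → List (Item t) → Set
  NoWrite x = All (λ it → ∀ v → op it ≢ wr x v)

  applyAll-NoWrite : ∀ {t M x} (its : List (Item t)) → NoWrite x its → applyAll M its x ≡ M x
  applyAll-NoWrite [] [] = refl
  applyAll-NoWrite {M = M} {x} (it ∷ its) (n ∷ ns) = trans (applyAll-NoWrite its ns) (lem (op it) n)
    where
    lem : ∀ o → (∀ v → o ≢ wr x v) → apply o M x ≡ M x
    lem tau      _ = refl
    lem (rd _ _) _ = refl
    lem (wr y v) n = update-other M y v (λ { refl → n v refl })

  -- If the memories differ only at `x`, then they agree again after the first write to `x` among
  -- the items, so only the reads of `x` before that write have to be checked.
  Valid-change : ∀ {t x} {M M′ : Mem P} (its : List (Item t)) → (∀ y → y ≢ x → M y ≡ M′ y) →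
    (∀ its₁ it its₂ v → its ≡ its₁ ++ it ∷ its₂ → NoWrite x its₁ → op it ≡ rd x v → M′ x ≡ v) →
    Valid M its → Valid M′ its
  Valid-change [] same reads v = tt
  Valid-change {t} {x} {M} {M′} (it ∷ its) same reads (ok , v) with op it in eo
  ... | tau = tt , Valid-change its same
        (λ its₁ it′ its₂ w e n → reads (it ∷ its₁) it′ its₂ w (cong (it ∷_) e) ((λ _ e′ → case-tau (trans (sym eo) e′)) ∷ n)) v
    where
    case-tau : ∀ {v} → tau ≢ wr x v
    case-tau ()
  ... | rd y w = rd-ok y refl , Valid-change its same
        (λ its₁ it′ its₂ w′ e n → reads (it ∷ its₁) it′ its₂ w′ (cong (it ∷_) e) ((λ _ e′ → case-rd (trans (sym eo) e′)) ∷ n)) v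
    where
    case-rd : ∀ {v} → rd y w ≢ wr x v
    case-rd ()
    rd-ok : ∀ y′ → y ≡ y′ → M′ y ≡ w
    rd-ok _ refl with y ≟ x
    ... | yes refl = reads [] it its w refl [] eo
    ... | no  y≢x  = trans (sym (same y y≢x)) ok
  ... | wr y w with y ≟ x
  ...   | yes refl = tt , Valid-cong its pointwise v
    where
    pointwise : ∀ z → (M ⟨ y ↦ w ⟩) z ≡ (M′ ⟨ y ↦ w ⟩) z
    pointwise z with y ≟ z
    ... | yes refl = refl
    ... | no  y≢z  = same z (λ e → y≢z (sym e))
  ...   | no y≢x = tt , Valid-change its same′
        (λ its₁ it′ its₂ w′ e n eo′ → trans (update-other M′ y w (λ e → y≢x (sym e)))
          (reads (it ∷ its₁) it′ its₂ w′ (cong (it ∷_) e) ((λ _ e′ → case-wr (trans (sym eo) e′)) ∷ n) eo′)) v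
    where
    case-wr : ∀ {v} → wr y w ≢ wr x v
    case-wr refl = y≢x refl
    same′ : ∀ z → z ≢ x → (M ⟨ y ↦ w ⟩) z ≡ (M′ ⟨ y ↦ w ⟩) z
    same′ z z≢x with y ≟ z
    ... | yes refl = refl
    ... | no  _    = same z z≢x

  -- sc is the state of the thread in the SC execution.  It is followed there by
  -- the pending items, which lead to the state of the thread under TSO.  The
  -- buffer consists of the writes that have been performed early in the SC
  -- execution, ep, and those of the items.
  record TState (t : Thread P) : Set where
    constructor ⟨_,_,_⟩
    field
      sc    : Loc t
      ep    : Buffer
      items : List (Item t)

  open TState public

  States : Set
  States = (t : Thread P) → TState t

  Late : (t : Thread P) → Fin (nInst t) → Set
  Late t i = ∀ j x → IsReadOf P t j x → BufferFreeReachable P t i j x → RightMover P t j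

  -- Nothing more can be emitted before a commit. The late write at the head is the one from which
  -- waiting reads will be buffer-free reachable.
  data Normal {t : Thread P} : TState t → Set where
    idle : ∀ {l b} → Normal ⟨ l , b , [] ⟩
    late : ∀ {l b it its x v} → op it ≡ wr x v → Late t (idx it) → Normal ⟨ l , b , it ∷ its ⟩

  -- `M` is the TSO memory, and the optional operation is the contribution to the SC history. An
  -- early write reaches the history in `emit-early` and the memory in `commit-early`; a late one
  -- reaches both in `commit-late`, which needs `ep` empty because buffers are FIFO.
  data TStep (t : Thread P) (M : Mem P) : TState t → Maybe Op → Mem P → TState t → Set where
    append : ∀ {l b its it} → src it ≡ end l its → Ok (over M (b ++ writes its)) (op it) →
      TStep t M ⟨ l , b , its ⟩ nothing M ⟨ l , b , its ∷ʳ it ⟩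
    emit : ∀ {l b it its} → NonWrite (op it) →
      TStep t M ⟨ l , b , it ∷ its ⟩ (just (op it)) M ⟨ tgt it , b , its ⟩
    emit-early : ∀ {l b it its x v} → op it ≡ wr x v → LeftMover P t (idx it) →
      TStep t M ⟨ l , b , it ∷ its ⟩ (just (wr x v)) M ⟨ tgt it , b ∷ʳ (x , v) , its ⟩
    commit-early : ∀ {l x v b its} →
      TStep t M ⟨ l , (x , v) ∷ b , its ⟩ nothing (M ⟨ x ↦ v ⟩) ⟨ l , b , its ⟩
    commit-late : ∀ {l it its x v} → op it ≡ wr x v →
      TStep t M ⟨ l , [] , it ∷ its ⟩ (just (wr x v)) (M ⟨ x ↦ v ⟩) ⟨ tgt it , [] , its ⟩
    sync : ∀ {l i o l′} → LStep t M l i o l′ →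
      TStep t M ⟨ l , [] , [] ⟩ (just o) (apply o M) ⟨ l′ , [] , [] ⟩

  push : Thread P → Maybe Op → History → History
  push t nothing  E = E
  push t (just o) E = (t , o) ∷ E

  -- The number of steps is the measure of the later induction. Threads other than the moving one
  -- are normal, so that their waiting reads are behind a late write whenever the memory changes.
  data Reach : ℕ → History → Mem P → States → Set where
    init : ∀ {th} → (∀ t → th t ≡ ⟨ initLoc t , [] , [] ⟩) → Reach 0 [] (λ _ → 0#) th
    step : ∀ {n E M th t ts δ M′ ts′ th′} → Reach n E M th → (∀ s → s ≢ t → Normal (th s)) →
      th t ≡ ts → TStep t M ts δ M′ ts′ → Update th t ts′ th′ → Reach (suc n) (push t δ E) M′ th′

  chain : ∀ {n E M th} → Reach n E M th → ∀ t → Chain (sc (th t)) (items (th t))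
  chain (init e) t rewrite e t = tt
  chain (step {t = u} R _ e st u′) t with t ≟ u
  ... | no  t≢u rewrite off u′ t t≢u = chain R t
  ... | yes refl rewrite at u′ with chain R t
  ...   | c rewrite e = go st c
    where
    go : ∀ {M ts δ M′ ts′} → TStep t M ts δ M′ ts′ → Chain (sc ts) (items ts) → Chain (sc ts′) (items ts′)
    go (append {its = its} e _) c     = Chain-∷ʳ its c e
    go (emit _)                 (_ , c) = c
    go (emit-early _ _)         (_ , c) = c
    go commit-early             c     = c
    go (commit-late _)          (_ , c) = c
    go (sync _)                 c     = tt

  -- Removing the last steps of a thread

  record Removed (n : ℕ) (E : History) (M : Mem P) (th : States) (t : Thread P) (ts : TState t) : Set where
    constructor removed
    field
      {size}   : ℕ
      {states} : States
      size<    : size < n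
      reach    : Reach size E M states
      update⁻  : Update th t ts states

  truncate-normal : ∀ {t} {l b} its {it its′} → Normal {t} ⟨ l , b , its ++ it ∷ its′ ⟩ → Normal {t} ⟨ l , b , its ⟩
  truncate-normal []        n          = idle
  truncate-normal (_ ∷ its) (late p q) = late p q

  module _ {n E M th t ts⁻ th⁻} (R : Reach n E M th⁻) (u⁻ : Update th t ts⁻ th⁻) where

    replay-other : ∀ {u ts δ M′ ts′ th′} → u ≢ t → Normal ts⁻ → (∀ s → s ≢ u → Normal (th s)) →
      th u ≡ ts → TStep u M ts δ M′ ts′ → Update th u ts′ th′ →
      Reach (suc n) (push u δ E) M′ (th′ ⟨ t ↦ ts⁻ ⟩)
    replay-other {u} {th′ = th′} u≢t nt ns e st u′ = step R normal (trans (off u⁻ u u≢t) e) st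
      (upd (trans (update-other th′ t ts⁻ u≢t) (at u′)) rest)
      where
      normal : ∀ s → s ≢ u → Normal (th⁻ s)
      normal s s≢u with s ≟ t
      ... | yes refl = subst Normal (sym (at u⁻)) nt
      ... | no  s≢t  = subst Normal (sym (off u⁻ s s≢t)) (ns s s≢u)
      rest : ∀ s → s ≢ u → (th′ ⟨ t ↦ ts⁻ ⟩) s ≡ th⁻ s
      rest s s≢u with s ≟ t
      ... | yes refl = trans (update-same th′ t ts⁻) (sym (at u⁻))
      ... | no  s≢t  = trans (update-other th′ t ts⁻ s≢t) (trans (off u′ s s≢u) (sym (off u⁻ s s≢t)))

    replay-own : ∀ {δ M′ ts′ ts₁ th′} → (∀ s → s ≢ t → Normal (th s)) → Update th t ts₁ th′ →
      TStep t M ts⁻ δ M′ ts′ → Reach (suc n) (push t δ E) M′ (th′ ⟨ t ↦ ts′ ⟩)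
    replay-own {ts′ = ts′} {th′ = th′} ns u′ st = step R
      (λ s s≢t → subst Normal (sym (off u⁻ s s≢t)) (ns s s≢t)) (at u⁻) st
      (upd (update-same th′ t ts′)
        (λ s s≢t → trans (update-other th′ t ts′ s≢t) (trans (off u′ s s≢t) (sym (off u⁻ s s≢t)))))

  Update-replace : ∀ {th th′ : States} {t ts ts′ th⁻} → Update th t ts′ th′ → Update th t ts th⁻ → Update th′ t ts th⁻
  Update-replace u′ u⁻ = upd (at u⁻) (λ s s≢t → trans (off u⁻ s s≢t) (sym (off u′ s s≢t)))

  ≢[] : ∀ {A : Set} (xs : List A) {x ys} → [] ≢ xs ++ x ∷ ys
  ≢[] []       ()
  ≢[] (_ ∷ _) ()

  ∷ʳ-split : ∀ {A : Set} (zs xs : List A) {z x} ys → zs ∷ʳ z ≡ xs ++ x ∷ ys →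
    (ys ≡ [] × zs ≡ xs × z ≡ x) ⊎ (∃[ ys′ ] ys ≡ ys′ ∷ʳ z × zs ≡ xs ++ x ∷ ys′)
  ∷ʳ-split zs xs {z} {x} ys e with initLast ys
  ... | [] with ∷ʳ-injective zs xs e
  ...   | e₁ , e₂ = inj₁ (refl , e₁ , e₂)
  ∷ʳ-split zs xs {z} {x} .(ys′ ∷ʳ y) e | ys′ ∷ʳ′ y
    with ∷ʳ-injective zs (xs ++ x ∷ ys′) (trans e (sym (++-assoc xs (x ∷ ys′) (y ∷ []))))
  ... | e₁ , refl = inj₂ (ys′ , refl , e₁)

  -- Items that still wait have affected neither the history nor the memory, so the run can be
  -- replayed without appending them. At least the step that appended `it` disappears.
  truncate : ∀ {n E M th t l b} its {it its′ x v} → Reach n E M th → th t ≡ ⟨ l , b , its ++ it ∷ its′ ⟩ →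
    op it ≡ wr x v → Removed n E M th t ⟨ l , b , its ⟩
  truncate {t = t} its (init e₀) e _ with trans (sym (e₀ t)) e
  ... | e′ = ⊥-elim (≢[] its (cong items e′))
  truncate {th = th′} {t} {l} {b} its {it} {its′} (step {th = th} {t = u} R ns eu st u′) e ew with u ≟ t
  ... | no u≢t with truncate its R (trans (sym (off u′ t (λ e → u≢t (sym e)))) e) ew
  ...   | removed m< R⁻ u⁻ = removed (s<s m<)
          (replay-other R⁻ u⁻ u≢t
            (truncate-normal its (subst Normal (trans (sym (off u′ t (λ e → u≢t (sym e)))) e) (ns t (λ e → u≢t (sym e)))))
            ns eu st u′)
          update
  truncate {M = M} {th = th′} {t} {l} {b} its {it} {its′} (step {n = n} {E = E} {th = th} R ns eu st u′) e ew | yes refl =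
    own R st (trans (sym (at u′)) e) eu u′
    where
    own : ∀ {M₀ ts δ M′ ts′} → Reach n E M₀ th → TStep t M₀ ts δ M′ ts′ → ts′ ≡ ⟨ l , b , its ++ it ∷ its′ ⟩ → th t ≡ ts →
      Update th t ts′ th′ → Removed (suc n) (push t δ E) M′ th′ t ⟨ l , b , its ⟩
    own R (append {its = its₀} _ _) e eu u′ with cong sc e | cong ep e | ∷ʳ-split its₀ its its′ (cong items e)
    ... | refl | refl | inj₁ (refl , refl , refl) =
          removed (n<1+n _) R (upd eu (λ s s≢t → sym (off u′ s s≢t)))
    ... | refl | refl | inj₂ (its″ , refl , refl) with truncate its R eu ew
    ...   | removed m< R⁻ u⁻ = removed (m<n⇒m<1+n m<) R⁻ (Update-replace u′ u⁻)
    own R (emit {it = it₀} nw) refl eu u′ with truncate (it₀ ∷ its) R eu ew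
    ... | removed m< R⁻ u⁻ = removed (s<s m<) (replay-own R⁻ u⁻ ns u′ (emit nw)) update
    own R (emit-early {it = it₀} eo lm) refl eu u′ with truncate (it₀ ∷ its) R eu ew
    ... | removed m< R⁻ u⁻ = removed (s<s m<) (replay-own R⁻ u⁻ ns u′ (emit-early eo lm)) update
    own R commit-early refl eu u′ with truncate its R eu ew
    ... | removed m< R⁻ u⁻ = removed (s<s m<) (replay-own R⁻ u⁻ ns u′ commit-early) update
    own R (commit-late {it = it₀} eo) refl eu u′ with truncate (it₀ ∷ its) R eu ew
    ... | removed m< R⁻ u⁻ = removed (s<s m<) (replay-own R⁻ u⁻ ns u′ (commit-late eo)) update
    own _ (sync _) e eu u′ = ⊥-elim (≢[] its (cong items e))

-- Freezing threads, and the use of right movers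

module Surgery {V : ValueDomain} (P : Program V) where
  open import Data.Nat using (_<_; _≤_)
  open ValueDomain V
  open Program P
  open Histories P
  open Machine P

  -- The memory `M` is that of the full run, as no removed write has been committed; hence the other
  -- threads can take the same steps as before.
  record Frozen (n : ℕ) (E : History) (M : Mem P) (th : States) (t : Thread P)
                (b : Buffer) (x : Var P) (v : D) (b′ : Buffer) : Set where
    constructor frozen
    field
      {size}    : ℕ
      {history} : History
      {states}  : States
      {loc loc′} : Loc t
      {index}   : Fin (nInst t)
      size<     : size < n
      reach     : Reach size history M states
      update⁻   : Update th t ⟨ loc , b , [] ⟩ states
      cut       : Cut t x v (length b′) E history
      leftMover : LeftMover P t index
      writeStep : IsWriteStep t loc index (wr x v) loc′

  DStep-write : ∀ {t l i o x v l′} → DStep t l i o l′ → o ≡ wr x v → IsWriteStep t l i (wr x v) l′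
  DStep-write d refl M = DStep⇒LStep d tt

  length-∷ʳ : ∀ {A : Set} (xs : List A) x → length (xs ∷ʳ x) ≡ suc (length xs)
  length-∷ʳ xs x = trans (length-++ xs) (+-comm (length xs) 1)

  -- While an early write is pending, `commit-late` and `sync` are impossible for its thread. So the
  -- writes of `t` that follow it in the history are exactly the early ones in `b′`, which explains
  -- the index `length b′` of the cut.
  freeze : ∀ {n E M th t} b {x v} b′ → Reach n E M th → ep (th t) ≡ b ++ (x , v) ∷ b′ → Frozen n E M th t b x v b′
  freeze {t = t} b b′ (init e₀) e = ⊥-elim (≢[] b (trans (sym (cong ep (e₀ t))) e))
  freeze {th = th′} {t} b {x} {v} b′ (step {E = E} {th = th} {t = u} R ns eu st u′) e with u ≟ t
  ... | no u≢t with freeze b b′ R (trans (sym (cong ep (off u′ t (λ e → u≢t (sym e))))) e)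
  ...   | frozen m< R⁻ u⁻ c lm w = frozen (s<s m<) (replay-other R⁻ u⁻ u≢t idle ns eu st u′) update (extended st) lm w
    where
    extended : ∀ {M ts δ M′ ts′} → TStep u M ts δ M′ ts′ → Cut t x v (length b′) (push u δ E) (push u δ _)
    extended {δ = nothing} _ = c
    extended {δ = just o}  _ = other u≢t c
  freeze {th = th′} {t} b {x} {v} b′ (step {n = n} {E = E} {th = th} R ns eu st u′) e | yes refl =
    own R st (trans (sym (cong ep (at u′))) e) eu u′
    where
    own : ∀ {M₀ ts δ M′ ts′} → Reach n E M₀ th → TStep t M₀ ts δ M′ ts′ → ep ts′ ≡ b ++ (x , v) ∷ b′ → th t ≡ ts →
      Update th t ts′ th′ → Frozen (suc n) (push t δ E) M′ th′ t b x v b′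
    own R (append _ _) e eu u′ with freeze b b′ R (trans (cong ep eu) e)
    ... | frozen m< R⁻ u⁻ c lm w = frozen (m<n⇒m<1+n m<) R⁻ (Update-replace u′ u⁻) c lm w
    own R (emit nw) e eu u′ with freeze b b′ R (trans (cong ep eu) e)
    ... | frozen m< R⁻ u⁻ c lm w = frozen (m<n⇒m<1+n m<) R⁻ (Update-replace u′ u⁻) (silent nw c) lm w
    own R (emit-early {b = b₀} {it = it} {its} eo lm) e eu u′ with ∷ʳ-split b₀ b b′ e
    -- This step emitted the write itself. It was the first waiting item then, so all waiting items
    -- are removed and the thread is left where the write is enabled.
    ... | inj₁ (refl , refl , refl) with truncate [] R eu eo
    ...   | removed m< R⁻ u⁻ = frozen (m<n⇒m<1+n m<) R⁻ (Update-replace u′ u⁻) root lm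
            (subst (λ l → IsWriteStep t l _ _ _) (proj₁ (subst (λ ts → Chain (sc ts) (items ts)) eu (chain R t)))
              (DStep-write (dstep it) eo))
    own R (emit-early {b = b₀} {it = it} {its} eo lm) e eu u′ | inj₂ (b″ , refl , refl)
      with freeze b b″ R (cong ep eu)
    ... | frozen m< R⁻ u⁻ c lm w = frozen (m<n⇒m<1+n m<) R⁻ (Update-replace u′ u⁻)
            (subst (λ n → Cut t x v n _ _) (sym (length-∷ʳ b″ _)) (write c)) lm w
    own R commit-early refl eu u′ with freeze (_ ∷ b) b′ R (cong ep eu)
    ... | frozen m< R⁻ u⁻ c lm w = frozen (s<s m<) (replay-own R⁻ u⁻ ns u′ commit-early) update c lm w
    own R (commit-late _) e eu u′ = ⊥-elim (≢[] b e)
    own R (sync _)        e eu u′ = ⊥-elim (≢[] b e)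

  empty? : (b : Buffer) → Dec (b ≡ [])
  empty? []      = yes refl
  empty? (_ ∷ _) = no λ ()

  pending? : ∀ {Q : Thread P → Set} (th : States) → (∀ s → Dec (Q s)) →
    (∃[ s ] Q s × ep (th s) ≢ []) ⊎ (∀ s → Q s → ep (th s) ≡ [])
  pending? {Q} th Q? with any? (λ s → Q? s ×-dec ¬? (empty? (ep (th s))))
  ... | yes p = inj₁ p
  ... | no ¬p = inj₂ none
    where
    none : ∀ s → Q s → ep (th s) ≡ []
    none s q with empty? (ep (th s))
    ... | yes e  = e
    ... | no  ne = ⊥-elim (¬p (s , q , ne))

  uncons : (b : Buffer) → b ≢ [] → ∃[ x ] ∃[ v ] ∃[ b′ ] b ≡ (x , v) ∷ b′
  uncons []             ne = ⊥-elim (ne refl)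
  uncons ((x , v) ∷ b′) ne = x , v , b′ , refl

  unsnoc : (b : Buffer) → b ≢ [] → ∃[ b′ ] ∃[ x ] ∃[ v ] b ≡ b′ ∷ʳ (x , v)
  unsnoc b ne with initLast b
  ... | []              = ⊥-elim (ne refl)
  ... | b′ ∷ʳ′ (x , v) = b′ , x , v , refl

  -- When only `t` has early writes, the memory of the history is exactly what `t` sees
  -- (`eval-over`), so the waiting items of `t` can be performed after the history.
  record AllFrozen (n : ℕ) (M : Mem P) (th : States) (t : Thread P) : Set where
    constructor allFrozen
    field
      {size}    : ℕ
      {history} : History
      {states}  : States
      size≤     : size ≤ n
      reach     : Reach size history M states
      others    : ∀ s → s ≢ t → ep (states s) ≡ []
      kept      : ∀ s → s ≡ t ⊎ ep (th s) ≡ [] → states s ≡ th s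

  freezeAll : ∀ {n E M th} t → Acc _<_ n → Reach n E M th → AllFrozen n M th t
  freezeAll {n} {E} {M} {th} t (acc rs) R with pending? th (λ s → ¬? (s ≟ t))
  ... | inj₂ none = allFrozen ≤-refl R none (λ _ _ → refl)
  ... | inj₁ (s , s≢t , ne) with uncons (ep (th s)) ne
  -- Freezing before the oldest pending early write leaves none pending for `s`.
  ...   | x , v , b′ , e with freeze [] b′ R e
  ...     | frozen {states = th⁻} m< R⁻ u⁻ _ _ _ with freezeAll t (rs m<) R⁻
  ...       | allFrozen {states = th₂} m≤ R₂ others kept = allFrozen (≤-trans m≤ (<⇒≤ m<)) R₂ others kept′
    where
    kept′ : ∀ r → r ≡ t ⊎ ep (th r) ≡ [] → th₂ r ≡ th r
    kept′ r (inj₁ refl) = trans (kept r (inj₁ refl)) (off u⁻ r (λ e → s≢t (sym e)))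
    kept′ r (inj₂ er) with r ≟ s
    ... | yes refl = ⊥-elim (ne er)
    ... | no  r≢s  = trans (kept r (inj₂ (trans (cong ep (off u⁻ r r≢s)) er))) (off u⁻ r r≢s)

  -- The history already contains the early writes that `M` lacks. As `written` holds for every
  -- thread, threads whose newest early writes to a variable are pending at the same time must have
  -- written the same value; this is due to their being left movers.
  record Inv (E : History) (M : Mem P) (th : States) : Set where
    constructor inv
    field
      run     : Run E (λ t → sc (th t))
      written : ∀ t x v → newest P x (ep (th t)) ≡ just v → eval E x ≡ v
      unwritten : ∀ x → (∀ t → newest P x (ep (th t)) ≡ nothing) → eval E x ≡ M x
      valid   : ∀ t → Valid (over M (ep (th t))) (items (th t))

    eval-over : ∀ t → (∀ s → s ≢ t → ep (th s) ≡ []) → ∀ x → eval E x ≡ over M (ep (th t)) x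
    eval-over t none x with newest P x (ep (th t)) in e
    ... | just v  = written t x v e
    ... | nothing = unwritten x all
      where
      all : ∀ s → newest P x (ep (th s)) ≡ nothing
      all s with s ≟ t
      ... | yes refl = e
      ... | no  s≢t rewrite none s s≢t = refl

  itemEvent : ∀ {t} → Item t → Event P
  itemEvent {t} it = event t (idx it) (label t (op it))

  itemsPath : ∀ {s l M t} (its : List (Item t)) → Represents s l M → Chain (l t) its → Valid M its →
    ∃[ s′ ] ∃[ l′ ] SCPath P s (map itemEvent its) s′ × Represents s′ l′ (applyAll M its) × (∀ u → u ≢ t → l′ u ≡ l u)
  itemsPath [] rs c v = _ , _ , [] , rs , λ _ _ → refl
  itemsPath {l = l} {M} {t} (it ∷ its) rs (e , c) (ok , v)
    with extend rs (subst (λ k → LStep t M k _ _ _) e (DStep⇒LStep (dstep it) ok)) (update {b = tgt it})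
  ... | s₁ , p₁ , rs₁ with itemsPath its rs₁ (subst (λ k → Chain k its) (sym (update-same l t (tgt it))) c) v
  ... | s₂ , l₂ , p₂ , rs₂ , eo = s₂ , l₂ , p₁ ++ₚ p₂ , rs₂ , λ u u≢ → trans (eo u u≢) (update-other l t (tgt it) u≢)

  -- The step may be a cas, which looks only at `x`. So it stays enabled after another thread has
  -- performed items that do not write `x`.
  Writer : (u : Thread P) → Loc u → Mem P → Var P → D → Set
  Writer u l M x v = ∃[ j ] ∃[ l′ ] (∀ M′ → M′ x ≡ M x → LStep u M′ l j (wr x v) l′)

  -- If another thread could overwrite x while the read is pending, then the read
  -- would not move right past that write.
  rightMover-value : ∀ {E l t u} w d r x₀ v₀ v → t ≢ u → Run E l → Late t (idx w) →
    op r ≡ rd x₀ v → NoWrite x₀ d → (∀ v → op w ≢ wr x₀ v) →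
    Chain (l t) (w ∷ d ∷ʳ r) → Valid (eval E) (w ∷ d ∷ʳ r) → Writer u (l u) (eval E) x₀ v₀ → v₀ ≡ v
  rightMover-value {E} {l} {t} {u} w d r x₀ v₀ v t≢u run lt eo nw nww c val (j , l′ , wstep) =
    conclude (Run⇒SCPath run)
    where
    b : Event P
    b = event u j (label u (wr x₀ v₀))

    -- In the swapped execution the read comes directly after the write of `v₀`, yet its label still
    -- says `v`.
    last : ∀ {E′} {π : List (List (Action P))} {k} → Run E′ k → labelsOf E′ ≡ (π ∷ʳ label u (wr x₀ v₀)) ∷ʳ label t (rd x₀ v) → v₀ ≡ v
    last {E′} r e with labelsOf-snoc {E′} {t = t} {rd x₀ v} e
    ... | E₁ , refl , e₁ with labelsOf-snoc {E₁} {t = u} {wr x₀ v₀} e₁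
    ... | E₂ , refl , e₂ with r
    ... | step _ s _ = trans (sym (update-same (eval E₂) x₀ v₀)) (LStep-rd s)

    conclude : ∃[ es ] ∃[ s ] SCPath P (initSC P) es s × labels P es ≡ labelsOf E × Represents s l (eval E) → v₀ ≡ v
    conclude (es , s , p , _ , rs) = conclude′ (itemsPath (w ∷ d ∷ʳ r) rs c val)
      where
      mid : List (Event P)
      mid = map itemEvent d
      mids : map itemEvent (w ∷ d ∷ʳ r) ≡ itemEvent w ∷ mid ++ itemEvent r ∷ []
      mids = cong (itemEvent w ∷_) (map-++ itemEvent d (r ∷ []))

      conclude′ : ∃[ s′ ] ∃[ l′ ] SCPath P s (map itemEvent (w ∷ d ∷ʳ r)) s′ ×
        Represents s′ l′ (applyAll (eval E) (w ∷ d ∷ʳ r)) × (∀ u → u ≢ t → l′ u ≡ l u) → v₀ ≡ v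
      conclude′ (s₁ , l₁ , p₁ , rs₁ , eo₁) = conclude″ (extend rs₁ (subst (λ k → LStep u _ k j _ l′) (sym (eo₁ u (λ e → t≢u (sym e))))
          (wstep _ (applyAll-NoWrite (w ∷ d ∷ʳ r) (nww ∷ noWrites)))) update)
        where
        rd≢wr : ∀ v′ → op r ≢ wr x₀ v′
        rd≢wr v′ e with trans (sym eo) e
        ... | ()
        noWrites : NoWrite x₀ (d ∷ʳ r)
        noWrites = All-∷ʳ nw rd≢wr
          where
          All-∷ʳ : ∀ {d} → NoWrite x₀ d → (∀ v → op r ≢ wr x₀ v) → NoWrite x₀ (d ∷ʳ r)
          All-∷ʳ []       q = q ∷ []
          All-∷ʳ (x ∷ xs) q = x ∷ All-∷ʳ xs q

        -- The waiting items are performed directly after the history. None of those in `d` is a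
        -- fence, by `DStep-not-fence`, or writes `x₀`, so the read is buffer-free reachable from
        -- `w`.
        rm : RightMover P t (idx r)
        rm = lt (idx r) x₀ (DStep-read (subst (λ o → DStep t _ _ o _) eo (dstep r)))
          (es , itemEvent w , mid , itemEvent r , [] , s₁ ,
            p ++ₚ subst (λ es′ → SCPath P s es′ s₁) mids p₁ , refl , refl ,
            map⁺ (All.map (λ {it} n → (λ (_ , e) → DStep-not-fence (dstep it) e) , noWriteOn it n) nw))
          where
          noWriteOn : ∀ it → (∀ v → op it ≢ wr x₀ v) → ¬ WriteOn P x₀ (itemEvent it)
          noWriteOn it n (t′ , v′ , m) = go (op it) n m
            where
            go : ∀ o → (∀ v → o ≢ wr x₀ v) → ¬ (com t′ x₀ v′ ∈ label t o)
            go tau      n (here ())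
            go tau      n (there ())
            go (rd _ _) n (here ())
            go (rd _ _) n (there ())
            go (wr y w) n (here ())
            go (wr y w) n (there (here refl)) = n _ refl
            go (wr y w) n (there (there ()))

        before : List (Event P)
        before = es ++ itemEvent w ∷ mid

        conclude″ : ∃[ s₂ ] SCPath P s₁ (b ∷ []) s₂ × Represents s₂ _ _ → v₀ ≡ v
        conclude″ (s₂ , p₂ , _) = conclude‴ (SCReaches⇒Run (rm before (itemEvent r) (b ∷ []) s₂
            (subst (λ es′ → SCPath P (initSC P) es′ s₂) path-≡ ((p ++ₚ p₁) ++ₚ p₂)) refl b [] refl t≢u))
          where
          path-≡ : (es ++ map itemEvent (w ∷ d ∷ʳ r)) ++ b ∷ [] ≡ before ++ itemEvent r ∷ b ∷ []
          path-≡ = trans (cong (λ z → (es ++ z) ++ b ∷ []) mids)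
            (trans (cong (_++ b ∷ []) (sym (++-assoc es (itemEvent w ∷ mid) (itemEvent r ∷ []))))
              (++-assoc before (itemEvent r ∷ []) (b ∷ [])))
          conclude‴ : ∃[ E′ ] Run E′ (locOf s₂) × labelsOf E′ ≡ labels P (before ++ b ∷ itemEvent r ∷ []) × _ → v₀ ≡ v
          conclude‴ (E′ , r′ , e′ , _) = last r′ (trans e′ (trans (map-++ Event.label before _)
            (trans (cong (λ o → labels P before ++ label u (wr x₀ v₀) ∷ label t o ∷ []) eo)
              (sym (++-assoc (labels P before) (label u (wr x₀ v₀) ∷ []) _)))))

-- The invariant of the intermediate machine

module Invariant {V : ValueDomain} (P : Program V) where
  open import Data.Nat using (_<_; _≤_)
  open ValueDomain V
  open Program P
  open Histories P
  open Machine P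
  open Surgery P

  -- The step of `u` comes from the run in which the cut write of `s` is restored; the silent steps
  -- of `s` missing there come from the run of `E`.
  splice : ∀ {s x v u o E H l p k} (c : Cut s x v 0 ((u , o) ∷ E) H) → u ≢ s → Restored c l → Run E p →
    k s ≡ p s → (∀ r → r ≢ s → l r ≡ k r) → Run ((u , o) ∷ E) k
  splice root         u≢s _ _ _ _ = ⊥-elim (u≢s refl)
  splice (silent _ _) u≢s _ _ _ _ = ⊥-elim (u≢s refl)
  splice {s} {u = u} {o} {k = k} (other _ c) u≢s (restored (step q sb ub) _ _) p ks kr with merge (Inserts-restore c) p q
  ... | m , r , et , eo = step r
        (subst (λ z → LStep u _ z _ o _) (sym (eo u u≢s)) (LStep-cong (λ x → sym (eval-Inserts (Inserts-restore c) x)) sb))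
        (upd (trans (sym (kr u u≢s)) (at ub)) rest)
    where
    rest : ∀ w → w ≢ u → k w ≡ m w
    rest w w≢u with w ≟ s
    ... | yes refl = trans ks (sym et)
    ... | no  w≢s  = trans (sym (kr w w≢s)) (trans (off ub w w≢u) (sym (eo w w≢s)))

  base-step : ∀ {u M ts o M′ ts′ N} → TStep u M ts (just o) M′ ts′ → Chain (sc ts) (items ts) →
    Valid (over M (ep ts)) (items ts) → (∀ x → N x ≡ over M (ep ts) x) → ∃[ i ] LStep u N (sc ts) i o (sc ts′)
  base-step {u} {N = N} (emit {it = it} nw) (e , _) (ok , _) eq =
    idx it , subst (λ l → LStep u N l _ _ _) e (DStep⇒LStep (dstep it) (Ok-cong (op it) (λ x → sym (eq x)) ok))
  base-step {u} {N = N} (emit-early {it = it} eo _) (e , _) _ eq =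
    idx it , subst (λ l → LStep u N l _ _ _) e (DStep-write (dstep it) eo N)
  base-step {u} {N = N} (commit-late {it = it} eo) (e , _) _ eq =
    idx it , subst (λ l → LStep u N l _ _ _) e (DStep-write (dstep it) eo N)
  base-step (sync st) _ _ eq = _ , LStep-cong (λ x → sym (eq x)) st

  valid-own : ∀ {t M ts δ M′ ts′} → TStep t M ts δ M′ ts′ → Valid (over M (ep ts)) (items ts) →
    Valid (over M′ (ep ts′)) (items ts′)
  valid-own {M = M} (append {b = b} {its} {it} _ ok) v =
    Valid-∷ʳ its v (Ok-cong (op it) (λ x → sym (over-writes M b its x)) ok)
  valid-own {M = M} (emit {b = b} {its = its} nw) (_ , v) = subst (λ N → Valid N its) (apply-nonWrite nw) v
  valid-own {M = M} (emit-early {b = b} {it} {its} {x} {w} eo _) (_ , v) rewrite eo =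
    Valid-cong its (λ y → sym (over-∷ʳ M b x w y)) v
  valid-own {M = M} (commit-early {x = x} {w} {b} {its}) v = Valid-cong its (over-∷ M x w b) v
  valid-own (commit-late eo) (_ , v) rewrite eo = v
  valid-own (sync _) v = tt

  LStep-wr-local : ∀ {u M N l j x v l′} → LStep u M l j (wr x v) l′ → N x ≡ M x → LStep u N l j (wr x v) l′
  LStep-wr-local (write p q)         e = write p q
  LStep-wr-local (cas-success p q r) e = cas-success p q (trans e r)

  module _ {n} (ih : ∀ {m E M th} → m < n → Reach m E M th → Inv E M th) where

    reinstate : ∀ {E M th t b x v} (F : Frozen n E M th t b x v []) →
      Restored (Frozen.cut F) ((λ s → sc (Frozen.states F s)) ⟨ t ↦ Frozen.loc′ F ⟩)
    reinstate {t = t} (frozen m< R u c lm w) = moveLeft c lm (Inv.run (ih m< R))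
      (subst (λ l → IsWriteStep t l _ _ _) (sym (cong sc (at u))) w) update

    eval-frozen : ∀ {E M th t b x v} (F : Frozen n E M th t b x v []) →
      ∀ y → eval E y ≡ eval ((t , wr x v) ∷ Frozen.history F) y
    eval-frozen F y = trans (eval-Inserts (Inserts-restore (Frozen.cut F)) y) (Restored.mem≗ (reinstate F) y)

    -- As a left mover, the newest early write of `t` has the same effect on memory as if it were
    -- last in the history. Either it is on `x` and decides the value, or it can be removed and the
    -- shorter run decides.
    written-inv : ∀ {E M th} → Reach n E M th → ∀ t x v → newest P x (ep (th t)) ≡ just v → eval E x ≡ v
    written-inv {E} {M} {th} R t x v e = go (unsnoc (ep (th t)) (λ z → just≢ (trans (sym e) (cong (newest P x) z))))
      where
      just≢ : just v ≢ nothing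
      just≢ ()
      go : ∃[ b ] ∃[ y ] ∃[ w ] ep (th t) ≡ b ∷ʳ (y , w) → eval E x ≡ v
      go (b , y , w , eb) = go′ (freeze b [] R eb)
        where
        go′ : Frozen n E M th t b y w [] → eval E x ≡ v
        go′ F with y ≟ x
        ... | yes refl = trans (eval-frozen F y) (trans (update-same (eval (Frozen.history F)) y w) (w≡v
                           (trans (sym (newest-∷ʳ-same y b w)) (trans (cong (newest P y) (sym eb)) e))))
          where
          w≡v : just w ≡ just v → w ≡ v
          w≡v refl = refl
        ... | no y≢x = trans (eval-frozen F x) (trans (update-other (eval (Frozen.history F)) y w (λ z → y≢x (sym z)))
            (Inv.written (ih (Frozen.size< F) (Frozen.reach F)) t x v
              (trans (cong (newest P x) (cong ep (at (Frozen.update⁻ F))))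
                (trans (sym (newest-∷ʳ-other b w y≢x)) (trans (cong (newest P x) (sym eb)) e)))))

    -- A pending early write is not on `x`, so it can be removed by freezing. If none is pending,
    -- the last step is inspected.
    unwritten-inv : ∀ {E M th} → Reach n E M th → ∀ x → (∀ t → newest P x (ep (th t)) ≡ nothing) → eval E x ≡ M x
    unwritten-inv {E} {M} {th} R x none = go (pending? {Q = λ _ → ⊤} th (λ _ → yes tt))
      where
      frozen-case : ∀ {t b y w} → ep (th t) ≡ b ∷ʳ (y , w) → Frozen n E M th t b y w [] → eval E x ≡ M x
      frozen-case {t} {b} {y} {w} eb F with y ≟ x
      ... | yes refl = ⊥-elim (just≢ (trans (sym (newest-∷ʳ-same y b w)) (trans (cong (newest P y) (sym eb)) (none t))))
        where
        just≢ : just w ≢ nothing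
        just≢ ()
      ... | no y≢x = trans (eval-frozen F x) (trans (update-other (eval (Frozen.history F)) y w (λ z → y≢x (sym z)))
          (Inv.unwritten (ih (Frozen.size< F) (Frozen.reach F)) x none⁻))
        where
        none⁻ : ∀ s → newest P x (ep (Frozen.states F s)) ≡ nothing
        none⁻ s with s ≟ t
        ... | yes refl = trans (cong (newest P x) (cong ep (at (Frozen.update⁻ F))))
                (trans (sym (newest-∷ʳ-other b w y≢x)) (trans (cong (newest P x) (sym eb)) (none t)))
        ... | no s≢t = trans (cong (newest P x) (cong ep (off (Frozen.update⁻ F) s s≢t))) (none s)

      -- The threads that did not take the last step had no early writes before it either, so
      -- `eval-over` describes the memory of the history at that point.
      empty-case : ∀ {n′ E M th} → n′ ≤ n → Reach n′ E M th → (∀ s → ep (th s) ≡ []) → eval E x ≡ M x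
      empty-case _ (init _) _ = refl
      empty-case n≤ (step {E = E} {M} {th₀} {t = t} R₀ ns eu st u′) all =
        own st (trans (sym (cong ep (at u′))) (all t)) (λ y → trans (eval₀ y) (cong (λ ts → over M (ep ts) y) eu))
        where
        eval₀ : ∀ y → eval E y ≡ over M (ep (th₀ t)) y
        eval₀ = Inv.eval-over (ih n≤ R₀) t (λ s s≢t → trans (sym (cong ep (off u′ s s≢t))) (all s))
        own : ∀ {ts δ M′ ts′} → TStep t M ts δ M′ ts′ → ep ts′ ≡ [] → (∀ y → eval E y ≡ over M (ep ts) y) →
          eval (push t δ E) x ≡ M′ x
        own (append _ _) refl eq = eq x
        own (emit nw) refl eq = trans (cong (λ N → N x) (apply-nonWrite {M = eval E} nw)) (eq x)
        own (emit-early {b = b} _ _) e eq = ⊥-elim (≢[] b (sym e))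
        own (commit-early {x = y} {v}) refl eq = trans (eq x) (over-∷ M y v [] x)
        own (commit-late {x = y} {v} _) _ eq = apply-cong (wr y v) eq x
        own (sync {o = o} _) _ eq = apply-cong o eq x

      go : (∃[ s ] ⊤ × ep (th s) ≢ []) ⊎ (∀ s → ⊤ → ep (th s) ≡ []) → eval E x ≡ M x
      go (inj₂ all) = empty-case ≤-refl R (λ s → all s tt)
      go (inj₁ (s , _ , ne)) = go′ (unsnoc (ep (th s)) ne)
        where
        go′ : ∃[ b ] ∃[ y ] ∃[ w ] ep (th s) ≡ b ∷ʳ (y , w) → eval E x ≡ M x
        go′ (b , y , w , eb) = frozen-case eb (freeze b [] R eb)

    -- An early write of `t` on `x₀` hides the change. Otherwise all other threads with early writes
    -- are frozen, so that the waiting items of `t` can follow the history in an SC execution. As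
    -- `u` has no early writes, it keeps its location and can still write there.
    valid-changed : ∀ {m E M th t u x₀ v₀} → m < n → Reach m E M th → t ≢ u → Normal (th t) → ep (th u) ≡ [] →
      Writer u (sc (th u)) M x₀ v₀ → Valid (over M (ep (th t))) (items (th t)) →
      Valid (over (M ⟨ x₀ ↦ v₀ ⟩) (ep (th t))) (items (th t))
    valid-changed {m} {E} {M} {th} {t} {u} {x₀} {v₀} m<n R t≢u nt eu (j , l′ , wstep) val
      with newest P x₀ (ep (th t)) in ne
    ... | just w = Valid-cong (items (th t)) same val
      where
      same : ∀ y → over M (ep (th t)) y ≡ over (M ⟨ x₀ ↦ v₀ ⟩) (ep (th t)) y
      same y with y ≟ x₀
      ... | yes refl rewrite ne = refl
      ... | no  y≢   = cong (λ d → fromMaybe d (newest P y (ep (th t)))) (sym (update-other M x₀ v₀ y≢))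
    ... | nothing = Valid-change (items (th t))
        (λ y y≢ → cong (λ d → fromMaybe d (newest P y (ep (th t)))) (sym (update-other M x₀ v₀ y≢)))
        (λ its₁ it its₂ v e nw eo → trans overM′ (reads its₁ it its₂ v (th t) refl nt e nw eo)) val
      where
      overM : over M (ep (th t)) x₀ ≡ M x₀
      overM = cong (fromMaybe (M x₀)) ne
      overM′ : over (M ⟨ x₀ ↦ v₀ ⟩) (ep (th t)) x₀ ≡ v₀
      overM′ = trans (cong (fromMaybe ((M ⟨ x₀ ↦ v₀ ⟩) x₀)) ne) (update-same M x₀ v₀)
      AF : AllFrozen m M th t
      AF = freezeAll t (<-wellFounded m) R
      open AllFrozen AF
      I : Inv history M states
      I = ih (≤-<-trans size≤ m<n) reach
      et : states t ≡ th t
      et = kept t (inj₁ refl)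
      eval≗ : ∀ y → eval history y ≡ over M (ep (th t)) y
      eval≗ y = trans (Inv.eval-over I t others y) (cong (λ ts → over M (ep ts) y) et)
      reads : ∀ its₁ it its₂ v ts → th t ≡ ts → Normal ts → items (th t) ≡ its₁ ++ it ∷ its₂ → NoWrite x₀ its₁ →
        op it ≡ rd x₀ v → v₀ ≡ v
      reads its₁ it its₂ v _ ets idle e _ _ = ⊥-elim (≢[] its₁ (trans (sym (cong items ets)) e))
      reads [] it its₂ v _ ets (late ew _) e _ eo with trans (sym (cong items ets)) e
      ... | refl with trans (sym ew) eo
      ...   | ()
      reads (w ∷ d) it its₂ v _ ets (late ew lt) e (nw ∷ nws) eo with trans (sym (cong items ets)) e
      ... | refl = rightMover-value w d it x₀ v₀ v t≢u (Inv.run I) lt eo nws nw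
          (Chain-++ˡ (w ∷ d ∷ʳ it) (subst₂ Chain (cong sc (sym et)) split (chain R t)))
          (Valid-++ˡ (w ∷ d ∷ʳ it) (Valid-cong ((w ∷ d ∷ʳ it) ++ its₂) (λ y → sym (eval≗ y)) (subst (Valid _) split val)))
          (j , l′ , λ N eN → subst (λ l → LStep u N l j _ l′) (cong sc (sym (kept u (inj₂ eu))))
            (wstep N (trans eN (trans (eval≗ x₀) overM))))
        where
        split : items (th t) ≡ (w ∷ d ∷ʳ it) ++ its₂
        split = trans e (sym (++-assoc (w ∷ d) (it ∷ []) its₂))

    valid-other : ∀ {m E M th t u ts δ M′ ts′} → m < n → Reach m E M th → t ≢ u → Normal (th t) → th u ≡ ts →
      TStep u M ts δ M′ ts′ → Valid (over M (ep (th t))) (items (th t)) → Valid (over M′ (ep (th t))) (items (th t))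
    valid-other m< R t≢u nt eu (append _ _)     val = val
    valid-other m< R t≢u nt eu (emit _)         val = val
    valid-other m< R t≢u nt eu (emit-early _ _) val = val
    valid-other {u = u} m< R t≢u nt eu (commit-late {it = it} eo) val =
      valid-changed m< R t≢u nt (cong ep eu) (idx it , tgt it , λ N _ →
        subst (λ l → LStep u N l _ _ _) (trans (proj₁ (subst (λ ts → Chain (sc ts) (items ts)) eu (chain R u))) (sym (cong sc eu)))
          (DStep-write (dstep it) eo N)) val
    valid-other m< R t≢u nt eu (sync {o = tau} _)    val = val
    valid-other m< R t≢u nt eu (sync {o = rd _ _} _) val = val
    valid-other {u = u} m< R t≢u nt eu (sync {o = wr x v} st) val =
      valid-changed m< R t≢u nt (cong ep eu) (_ , _ , λ N e →
        subst (λ l → LStep u N l _ _ _) (sym (cong sc eu)) (LStep-wr-local st e)) val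
    -- The committed write lies somewhere back in the history. Freezing `u` just before it, with the
    -- same memory and the same state of `t`, makes `u` a thread that is about to perform it.
    valid-other {M = M} {th} {t} {u} m< R t≢u nt eu (commit-early {x = x} {v} {b}) val = go (freeze [] b R (cong ep eu))
      where
      go : Frozen _ _ M th u [] x v b → Valid (over (M ⟨ x ↦ v ⟩) (ep (th t))) (items (th t))
      go (frozen {states = th⁻} {index = i} m<′ R⁻ u⁻ _ _ w) =
        subst (λ ts → Valid (over (M ⟨ x ↦ v ⟩) (ep ts)) (items ts)) et
          (valid-changed (<-trans m<′ m<) R⁻ t≢u (subst Normal (sym et) nt) (cong ep (at u⁻))
            (_ , _ , λ N _ → subst (λ l → LStep u N l _ _ _) (sym (cong sc (at u⁻))) (w N))
            (subst (λ ts → Valid (over M (ep ts)) (items ts)) (sym et) val))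
        where
        et : th⁻ t ≡ th t
        et = off u⁻ t t≢u

    valid-inv : ∀ {E M th} → Reach n E M th → ∀ t → Valid (over M (ep (th t))) (items (th t))
    valid-inv {M = M} {th} R t = go ≤-refl R
      where
      go : ∀ {n′ E M th} → n′ ≤ n → Reach n′ E M th → Valid (over M (ep (th t))) (items (th t))
      go _ (init e) rewrite e t = tt
      go {th = th′} n≤ (step {M = M} {th₀} {t = u} {M′ = M′} R₀ ns eu st u′) with t ≟ u
      ... | yes refl = subst (λ ts → Valid (over M′ (ep ts)) (items ts)) (sym (at u′))
            (valid-own st (subst (λ ts → Valid (over M (ep ts)) (items ts)) eu (Inv.valid (ih n≤ R₀) t)))
      ... | no t≢u = subst (λ ts → Valid (over M′ (ep ts)) (items ts)) (sym (off u′ t t≢u))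
            (valid-other n≤ R₀ t≢u (ns t t≢u) eu st (Inv.valid (ih n≤ R₀) t))

    -- If no other thread has early writes, the memory of the history is what `u` sees and its step
    -- can be added directly. Otherwise the newest early write of some `s` is frozen away; the
    -- shorter history still ends with the step of `u`, and its run survives reinstating the write.
    -- Taking the newest write ensures that the steps lost by `s` after it are silent.
    run-inv : ∀ {E M th} → Reach n E M th → Run E (λ t → sc (th t))
    run-inv (init e) = [] (λ t → cong sc (e t))
    run-inv {th = th′} R@(step {E = E} {M} {th} {t = u} {ts} {nothing} {ts′ = ts′} R₀ ns eu st u′) =
      Run-cong same (Inv.run (ih ≤-refl R₀))
      where
      silent-sc : ∀ {M ts M′ ts′} → TStep u M ts nothing M′ ts′ → sc ts′ ≡ sc ts
      silent-sc (append _ _) = refl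
      silent-sc commit-early = refl
      same : ∀ s → sc (th′ s) ≡ sc (th s)
      same s with s ≟ u
      ... | yes refl = trans (cong sc (at u′)) (trans (silent-sc st) (cong sc (sym eu)))
      ... | no  s≢u  = cong sc (off u′ s s≢u)
    run-inv {M = M′} {th′} R@(step {E = E} {M} {th} {t = u} {ts} {just o} {ts′ = ts′} R₀ ns eu st u′) =
      go (pending? th (λ s → ¬? (s ≟ u)))
      where
      I : Inv E M th
      I = ih ≤-refl R₀
      go : (∃[ s ] s ≢ u × ep (th s) ≢ []) ⊎ (∀ s → s ≢ u → ep (th s) ≡ []) → Run ((u , o) ∷ E) (λ t → sc (th′ t))
      go (inj₂ none) = go′ (base-step st (subst (λ ts → Chain (sc ts) (items ts)) eu (chain R₀ u))
          (subst (λ ts → Valid (over M (ep ts)) (items ts)) eu (Inv.valid I u))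
          (λ x → trans (Inv.eval-over I u none x) (cong (λ ts → over M (ep ts) x) eu)))
        where
        go′ : ∃[ i ] LStep u (eval E) (sc ts) i o (sc ts′) → Run ((u , o) ∷ E) (λ t → sc (th′ t))
        go′ (i , s) = step (Inv.run I) (subst (λ l → LStep u (eval E) l i o (sc ts′)) (sym (cong sc eu)) s)
          (upd (cong sc (at u′)) (λ r r≢ → cong sc (off u′ r r≢)))
      go (inj₁ (s , s≢u , ne)) = go′ (unsnoc (ep (th s)) ne)
        where
        go′ : ∃[ b ] ∃[ y ] ∃[ w ] ep (th s) ≡ b ∷ʳ (y , w) → Run ((u , o) ∷ E) (λ t → sc (th′ t))
        go′ (b , y , w , eb) = go″ (freeze b [] R (trans (cong ep (off u′ s s≢u)) eb))
          where
          go″ : Frozen n ((u , o) ∷ E) M′ th′ s b y w [] → Run ((u , o) ∷ E) (λ t → sc (th′ t))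
          go″ F = splice (Frozen.cut F) (λ e → s≢u (sym e)) (reinstate F) (Inv.run I) (cong sc (off u′ s s≢u))
            (λ r r≢s → trans (update-other (λ q → sc (Frozen.states F q)) s (Frozen.loc′ F) r≢s)
              (cong sc (off (Frozen.update⁻ F) r r≢s)))

    invariant-step : ∀ {E M th} → Reach n E M th → Inv E M th
    invariant-step R = inv (run-inv R) (written-inv R) (unwritten-inv R) (valid-inv R)

  invariant : ∀ {n E M th} → Reach n E M th → Inv E M th
  invariant {n} = go (<-wellFounded n)
    where
    go : ∀ {n E M th} → Acc _<_ n → Reach n E M th → Inv E M th
    go (acc rs) R = invariant-step (λ m< → go (rs m<)) R

-- Flattening histories to actions, and moving commits back to their issues

module Flattening {V : ValueDomain} (P : Program V) where
  open import Data.Nat using (_<_; _≤_)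
  open ValueDomain V
  open Program P
  open Reordering P
  open Histories P
  open Machine P

  Acts : Set
  Acts = List (Action P)

  infix 4 _⇒_
  _⇒_ : Acts → Acts → Set
  _⇒_ = SameTrace P

  ≡⇒ : ∀ {π π′} → π ≡ π′ → π ⇒ π′
  ≡⇒ refl = SameTrace-refl _

  -- The actions of a history, without the commits of the last k t writes of
  -- each thread t.
  flat : (Thread P → ℕ) → History → Acts
  flat k []                 = []
  flat k ((t , tau) ∷ E)    = flat k E ∷ʳ tau t
  flat k ((t , rd x v) ∷ E) = flat k E ∷ʳ rd t x v
  flat k ((t , wr x v) ∷ E) with k t
  ... | zero  = flat k E ++ isu t ∷ com t x v ∷ []
  ... | suc m = flat (k ⟨ t ↦ m ⟩) E ∷ʳ isu t

  flat-done : ∀ k {t x v} E → k t ≡ 0 → flat k ((t , wr x v) ∷ E) ≡ flat k E ++ isu t ∷ com t x v ∷ []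
  flat-done k E e rewrite e = refl

  flat-pending : ∀ k {t x v m} E → k t ≡ suc m → flat k ((t , wr x v) ∷ E) ≡ flat (k ⟨ t ↦ m ⟩) E ∷ʳ isu t
  flat-pending k E e rewrite e = refl

  update-cong : ∀ {k k′ : Thread P → ℕ} t m → (∀ s → k s ≡ k′ s) → ∀ s → (k ⟨ t ↦ m ⟩) s ≡ (k′ ⟨ t ↦ m ⟩) s
  update-cong t m e s with t ≟ s
  ... | yes refl = refl
  ... | no  _    = e s

  flat-cong : ∀ {k k′} E → (∀ s → k s ≡ k′ s) → flat k E ≡ flat k′ E
  flat-cong []                 e = refl
  flat-cong ((t , tau) ∷ E)    e = cong (_∷ʳ _) (flat-cong E e)
  flat-cong ((t , rd _ _) ∷ E) e = cong (_∷ʳ _) (flat-cong E e)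
  flat-cong {k} {k′} ((t , wr x v) ∷ E) e with k t | k′ t | e t
  ... | zero  | zero  | refl = cong (_++ _) (flat-cong E e)
  ... | suc m | suc m | refl = cong (_∷ʳ _) (flat-cong E (update-cong t m e))

  flat-concat : ∀ k E → (∀ s → k s ≡ 0) → flat k E ≡ concat (labelsOf E)
  flat-concat k [] e = refl
  flat-concat k ((t , o) ∷ E) e = trans (lem o) (trans (cong₂ _++_ (flat-concat k E e) (sym (++-identityʳ _)))
      (concat-++ (labelsOf E) (label t o ∷ [])))
    where
    lem : ∀ o → flat k ((t , o) ∷ E) ≡ flat k E ++ label t o
    lem tau      = refl
    lem (rd _ _) = refl
    lem (wr _ _) = flat-done k E (e t)

  #writes : Thread P → History → ℕ
  #writes t []                 = 0
  #writes t ((u , wr _ _) ∷ E) with t ≟ u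
  ... | yes _ = suc (#writes t E)
  ... | no  _ = #writes t E
  #writes t ((u , _) ∷ E) = #writes t E

  Cut-#writes : ∀ {t x v n E H} → Cut t x v n E H → n < #writes t E
  Cut-#writes {t} root with t ≟ t
  ... | yes _ = s≤s z≤n
  ... | no  n = ⊥-elim (n refl)
  Cut-#writes (silent tau c) = Cut-#writes c
  Cut-#writes (silent rd c)  = Cut-#writes c
  Cut-#writes {t} (write c) with t ≟ t
  ... | yes _ = s≤s (Cut-#writes c)
  ... | no  n = ⊥-elim (n refl)
  Cut-#writes (other {o = tau} _ c)    = Cut-#writes c
  Cut-#writes (other {o = rd _ _} _ c) = Cut-#writes c
  Cut-#writes {t} (other {u = u} {wr _ _} u≢t c) with t ≟ u
  ... | yes e = ⊥-elim (u≢t (sym e))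
  ... | no  _ = Cut-#writes c

  #isu-++ : ∀ s A B → #isu P s (A ++ B) ≡ #isu P s A + #isu P s B
  #isu-++ s = Additive.on-++ (#isu-additive s)

  #com-++ : ∀ s A B → #com P s (A ++ B) ≡ #com P s A + #com P s B
  #com-++ s = Additive.on-++ (#com-additive s)

  #isu-flat : ∀ s k E → k s ≤ #writes s E → #isu P s (flat k E) ≡ #com P s (flat k E) + k s
  #isu-flat s k [] le with k s | le
  ... | zero | _ = refl
  #isu-flat s k ((t , tau) ∷ E) le
    rewrite #isu-++ s (flat k E) (tau t ∷ []) | #com-++ s (flat k E) (tau t ∷ [])
          | +-identityʳ (#isu P s (flat k E)) | +-identityʳ (#com P s (flat k E)) = #isu-flat s k E le
  #isu-flat s k ((t , rd x v) ∷ E) le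
    rewrite #isu-++ s (flat k E) (rd t x v ∷ []) | #com-++ s (flat k E) (rd t x v ∷ [])
          | +-identityʳ (#isu P s (flat k E)) | +-identityʳ (#com P s (flat k E)) = #isu-flat s k E le
  #isu-flat s k ((t , wr x v) ∷ E) le with k t in ek | s ≟ t
  ... | zero | yes refl
    rewrite #isu-++ s (flat k E) (isu s ∷ com s x v ∷ []) | #com-++ s (flat k E) (isu s ∷ com s x v ∷ []) with s ≟ s
  ...   | no n = ⊥-elim (n refl)
  ...   | yes _ rewrite ek | +-identityʳ (#com P s (flat k E) + 1)
          | #isu-flat s k E (subst (_≤ #writes s E) (sym ek) z≤n) | ek | +-identityʳ (#com P s (flat k E)) = refl
  #isu-flat s k ((t , wr x v) ∷ E) le | zero | no s≢t
    rewrite #isu-++ s (flat k E) (isu t ∷ com t x v ∷ []) | #com-++ s (flat k E) (isu t ∷ com t x v ∷ []) with s ≟ t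
  ...   | yes e = ⊥-elim (s≢t e)
  ...   | no _ rewrite +-identityʳ (#isu P s (flat k E)) | +-identityʳ (#com P s (flat k E)) = #isu-flat s k E le
  #isu-flat s k ((t , wr x v) ∷ E) le | suc m | yes refl
    rewrite #isu-++ s (flat (k ⟨ s ↦ m ⟩) E) (isu s ∷ []) | #com-++ s (flat (k ⟨ s ↦ m ⟩) E) (isu s ∷ []) | #isu-own s
          | +-identityʳ (#com P s (flat (k ⟨ s ↦ m ⟩) E))
    = trans (cong (_+ 1) (#isu-flat s (k ⟨ s ↦ m ⟩) E (subst (_≤ #writes s E) (sym (update-same k s m)) m≤)))
        (trans (+-assoc (#com P s (flat (k ⟨ s ↦ m ⟩) E)) _ 1)
          (cong (#com P s (flat (k ⟨ s ↦ m ⟩) E) +_) (trans (+-comm _ 1) (trans (cong suc (update-same k s m)) (sym ek)))))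
    where
    m≤ : m ≤ #writes s E
    m≤ with subst (_≤ suc (#writes s E)) ek le
    ... | s≤s p = p
  #isu-flat s k ((t , wr x v) ∷ E) le | suc m | no s≢t
    rewrite #isu-++ s (flat (k ⟨ t ↦ m ⟩) E) (isu t ∷ []) | #com-++ s (flat (k ⟨ t ↦ m ⟩) E) (isu t ∷ [])
          | #isu-other s (isu t) (λ { refl → s≢t refl })
          | +-identityʳ (#com P s (flat (k ⟨ t ↦ m ⟩) E)) | +-identityʳ (#isu P s (flat (k ⟨ t ↦ m ⟩) E))
    = trans (#isu-flat s (k ⟨ t ↦ m ⟩) E (subst (_≤ #writes s E) (sym (update-other k t m s≢t)) le))
        (cong (#com P s (flat (k ⟨ t ↦ m ⟩) E) +_) (update-other k t m s≢t))

  -- By the hypothesis some issue in `A` awaits its commit. The commit after the read is the next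
  -- one of `t`, so it belongs to such an issue; if it is on `x`, it is pending at the read.
  swap-rd-com-own : ∀ {A t x v y w C} → #com P t A < #isu P t A →
    A ++ rd t x v ∷ com t y w ∷ C ⇒ A ++ com t y w ∷ rd t x v ∷ C
  swap-rd-com-own {A} {t} {x} {v} {y} {w} {C} lt = swap-rd-com λ { refl → inj₂ (Pending-intro A (rd t x v ∷ []) C refl z<s
    (subst (_< #isu P t A) (sym (+-identityʳ _)) lt)) }

  -- The counterpart of `moveLeft` for traces: the commit passes stores and reads of other threads
  -- because they agree with it, reads of its own thread because it is pending there, and issues
  -- freely, until it stands next to its own issue.
  commit-to-issue : ∀ {t x v n E H k} (c : Cut t x v n E H) → AllAgree c → k t ≡ suc n → ∀ C →
    flat k E ++ com t x v ∷ C ⇒ flat (k ⟨ t ↦ n ⟩) E ++ C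
  commit-to-issue {t} {x} {v} {k = k} (root {E = E}) _ ek C = ≡⇒ (trans (cong (_++ com t x v ∷ C) (flat-pending k E ek))
    (trans (++-assoc (flat (k ⟨ t ↦ 0 ⟩) E) _ _)
      (trans (sym (++-assoc (flat (k ⟨ t ↦ 0 ⟩) E) (isu t ∷ com t x v ∷ []) C))
        (cong (_++ C) (sym (flat-done (k ⟨ t ↦ 0 ⟩) E (update-same k t 0)))))))
  commit-to-issue {t} {x} {v} {n} {k = k} (silent {E = E} tau c) ag ek C = SameTrace-trans
    (≡⇒ (++-assoc (flat k E) _ _)) (SameTrace-trans (swap-tau-com {flat k E})
      (SameTrace-trans (commit-to-issue c ag ek _) (≡⇒ (sym (++-assoc (flat (k ⟨ t ↦ n ⟩) E) _ _)))))
  commit-to-issue {t} {x} {v} {n} {k = k} (silent {E = E} rd c) ag ek C = SameTrace-trans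
    (≡⇒ (++-assoc (flat k E) _ _)) (SameTrace-trans (swap-rd-com-own {flat k E} lt)
      (SameTrace-trans (commit-to-issue c ag ek _) (≡⇒ (sym (++-assoc (flat (k ⟨ t ↦ n ⟩) E) _ _)))))
    where
    lt : #com P t (flat k E) < #isu P t (flat k E)
    lt = subst (#com P t (flat k E) <_)
      (sym (#isu-flat t k E (subst (_≤ #writes t E) (sym ek) (Cut-#writes c))))
      (m<m+n _ (subst (0 <_) (sym ek) z<s))
  commit-to-issue {t} {x} {v} {suc n} {k = k} (write {E = E} c) ag ek C = SameTrace-trans
    (≡⇒ (trans (cong (_++ com t x v ∷ C) (flat-pending k E ek)) (++-assoc (flat k₁ E) _ _)))
    (SameTrace-trans (swap-isu-com {flat k₁ E})
      (SameTrace-trans (commit-to-issue {k = k₁} c ag (update-same k t (suc n)) _)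
        (≡⇒ (trans (sym (++-assoc (flat (k₁ ⟨ t ↦ n ⟩) E) _ _))
          (cong (_++ C) (sym (flat-pending k₁ E (update-same k t (suc n)))))))))
    where
    k₁ : Thread P → ℕ
    k₁ = k ⟨ t ↦ suc n ⟩
  commit-to-issue {t} {x} {v} {n} {k = k} (other {u = u} {tau} {E} u≢t c) (_ , ag) ek C = SameTrace-trans
    (≡⇒ (++-assoc (flat k E) _ _)) (SameTrace-trans (swap-tau-com {flat k E})
      (SameTrace-trans (commit-to-issue c ag ek _) (≡⇒ (sym (++-assoc (flat (k ⟨ t ↦ n ⟩) E) _ _)))))
  commit-to-issue {t} {x} {v} {n} {k = k} (other {u = u} {rd y w} {E} u≢t c) (a , ag) ek C = SameTrace-trans
    (≡⇒ (++-assoc (flat k E) _ _)) (SameTrace-trans (swap-rd-com {flat k E} (λ e → inj₁ (a e)))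
      (SameTrace-trans (commit-to-issue c ag ek _) (≡⇒ (sym (++-assoc (flat (k ⟨ t ↦ n ⟩) E) _ _)))))
  commit-to-issue {t} {x} {v} {n} {k = k} (other {u = u} {wr y w} {E} u≢t c) (a , ag) ek C with k u in eu
  ... | zero = SameTrace-trans (≡⇒ (++-assoc (flat k E) _ _))
    (SameTrace-trans (≡⇒ (sym (++-assoc (flat k E) (isu u ∷ []) _)))
    (SameTrace-trans (swap-com {flat k E ∷ʳ isu u} u≢t a)
    (SameTrace-trans (≡⇒ (++-assoc (flat k E) (isu u ∷ []) _))
    (SameTrace-trans (swap-isu-com {flat k E})
    (SameTrace-trans (commit-to-issue c ag ek _)
    (≡⇒ (trans (sym (++-assoc (flat (k ⟨ t ↦ n ⟩) E) (isu u ∷ com u y w ∷ []) C))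
      (cong (_++ C) (sym (flat-done (k ⟨ t ↦ n ⟩) E (trans (update-other k t n u≢t) eu)))))))))))
  ... | suc m = SameTrace-trans (≡⇒ (++-assoc (flat k₁ E) _ _))
    (SameTrace-trans (swap-isu-com {flat k₁ E})
    (SameTrace-trans (commit-to-issue {k = k₁} c ag (trans (update-other k u m (λ e → u≢t (sym e))) ek) _)
    (≡⇒ (trans (sym (++-assoc (flat (k₁ ⟨ t ↦ n ⟩) E) _ _))
      (cong (_++ C) (trans (cong (_∷ʳ isu u) (flat-cong E comm))
        (sym (flat-pending (k ⟨ t ↦ n ⟩) E (trans (update-other k t n u≢t) eu)))))))))
    where
    k₁ : Thread P → ℕ
    k₁ = k ⟨ u ↦ m ⟩
    comm : ∀ s → (k₁ ⟨ t ↦ n ⟩) s ≡ ((k ⟨ t ↦ n ⟩) ⟨ u ↦ m ⟩) s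
    comm s with s ≟ t
    ... | yes refl = trans (update-same k₁ s n) (sym (trans (update-other (k ⟨ s ↦ n ⟩) u m (λ e → u≢t (sym e))) (update-same k s n)))
    ... | no s≢t with s ≟ u
    ...   | yes refl = trans (update-other k₁ t n s≢t) (trans (update-same k s m) (sym (update-same (k ⟨ t ↦ n ⟩) s m)))
    ...   | no s≢u = trans (update-other k₁ t n s≢t) (trans (update-other k u m s≢u)
            (sym (trans (update-other (k ⟨ t ↦ n ⟩) u m s≢u) (update-other k t n s≢t))))

  moveFront : ∀ A R a C → All NonCom R → NonCom a → All (λ c → threadOf P c ≢ threadOf P a) R →
    A ++ R ++ a ∷ C ⇒ A ++ a ∷ R ++ C
  moveFront A []      a C _          na _          = SameTrace-refl _
  moveFront A (c ∷ R) a C (nc ∷ ncs) na (t≢ ∷ t≢s) = SameTrace-trans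
    (≡⇒ (sym (++-assoc A (c ∷ []) _))) (SameTrace-trans (moveFront (A ∷ʳ c) R a C ncs na t≢s)
      (SameTrace-trans (≡⇒ (++-assoc A (c ∷ []) _)) (swap-local {A} nc na t≢)))

  moveCom : ∀ A R a C → (∀ X c Y → R ≡ X ++ c ∷ Y → (A ++ X) ++ c ∷ a ∷ Y ++ C ⇒ (A ++ X) ++ a ∷ c ∷ Y ++ C) →
    A ++ R ++ a ∷ C ⇒ A ++ a ∷ R ++ C
  moveCom A []      a C sw = SameTrace-refl _
  moveCom A (c ∷ R) a C sw = SameTrace-trans (≡⇒ (sym (++-assoc A (c ∷ []) _)))
    (SameTrace-trans (moveCom (A ∷ʳ c) R a C λ X d Y e →
        subst (λ z → z ++ d ∷ a ∷ Y ++ C ⇒ z ++ a ∷ d ∷ Y ++ C) (sym (++-assoc A (c ∷ []) X)) (sw (c ∷ X) d Y (cong (c ∷_) e)))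
      (SameTrace-trans (≡⇒ (++-assoc A (c ∷ []) _))
        (subst (λ z → z ++ c ∷ a ∷ R ++ C ⇒ z ++ a ∷ c ∷ R ++ C) (++-identityʳ A) (sw [] c R refl))))

  proj : Thread P → Acts → Acts
  proj t []      = []
  proj t (a ∷ R) with threadOf P a ≟ t
  ... | yes _ = a ∷ proj t R
  ... | no  _ = proj t R

  proj-++ : ∀ t R R′ → proj t (R ++ R′) ≡ proj t R ++ proj t R′
  proj-++ t []      R′ = refl
  proj-++ t (a ∷ R) R′ with threadOf P a ≟ t
  ... | yes _ = cong (a ∷_) (proj-++ t R R′)
  ... | no  _ = proj-++ t R R′

  proj-own : ∀ {t} a → threadOf P a ≡ t → proj t (a ∷ []) ≡ a ∷ []
  proj-own {t} a e with threadOf P a ≟ t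
  ... | yes _ = refl
  ... | no  n = ⊥-elim (n e)

  proj-other : ∀ {t} a → threadOf P a ≢ t → proj t (a ∷ []) ≡ []
  proj-other {t} a n with threadOf P a ≟ t
  ... | yes e = ⊥-elim (n e)
  ... | no  _ = refl

  proj-[] : ∀ {t} R → proj t R ≡ [] → All (λ c → threadOf P c ≢ t) R
  proj-[] []      _ = []
  proj-[] {t} (a ∷ R) e with threadOf P a ≟ t
  ... | no n = n ∷ proj-[] R e

  proj-head : ∀ {t a as} R → proj t R ≡ a ∷ as → ∃[ R₁ ] ∃[ R₂ ] R ≡ R₁ ++ a ∷ R₂ × threadOf P a ≡ t ×
    All (λ c → threadOf P c ≢ t) R₁ × proj t (R₁ ++ R₂) ≡ as × (∀ s → s ≢ t → proj s (R₁ ++ R₂) ≡ proj s R)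
  proj-head {t} (c ∷ R) e with threadOf P c ≟ t
  proj-head {t} (c ∷ R) refl | yes ec = [] , R , refl , ec , [] , refl , λ s s≢t → sym (same s s≢t)
    where
    same : ∀ s → s ≢ t → proj s (c ∷ R) ≡ proj s R
    same s s≢t with threadOf P c ≟ s
    ... | yes e = ⊥-elim (s≢t (trans (sym e) ec))
    ... | no  _ = refl
  proj-head {t} (c ∷ R) e | no c≢ with proj-head R e
  ... | R₁ , R₂ , refl , ea , al , e₁ , e₂ = c ∷ R₁ , R₂ , refl , ea , c≢ ∷ al , own , others
    where
    own : proj t (c ∷ R₁ ++ R₂) ≡ _
    own with threadOf P c ≟ t
    ... | yes ec = ⊥-elim (c≢ ec)
    ... | no  _  = e₁
    others : ∀ s → s ≢ t → proj s (c ∷ R₁ ++ R₂) ≡ proj s (c ∷ R)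
    others s s≢t with threadOf P c ≟ s
    ... | yes _ = cong (c ∷_) (e₂ s s≢t)
    ... | no  _ = e₂ s s≢t

  issue : Thread P → Op → Action P
  issue t tau      = tau t
  issue t (rd x v) = rd t x v
  issue t (wr _ _) = isu t

  issue-nonCom : ∀ t o → NonCom (issue t o)
  issue-nonCom t tau      = tau
  issue-nonCom t (rd _ _) = rd
  issue-nonCom t (wr _ _) = isu

  issue-thread : ∀ t o → threadOf P (issue t o) ≡ t
  issue-thread t tau      = refl
  issue-thread t (rd _ _) = refl
  issue-thread t (wr _ _) = refl

  issue-rd : ∀ {t x v} o → issue t o ≡ rd t x v → o ≡ rd x v
  issue-rd (rd _ _) refl = refl

  act : ∀ {t} → Item t → Action P
  act {t} it = issue t (op it)

  #isu-proj : ∀ s X (its : List (Item s)) → All NonCom X → proj s X ≡ map act its → #isu P s X ≡ length (writes its)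
  #isu-proj s X its nc e = trans (reduce X nc) (trans (cong (#isu P s) e) (count its))
    where
    reduce : ∀ X → All NonCom X → #isu P s X ≡ #isu P s (proj s X)
    reduce [] [] = refl
    reduce (c ∷ X) (n ∷ ns) with threadOf P c ≟ s
    ... | yes _ = trans (Additive.on-∷ (#isu-additive s) c X) (trans (cong (#isu P s (c ∷ []) +_) (reduce X ns))
                    (sym (Additive.on-∷ (#isu-additive s) c (proj s X))))
    ... | no c≢ = trans (Additive.on-∷ (#isu-additive s) c X)
                    (trans (cong (_+ #isu P s X) (#isu-other s c (λ { refl → c≢ refl }))) (reduce X ns))
    count : ∀ its → #isu P s (map act its) ≡ length (writes {s} its)
    count [] = refl
    count (it ∷ its) with op it
    ... | tau    = count its
    ... | rd _ _ = count its
    ... | wr _ _ = trans (Additive.on-∷ (#isu-additive s) (isu s) _) (cong₂ _+_ (#isu-own s) (count its))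

  #com-nonCom : ∀ s X → All NonCom X → #com P s X ≡ 0
  #com-nonCom s []       []         = refl
  #com-nonCom s (_ ∷ X) (isu ∷ ns) = #com-nonCom s X ns
  #com-nonCom s (_ ∷ X) (rd ∷ ns)  = #com-nonCom s X ns
  #com-nonCom s (_ ∷ X) (tau ∷ ns) = #com-nonCom s X ns

  map-split : ∀ {A B : Set} {f : A → B} (xs : List A) ys {y zs} → map f xs ≡ ys ++ y ∷ zs →
    ∃[ xs₁ ] ∃[ x ] ∃[ xs₂ ] xs ≡ xs₁ ++ x ∷ xs₂ × map f xs₁ ≡ ys × f x ≡ y
  map-split []       []       ()
  map-split []       (_ ∷ _) ()
  map-split (x ∷ xs) []       refl = [] , x , xs , refl , refl , refl
  map-split {f = f} (x ∷ xs) (y ∷ ys) e with ∷-injective e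
  ... | refl , e′ with map-split xs ys e′
  ... | xs₁ , x′ , xs₂ , refl , refl , ex = x ∷ xs₁ , x′ , xs₂ , refl , refl , ex

  newest-split : ∀ x b {w} → newest P x b ≡ just w → ∃[ b₁ ] ∃[ w′ ] ∃[ b₂ ] b ≡ b₁ ++ (x , w′) ∷ b₂
  newest-split x ((y , v) ∷ b) e with y ≟ x
  ... | yes refl = [] , v , b , refl
  ... | no _ with newest-split x b e
  ...   | b₁ , w′ , b₂ , refl = (y , v) ∷ b₁ , w′ , b₂ , refl

  CommitAhead : Thread P → Var P → D → ℕ → Acts → Set
  CommitAhead s x w n π = ∃[ C₁ ] ∃[ C₂ ] π ≡ C₁ ++ com s x w ∷ C₂ × #com P s C₁ ≡ n

  CommitAhead-++ : ∀ {s x w n π} as {m} → #com P s as ≡ m → CommitAhead s x w n π → CommitAhead s x w (m + n) (as ++ π)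
  CommitAhead-++ {s} as e (C₁ , C₂ , refl , e′) = as ++ C₁ , C₂ , sym (++-assoc as C₁ _) , trans (#com-++ s as C₁) (cong₂ _+_ e e′)

  -- Buffers are empty at the end and entries leave them oldest first, so the commit of this entry
  -- comes after exactly those of `b`. This number later identifies its issue.
  commit-ahead : ∀ {σ π σf s x w} b {b′} → TSOPath P σ π σf → TSOState.buf σf s ≡ [] →
    TSOState.buf σ s ≡ b ++ (x , w) ∷ b′ → CommitAhead s x w (length b) π
  commit-ahead b [] ef e = ⊥-elim (≢[] b (trans (sym ef) e))
  commit-ahead b (assign _ _ _ ∷ p)   ef e = CommitAhead-++ (_ ∷ []) refl (commit-ahead b p ef e)
  commit-ahead b (read _ _ _ _ ∷ p)   ef e = CommitAhead-++ (_ ∷ []) refl (commit-ahead b p ef e)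
  commit-ahead b (fence _ _ _ _ ∷ p)  ef e = CommitAhead-++ (_ ∷ []) refl (commit-ahead b p ef e)
  commit-ahead b (skip _ _ _ ∷ p)     ef e = CommitAhead-++ (_ ∷ []) refl (commit-ahead b p ef e)
  commit-ahead b (assume _ _ _ _ ∷ p) ef e = CommitAhead-++ (_ ∷ []) refl (commit-ahead b p ef e)
  commit-ahead b (cas-failure _ _ _ _ _ ∷ p) ef e = CommitAhead-++ (_ ∷ []) refl (commit-ahead b p ef e)
  commit-ahead {s = s} b (cas-success {reg = reg} {t = t} i {x = x} {e₂ = e₂} _ _ em _ ∷ p) ef e with s ≟ t
  ... | yes refl = ⊥-elim (≢[] b (trans (sym em) e))
  ... | no s≢t = CommitAhead-++ (_ ∷ _ ∷ []) (#com-other s (com t x (e₂ (reg t))) (λ { _ _ refl → s≢t refl })) (commit-ahead b p ef e)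
  commit-ahead {s = s} {x} {w} b {b′} (write {buf = buf} {t = t} i _ _ ∷ p) ef e with s ≟ t
  ... | no s≢t = CommitAhead-++ (_ ∷ []) refl (commit-ahead b p ef (trans (update-other buf t _ s≢t) e))
  ... | yes refl = CommitAhead-++ (_ ∷ []) refl (commit-ahead b {b′ ∷ʳ _} p ef
        (trans (update-same buf t _) (trans (cong (_∷ʳ _) e) (++-assoc b _ _))))
  commit-ahead {s = s} {x} {w} b {b′} (commit {buf = buf} {t = t} {x = y} {v} {b₀} eb ∷ p) ef e with s ≟ t
  ... | no s≢t = CommitAhead-++ (_ ∷ []) (#com-other s (com t y v) (λ { _ _ refl → s≢t refl }))
        (commit-ahead b p ef (trans (update-other buf t _ s≢t) e))
  commit-ahead {s = s} [] (commit eb ∷ p) ef e | yes refl with trans (sym eb) e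
  ... | refl = [] , _ , refl , refl
  commit-ahead {s = s} (_ ∷ b) (commit {buf = buf} {x = y} {v} eb ∷ p) ef e | yes refl with trans (sym eb) e
  ... | refl = CommitAhead-++ (_ ∷ []) (#com-own s {y} {v}) (commit-ahead b p ef (update-same buf s _))

  -- A deferred read either has the value that is committed or reads from the
  -- buffer of its thread.
  swap-deferred : ∀ {A t x v c Y C} X (its : ∀ s → List (Item s)) (b : Thread P → Buffer) →
    let R = X ++ c ∷ Y in
    All NonCom R → (∀ s → proj s R ≡ map act (its s)) → #com P t A < #isu P t A →
    (∀ s → s ≢ t → #isu P s A ≡ #com P s A + length (b s)) →
    (∀ s → s ≢ t → ∃[ M ] M x ≡ v × Valid (over M (b s)) (its s)) →
    (∀ s {y w} b₁ {b₂} → s ≢ t → b s ++ writes (its s) ≡ b₁ ++ (y , w) ∷ b₂ → CommitAhead s y w (length b₁) C) →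
    (A ++ X) ++ c ∷ com t x v ∷ Y ++ C ⇒ (A ++ X) ++ com t x v ∷ c ∷ Y ++ C
  swap-deferred {A} {t} {x} {v} {c} {Y} {C} X its b nc inter own balance valid ahead = go c (++⁻ X nc) inter
    where
    go : ∀ c → All NonCom X × All NonCom (c ∷ Y) → (∀ s → proj s (X ++ c ∷ Y) ≡ map act (its s)) →
      (A ++ X) ++ c ∷ com t x v ∷ Y ++ C ⇒ (A ++ X) ++ com t x v ∷ c ∷ Y ++ C
    go (isu _) _ _ = swap-isu-com {A ++ X}
    go (tau _) _ _ = swap-tau-com {A ++ X}
    go (com _ _ _) (_ , () ∷ _) _
    go (rd s y w) (ncX , _ ∷ ncY) inter with s ≟ t
    ... | yes refl = swap-rd-com-own {A ++ X} (subst₂ _<_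
          (sym (trans (#com-++ s A X) (trans (cong (#com P s A +_) (#com-nonCom s X ncX)) (+-identityʳ _))))
          (sym (#isu-++ s A X)) (≤-trans own (m≤m+n _ _)))
    ... | no s≢t = swap-rd-com {A ++ X} cond
      where
      cond : y ≡ x → w ≡ v ⊎ (∀ r → toℕ r ≡ length (A ++ X) →
        ∃[ p ] Pending P ((A ++ X) ++ rd s y w ∷ com t x v ∷ Y ++ C) s y p r)
      cond refl with map-split (its s) (proj s X) {rd s y w} {proj s Y} (trans (sym (inter s))
              (trans (proj-++ s X (rd s y w ∷ Y)) (cong (proj s X ++_)
                (trans (proj-++ s (rd s y w ∷ []) Y) (cong (_++ proj s Y) (proj-own {s} (rd s y w) refl))))))
      ... | its₁ , it , its₂ , ei , e₁ , e₂ = decide (valid s s≢t)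
        where
        op≡ : op it ≡ rd y w
        op≡ = issue-rd (op it) e₂

        decide : ∃[ M ] M y ≡ v × Valid (over M (b s)) (its s) → _
        decide (M , eM , val) = by-newest (newest P y (b s ++ writes its₁)) refl
          where
          value : over M (b s ++ writes its₁) y ≡ w
          value = trans (sym (over-writes M (b s) its₁ y)) (valid-at its₁ (subst (Valid _) ei val))
            where
            valid-at : ∀ {N : Mem P} its₁ → Valid N (its₁ ++ it ∷ its₂) → applyAll N its₁ y ≡ w
            valid-at [] (ok , _) rewrite op≡ = ok
            valid-at (_ ∷ its₁) (_ , vs) = valid-at its₁ vs
          by-newest : ∀ m → newest P y (b s ++ writes its₁) ≡ m → w ≡ v ⊎ _
          -- No write of the thread hides the memory, so the read, valid in the memory `M` after the
          -- commit, must have the committed value.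
          by-newest nothing en = inj₁ (trans (sym value) (trans (cong (fromMaybe (M y)) en) eM))
          -- A write of the thread to `y` was issued before the read and is still in the TSO buffer,
          -- so its commit lies in `C`.
          by-newest (just _) en with newest-split y (b s ++ writes its₁) en
          ... | b₁ , w′ , b₂ , eb with ahead s b₁ {b₂ ++ writes (it ∷ its₂)} s≢t
                  (trans (cong (b s ++_) (trans (cong writes ei) (writes-++ its₁ (it ∷ its₂))))
                    (trans (sym (++-assoc (b s) (writes its₁) _)) (trans (cong (_++ writes (it ∷ its₂)) eb) (++-assoc b₁ _ _))))
            where
            writes-++ : ∀ {t} (its its′ : List (Item t)) → writes (its ++ its′) ≡ writes its ++ writes its′
            writes-++ []         its′ = refl
            writes-++ (it ∷ its) its′ = trans (cong (wrote (op it) ++_) (writes-++ its its′)) (sym (++-assoc (wrote (op it)) _ _))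
          ...   | C₁ , C₂ , refl , e₃ = inj₂ (Pending-intro (A ++ X) (rd s y w ∷ com t y v ∷ Y ++ C₁) C₂
                    (cong (λ z → (A ++ X) ++ rd s y w ∷ com t y v ∷ z) (sym (++-assoc Y C₁ _))) z<s
                    (subst₂ _<_ (cong₂ _+_ (sym comA) (sym comB)) (sym isuA)
                      (+-monoʳ-< (#com P s A) (subst (length b₁ <_) (trans (sym (length-++ b₁)) (trans (cong length (sym eb)) (length-++ (b s))))
                        (m<m+n (length b₁) z<s)))))
            where
            comA : #com P s (A ++ X) ≡ #com P s A
            comA = trans (#com-++ s A X) (trans (cong (#com P s A +_) (#com-nonCom s X ncX)) (+-identityʳ _))
            comB : #com P s (rd s y w ∷ com t y v ∷ Y ++ C₁) ≡ length b₁
            comB = trans (Additive.on-∷ (#com-additive s) (com t y v) (Y ++ C₁))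
              (trans (cong₂ _+_ (#com-other s (com t y v) (λ { _ _ refl → s≢t refl }))
                (trans (#com-++ s Y C₁) (cong (_+ #com P s C₁) (#com-nonCom s Y ncY)))) e₃)
            isuA : #isu P s (A ++ X) ≡ #com P s A + (length (b s) + length (writes its₁))
            isuA = trans (#isu-++ s A X) (trans (cong₂ _+_ (balance s s≢t) (#isu-proj s X its₁ ncX (sym e₁)))
              (+-assoc (#com P s A) _ _))

-- Simulation of TSO executions by the machine

module Simulation {V : ValueDomain} (P : Program V) where
  open import Data.Nat using (_<_; _≤_)
  open ValueDomain V
  open Program P
  open Reordering P
  open Histories P
  open Machine P
  open Surgery P
  open Invariant P
  open Flattening P

  pending : States → Thread P → ℕ
  pending th t = length (ep (th t))

  pending≤#writes : ∀ {n E M th} → Reach n E M th → ∀ s → pending th s ≤ #writes s E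
  pending≤#writes {E = E} {th = th} R s = go (ep (th s)) refl
    where
    go : ∀ b → ep (th s) ≡ b → length b ≤ #writes s E
    go []      _ = z≤n
    go (_ ∷ b) e = Cut-#writes (Frozen.cut (freeze [] b R e))

  balanced : ∀ {n E M th} → Reach n E M th → ∀ s →
    #isu P s (flat (pending th) E) ≡ #com P s (flat (pending th) E) + pending th s
  balanced {E = E} {th = th} R s = #isu-flat s (pending th) E (pending≤#writes R s)

  Interleaves : Acts → States → Set
  Interleaves R th = ∀ t → proj t R ≡ map act (items (th t))

  -- `L` is a reordering of the TSO execution up to `σ`: the history without the commits still to
  -- come, followed by the actions of the waiting items in an interleaving that respects each
  -- thread.
  record Config (σ : TSOState P) (L : Acts) : Set where
    constructor config
    field
      {size}     : ℕ
      {history}  : History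
      {states}   : States
      {deferred} : Acts
      reach      : Reach size history (TSOState.mem σ) states
      locs       : ∀ t → (TSOState.pc σ t , TSOState.reg σ t) ≡ end (sc (states t)) (items (states t))
      bufs       : ∀ t → TSOState.buf σ t ≡ ep (states t) ++ writes (items (states t))
      inter      : Interleaves deferred states
      nonCom     : All NonCom deferred
      list       : L ≡ flat (pending states) history ++ deferred

  update-elim : ∀ {th : States} {t ts} (Q : ∀ s → TState s → Set) → Q t ts → (∀ s → s ≢ t → Q s (th s)) →
    ∀ s → Q s ((th ⟨ t ↦ ts ⟩) s)
  update-elim {th} {t} {ts} Q q qs s with s ≟ t
  ... | yes refl = subst (Q s) (sym (update-same th s ts)) q
  ... | no  s≢t  = subst (Q s) (sym (update-other th t ts s≢t)) (qs s s≢t)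

  OthersNormal : Thread P → States → Set
  OthersNormal t th = ∀ s → s ≢ t → Normal (th s)

  OthersNormal-update : ∀ {t th ts} → OthersNormal t th → OthersNormal t (th ⟨ t ↦ ts ⟩)
  OthersNormal-update {t} {th} {ts} ns s s≢t = subst Normal (sym (update-other th t ts s≢t)) (ns s s≢t)

  -- The continuation `C` is part of the statement because traces are compared for complete lists:
  -- whether a read is from the buffer depends on commits that come later.
  record Emitted (σ : TSOState P) (t : Thread P) (its : List (Item t)) (L : Acts) : Set where
    constructor emitted
    field
      {list′} : Acts
      conf    : Config σ list′
      normal  : OthersNormal t (Config.states conf)
      rest    : items (Config.states conf t) ≡ its
      trace   : ∀ C → L ++ C ⇒ list′ ++ C

  -- The first deferred action of `t` is preceded in the deferred part only by non-commit actions of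
  -- other threads, so it can move to the end of the flattened history.
  emission : ∀ {σ L t l b it its o ts′} (c : Config σ L) → OthersNormal t (Config.states c) →
    Config.states c t ≡ ⟨ l , b , it ∷ its ⟩ → o ≡ op it →
    TStep t (TSOState.mem σ) ⟨ l , b , it ∷ its ⟩ (just o) (TSOState.mem σ) ts′ →
    sc ts′ ≡ tgt it → items ts′ ≡ its → ep ts′ ≡ b ++ wrote (op it) →
    flat (pending (Config.states c ⟨ t ↦ ts′ ⟩)) ((t , o) ∷ Config.history c) ≡
      flat (pending (Config.states c)) (Config.history c) ∷ʳ act it →
    Emitted σ t its L
  emission {σ} {L} {t} {l} {b} {it} {its} {o} {ts′} (config {_} {E} {th} {R} reach locs bufs inter nonCom refl) ns et refl st esc eits eep eflat =
    go (proj-head R (trans (inter t) (cong (λ ts → map act (items ts)) et)))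
    where
    th′ : States
    th′ = th ⟨ t ↦ ts′ ⟩
    go : ∃[ R₁ ] ∃[ R₂ ] R ≡ R₁ ++ act it ∷ R₂ × threadOf P (act it) ≡ t ×
      All (λ c → threadOf P c ≢ t) R₁ × proj t (R₁ ++ R₂) ≡ map act its × (∀ s → s ≢ t → proj s (R₁ ++ R₂) ≡ proj s R) →
      Emitted σ t its L
    go (R₁ , R₂ , refl , ea , al , e₁ , e₂) = emitted
      (config {deferred = R₁ ++ R₂} (step reach ns et st update)
        (update-elim (λ s ts → (TSOState.pc σ s , TSOState.reg σ s) ≡ end (sc ts) (items ts))
          (trans (locs t) (trans (cong (λ ts → end (sc ts) (items ts)) et) (sym (cong₂ end esc eits))))
          (λ s _ → locs s))
        (update-elim (λ s ts → TSOState.buf σ s ≡ ep ts ++ writes (items ts))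
          (trans (bufs t) (trans (cong (λ ts → ep ts ++ writes (items ts)) et)
            (trans (sym (++-assoc b (wrote (op it)) (writes its))) (sym (cong₂ (λ a z → a ++ writes z) eep eits)))))
          (λ s _ → bufs s))
        (update-elim (λ s ts → proj s (R₁ ++ R₂) ≡ map act (items ts))
          (trans e₁ (cong (map act) (sym eits)))
          (λ s s≢t → trans (e₂ s s≢t) (inter s)))
        (++⁺ (proj₁ (++⁻ R₁ nonCom)) (tail (proj₂ (++⁻ R₁ nonCom)))) refl)
      (OthersNormal-update ns)
      (trans (cong items (update-same th t ts′)) eits)
      λ C → SameTrace-trans (≡⇒ (trans (++-assoc F (R₁ ++ act it ∷ R₂) C) (cong (F ++_) (++-assoc R₁ (act it ∷ R₂) C))))
        (SameTrace-trans (moveFront F R₁ (act it) (R₂ ++ C) (proj₁ (++⁻ R₁ nonCom)) (issue-nonCom t (op it))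
            (subst (λ u → All (λ c → threadOf P c ≢ u) R₁) (sym ea) al))
          (≡⇒ (trans (cong (λ z → F ++ act it ∷ z) (sym (++-assoc R₁ R₂ C)))
            (trans (sym (++-assoc F (act it ∷ []) _))
              (trans (cong (_++ (R₁ ++ R₂) ++ C) (sym eflat)) (sym (++-assoc (flat (pending th′) ((t , op it) ∷ E)) _ _)))))))
      where
      F : Acts
      F = flat (pending th) E
      tail : ∀ {a as} → All NonCom (a ∷ as) → All NonCom as
      tail (_ ∷ ns) = ns

  module _ (atomic : WriteAtomic P) where

    record Drained (σ : TSOState P) (L : Acts) : Set where
      constructor drained
      field
        {list′} : Acts
        conf    : Config σ list′
        normal  : ∀ s → Normal (Config.states conf s)
        trace   : ∀ C → L ++ C ⇒ list′ ++ C

    all-normal : ∀ {t} {th : States} → OthersNormal t th → Normal (th t) → ∀ s → Normal (th s)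
    all-normal {t} ns n s with s ≟ t
    ... | yes refl = n
    ... | no  s≢t  = ns s s≢t

    DStep-IsWrite : ∀ {t l i o x v l′} → DStep t l i o l′ → o ≡ wr x v → IsWrite P t i
    DStep-IsWrite (write _ q) refl = _ , _ , q

    -- Write atomicity is used here only: emission goes on until a write is met for which it yields
    -- the second alternative, and that write makes the thread normal.
    drain : ∀ {σ L} t its (c : Config σ L) → items (Config.states c t) ≡ its → OthersNormal t (Config.states c) → Drained σ L
    drain t [] c e ns = drained c
      (all-normal {th = th} ns (subst (λ z → Normal ⟨ sc (th t) , ep (th t) , z ⟩) (sym e) idle)) (λ C → SameTrace-refl _)
      where
      th = Config.states c
    drain {σ} {L} t (it ∷ its) c e ns = by-op (op it) refl
      where
      th : States
      th = Config.states c
      E : History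
      E = Config.history c
      et : th t ≡ ⟨ sc (th t) , ep (th t) , it ∷ its ⟩
      et = cong (λ z → ⟨ sc (th t) , ep (th t) , z ⟩) e

      continue : Emitted σ t its L → Drained σ L
      continue (emitted conf normal rest trace) = compose (drain t its conf rest normal)
        where
        compose : Drained σ _ → Drained σ L
        compose (drained c′ n′ tr′) = drained c′ n′ (λ C → SameTrace-trans (trace C) (tr′ C))

      pending-same : ∀ {l its′} s → pending (th ⟨ t ↦ ⟨ l , ep (th t) , its′ ⟩ ⟩) s ≡ pending th s
      pending-same {l} {its′} = update-elim {th = th} {t} {⟨ l , ep (th t) , its′ ⟩} (λ s ts → length (ep ts) ≡ pending th s) refl (λ _ _ → refl)

      emit-silent : NonWrite (op it) → wrote (op it) ≡ [] →
        (∀ k → flat k ((t , op it) ∷ E) ≡ flat k E ∷ʳ act it) → Drained σ L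
      emit-silent nw ew fl = continue (emission c ns et refl (emit nw) refl refl
        (sym (trans (cong (ep (th t) ++_) ew) (++-identityʳ _)))
        (trans (fl _) (cong (_∷ʳ act it) (flat-cong E pending-same))))

      by-op : ∀ o → op it ≡ o → Drained σ L
      by-op tau eo = emit-silent (subst NonWrite (sym eo) tau) (cong wrote eo)
        (λ k → subst (λ o → flat k ((t , o) ∷ E) ≡ flat k E ∷ʳ issue t o) (sym eo) refl)
      by-op (rd x v) eo = emit-silent (subst NonWrite (sym eo) rd) (cong wrote eo)
        (λ k → subst (λ o → flat k ((t , o) ∷ E) ≡ flat k E ∷ʳ issue t o) (sym eo) refl)
      by-op (wr x v) eo with atomic t (idx it) (DStep-IsWrite (dstep it) eo)
      ... | inj₂ lt = drained c (all-normal {th = th} ns (subst Normal (sym et) (late eo lt))) (λ C → SameTrace-refl _)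
      -- The early write raises the number of pending commits of `t` by one, so the flattened
      -- history gains only its issue.
      ... | inj₁ lm = continue (emission c ns et (sym eo) (emit-early eo lm) refl refl (cong (λ o → ep (th t) ++ wrote o) (sym eo))
            (trans (flat-pending (pending th′) E (trans (cong (λ ts → length (ep ts)) (update-same th t _)) (length-∷ʳ (ep (th t)) _)))
              (cong₂ _∷ʳ_ (flat-cong E same) (cong (issue t) (sym eo)))))
        where
        th′ : States
        th′ = th ⟨ t ↦ ⟨ tgt it , ep (th t) ∷ʳ (x , v) , its ⟩ ⟩
        same : ∀ s → (pending th′ ⟨ t ↦ length (ep (th t)) ⟩) s ≡ pending th s
        same s with s ≟ t
        ... | yes refl = update-same (pending th′) s _
        ... | no  s≢t  = trans (update-other (pending th′) t _ s≢t) (cong (λ ts → length (ep ts)) (update-other th t _ s≢t))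

  record Advanced (σ : TSOState P) (t : Thread P) (π rest : Acts) : Set where
    constructor advanced
    field
      {list′} : Acts
      conf    : Config σ list′
      normal  : OthersNormal t (Config.states conf)
      trace   : π ⇒ list′ ++ rest

  writes-∷ʳ : ∀ {t} its (it : Item t) → writes (its ∷ʳ it) ≡ writes its ++ wrote (op it)
  writes-∷ʳ []         it = ++-identityʳ _
  writes-∷ʳ (i ∷ its) it = trans (cong (wrote (op i) ++_) (writes-∷ʳ its it)) (sym (++-assoc (wrote (op i)) _ _))

  -- Every instruction other than a fence or a cas first becomes an item, even in an idle thread;
  -- `drain` then decides whether it has to wait.
  defer : ∀ {pc mem reg buf pc′ reg′ buf′ L t rest} (it : Item t) → let σ = (⟪_,_,_,_⟫ pc mem reg buf) in
    (c : Config σ L) → (∀ s → Normal (Config.states c s)) →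
    src it ≡ (pc t , reg t) → (pc′ t , reg′ t) ≡ tgt it →
    (∀ s → s ≢ t → _≡_ {A = Loc s} (pc′ s , reg′ s) (pc s , reg s)) →
    buf′ t ≡ buf t ++ wrote (op it) → (∀ s → s ≢ t → buf′ s ≡ buf s) → Ok (over mem (buf t)) (op it) →
    Advanced (⟪_,_,_,_⟫ pc′ mem reg′ buf′) t (L ++ act it ∷ rest) rest
  defer {pc} {mem} {reg} {buf} {pc′} {reg′} {buf′} {t = t} {rest} it (config {_} {E} {th} {R} reach locs bufs inter nonCom refl) ns es et eo eb ebo ok =
    advanced
      (config {deferred = R ∷ʳ act it} (step reach (λ s _ → ns s) refl
          (append (trans es (locs t)) (subst (λ b → Ok (over mem b) (op it)) (bufs t) ok)) update)
        (update-elim (λ s ts → (pc′ s , reg′ s) ≡ end (sc ts) (items ts))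
          (trans et (sym (end-∷ʳ (sc (th t)) (items (th t)) it))) (λ s s≢t → trans (eo s s≢t) (locs s)))
        (update-elim (λ s ts → buf′ s ≡ ep ts ++ writes (items ts))
          (trans eb (trans (cong (_++ wrote (op it)) (bufs t)) (trans (++-assoc (ep (th t)) _ _)
            (cong (ep (th t) ++_) (sym (writes-∷ʳ (items (th t)) it))))))
          (λ s s≢t → trans (ebo s s≢t) (bufs s)))
        (update-elim (λ s ts → proj s (R ∷ʳ act it) ≡ map act (items ts))
          (trans (proj-++ t R (act it ∷ [])) (trans (cong₂ _++_ (inter t) (proj-own (act it) (issue-thread t (op it))))
            (sym (map-++ act (items (th t)) (it ∷ [])))))
          (λ s s≢t → trans (proj-++ s R (act it ∷ []))
            (trans (cong (proj s R ++_) (proj-other (act it) (λ e → s≢t (trans (sym e) (issue-thread t (op it))))))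
              (trans (++-identityʳ _) (inter s)))))
        (++⁺ nonCom (issue-nonCom t (op it) ∷ [])) refl)
      (OthersNormal-update (λ s _ → ns s))
      (≡⇒ (trans (++-assoc F R (act it ∷ rest)) (trans (cong (F ++_) (sym (++-assoc R (act it ∷ []) rest)))
        (trans (sym (++-assoc F (R ∷ʳ act it) rest)) (cong (λ z → (z ++ R ∷ʳ act it) ++ rest) (flat-cong E same))))))
    where
    F : Acts
    F = flat (pending th) E
    same : ∀ s → pending th s ≡ pending (th ⟨ t ↦ ⟨ sc (th t) , ep (th t) , items (th t) ∷ʳ it ⟩ ⟩) s
    same = update-elim {th = th} {t} {⟨ sc (th t) , ep (th t) , items (th t) ∷ʳ it ⟩}
      (λ s ts → pending th s ≡ length (ep ts)) refl (λ _ _ → refl)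

  module _ {t : Thread P} {x : Var P} {v : D} {n : ℕ} {E : History} {M : Mem P} {th : States}
    {R rest : Acts} {pc : PC P} {reg : Regs P} {buf : Buf P} {σf : TSOState P}
    (R′ : Reach n E M th) (inter : Interleaves R th) (nc : All NonCom R) (Mx : M x ≡ v)
    (bufs : ∀ s → buf s ≡ ep (th s) ++ writes (items (th s)))
    (p : TSOPath P (⟪_,_,_,_⟫ pc M reg buf) rest σf) (final : ∀ s → TSOState.buf σf s ≡ []) where

    -- `M` is the memory after the commit. The waiting items are valid in it by the invariant of the
    -- state reached, which is what the reads to be passed require.
    move-commit : ∀ A → #com P t A < #isu P t A → (∀ s → s ≢ t → #isu P s A ≡ #com P s A + pending th s) →
      A ++ R ++ com t x v ∷ rest ⇒ A ++ com t x v ∷ R ++ rest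
    move-commit A own balance = moveCom A R (com t x v) rest λ { X c Y refl →
      swap-deferred {A} {C = rest} X (λ s → items (th s)) (λ s → ep (th s)) nc inter own balance
        (λ s _ → M , Mx , Inv.valid (invariant R′) s)
        (λ s b₁ _ e → commit-ahead b₁ p (final s) (trans (bufs s) e)) }

    -- A write that is performed in the SC execution when it is committed.
    place-write : ∀ {E₀ M₀ th₀ n₀} → E ≡ (t , wr x v) ∷ E₀ → Reach n₀ E₀ M₀ th₀ → ep (th₀ t) ≡ [] →
      (∀ s → pending th₀ s ≡ pending th s) →
      flat (pending th₀) E₀ ++ isu t ∷ R ++ com t x v ∷ rest ⇒ flat (pending th) E ++ R ++ rest
    place-write {E₀} {th₀ = th₀} refl R₀ e same = SameTrace-trans (≡⇒ (sym (++-assoc F (isu t ∷ []) _)))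
      (SameTrace-trans (move-commit (F ∷ʳ isu t) own balance)
        (≡⇒ (trans (++-assoc F (isu t ∷ []) _) (trans (sym (++-assoc F (isu t ∷ com t x v ∷ []) _))
          (cong (_++ R ++ rest) (trans (cong (_++ isu t ∷ com t x v ∷ []) (flat-cong E₀ same))
            (sym (flat-done (pending th) E₀ (trans (sym (same t)) (cong length e))))))))))
      where
      F : Acts
      F = flat (pending th₀) E₀
      own : #com P t (F ∷ʳ isu t) < #isu P t (F ∷ʳ isu t)
      own = subst₂ _<_
        (sym (trans (#com-++ t F (isu t ∷ [])) (+-identityʳ _)))
        (sym (trans (#isu-++ t F (isu t ∷ [])) (cong₂ _+_
          (trans (balanced R₀ t) (trans (cong (#com P t F +_) (cong length e)) (+-identityʳ _))) (#isu-own t))))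
        (m<m+n (#com P t F) z<s)
      balance : ∀ s → s ≢ t → #isu P s (F ∷ʳ isu t) ≡ #com P s (F ∷ʳ isu t) + pending th s
      balance s s≢t = trans (#isu-++ s F (isu t ∷ []))
        (trans (cong (#isu P s F +_) (#isu-other s (isu t) (λ { refl → s≢t refl })))
        (trans (+-identityʳ _) (trans (balanced R₀ s) (cong₂ _+_
          (sym (trans (#com-++ s F (isu t ∷ [])) (+-identityʳ _))) (same s)))))

  -- Waiting items would be headed by a late write, which would still be in the buffer.
  flushed : ∀ {t} (ts : TState t) → Normal ts → [] ≡ ep ts ++ writes (items ts) → ts ≡ ⟨ sc ts , [] , [] ⟩
  flushed ⟨ l , [] , [] ⟩ _ _ = refl
  flushed ⟨ l , [] , it ∷ its ⟩ (late eo _) e rewrite eo with e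
  ... | ()
  flushed ⟨ l , _ ∷ _ , _ ⟩ _ ()

  -- An empty buffer means that the thread has no deferred actions, so the action of its fence or
  -- cas may pass all deferred ones. A successful cas is placed like a late write committed at once.
  synchronise : ∀ {pc mem reg buf pc′ reg′ L t i o rest σf} → let σ = (⟪_,_,_,_⟫ pc mem reg buf) in
    (c : Config σ L) → (∀ s → Normal (Config.states c s)) → buf t ≡ [] →
    LStep t mem (pc t , reg t) i o (pc′ t , reg′ t) →
    (∀ s → s ≢ t → _≡_ {A = Loc s} (pc′ s , reg′ s) (pc s , reg s)) →
    TSOPath P (⟪_,_,_,_⟫ pc′ (apply o mem) reg′ buf) rest σf → (∀ s → TSOState.buf σf s ≡ []) →
    Advanced (⟪_,_,_,_⟫ pc′ (apply o mem) reg′ buf) t (L ++ label t o ++ rest) rest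
  synchronise {pc} {mem} {reg} {buf} {pc′} {reg′} {L} {t} {i} {o} {rest} (config {_} {E} {th} {R} reach locs bufs inter nonCom refl) ns eb st eo p final =
    advanced
      (config {deferred = R} reach′ locs′ bufs′ inter′ nonCom refl)
      (OthersNormal-update (λ s _ → ns s))
      (SameTrace-trans (≡⇒ (++-assoc F R (label t o ++ rest)))
        (SameTrace-trans (tr o refl) (≡⇒ (sym (++-assoc (flat (pending th′) ((t , o) ∷ E)) R rest)))))
    where
    F : Acts
    F = flat (pending th) E
    et : th t ≡ ⟨ sc (th t) , [] , [] ⟩
    et = flushed (th t) (ns t) (trans (sym eb) (bufs t))
    th′ : States
    th′ = th ⟨ t ↦ ⟨ (pc′ t , reg′ t) , [] , [] ⟩ ⟩
    reach′ : Reach _ ((t , o) ∷ E) (apply o mem) th′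
    reach′ = step reach (λ s _ → ns s) et (sync (subst (λ l → LStep t mem l i o (pc′ t , reg′ t))
      (trans (locs t) (cong (λ ts → end (sc ts) (items ts)) et)) st)) update
    locs′ : ∀ s → (pc′ s , reg′ s) ≡ end (sc (th′ s)) (items (th′ s))
    locs′ = update-elim (λ s ts → (pc′ s , reg′ s) ≡ end (sc ts) (items ts)) refl (λ s s≢t → trans (eo s s≢t) (locs s))
    bufs′ : ∀ s → buf s ≡ ep (th′ s) ++ writes (items (th′ s))
    bufs′ = update-elim (λ s ts → buf s ≡ ep ts ++ writes (items ts)) eb (λ s _ → bufs s)
    projt : proj t R ≡ []
    projt = trans (inter t) (cong (λ ts → map act (items ts)) et)
    inter′ : Interleaves R th′
    inter′ = update-elim (λ s ts → proj s R ≡ map act (items ts)) projt (λ s _ → inter s)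
    same : ∀ s → pending th s ≡ pending th′ s
    same = update-elim {th = th} (λ s ts → pending th s ≡ length (ep ts)) (cong (λ ts → length (ep ts)) et) (λ _ _ → refl)
    front : ∀ a C → NonCom a → threadOf P a ≡ t → F ++ R ++ a ∷ C ⇒ F ++ a ∷ R ++ C
    front a C na ea = moveFront F R a C nonCom na (subst (λ u → All (λ c → threadOf P c ≢ u) R) (sym ea) (proj-[] R projt))
    finish : ∀ a → F ++ a ∷ R ++ rest ≡ (flat (pending th′) E ∷ʳ a) ++ R ++ rest
    finish a = trans (sym (++-assoc F (a ∷ []) (R ++ rest))) (cong (λ z → (z ∷ʳ a) ++ R ++ rest) (flat-cong E same))
    tr : ∀ o′ → o ≡ o′ → F ++ R ++ label t o′ ++ rest ⇒ flat (pending th′) ((t , o′) ∷ E) ++ R ++ rest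
    tr tau      _    = SameTrace-trans (front (tau t) rest tau refl) (≡⇒ (finish (tau t)))
    tr (rd x v) _    = SameTrace-trans (front (rd t x v) rest rd refl) (≡⇒ (finish (rd t x v)))
    tr (wr x v) refl = SameTrace-trans (front (isu t) (com t x v ∷ rest) isu refl)
      (place-write reach′ inter′ nonCom (update-same mem x v) bufs′ p final refl reach (cong ep et) same)

  commit-step : ∀ {pc mem reg buf L t x v b rest σf} → let σ = (⟪_,_,_,_⟫ pc mem reg buf) in
    (c : Config σ L) → (∀ s → Normal (Config.states c s)) → buf t ≡ (x , v) ∷ b →
    TSOPath P (⟪_,_,_,_⟫ pc (mem ⟨ x ↦ v ⟩) reg (buf ⟨ t ↦ b ⟩)) rest σf → (∀ s → TSOState.buf σf s ≡ []) →
    Advanced (⟪_,_,_,_⟫ pc (mem ⟨ x ↦ v ⟩) reg (buf ⟨ t ↦ b ⟩)) t (L ++ com t x v ∷ rest) rest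
  commit-step {pc} {mem} {reg} {buf} {L} {t} {x} {v} {b} {rest} {σf} (config {_} {E} {th} {R} reach locs bufs inter nonCom refl) ns eb p final =
    by-state (th t) refl (ns t) (trans (sym eb) (bufs t))
    where
    F : Acts
    F = flat (pending th) E
    σ′ : TSOState P
    σ′ = (⟪_,_,_,_⟫ pc (mem ⟨ x ↦ v ⟩) reg (buf ⟨ t ↦ b ⟩))

    bufs-update : ∀ {ts} → b ≡ ep ts ++ writes (items ts) → ∀ s → (buf ⟨ t ↦ b ⟩) s ≡ ep ((th ⟨ t ↦ ts ⟩) s) ++ writes (items ((th ⟨ t ↦ ts ⟩) s))
    bufs-update e = update-elim {th = th} (λ s ts → (buf ⟨ t ↦ b ⟩) s ≡ ep ts ++ writes (items ts))
      (trans (update-same buf t b) e) (λ s s≢t → trans (update-other buf t b s≢t) (bufs s))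

    -- The history already contains the write, so only the commit travels: past the deferred
    -- actions, then through the flattened history to its issue.
    early : ∀ {l b′ its} → th t ≡ ⟨ l , (x , v) ∷ b′ , its ⟩ → b ≡ b′ ++ writes its →
      Advanced σ′ t ((F ++ R) ++ com t x v ∷ rest) rest
    early {l} {b′} {its} et e = advanced
      (config {deferred = R} reach′
        (update-elim (λ s ts → (pc s , reg s) ≡ end (sc ts) (items ts))
          (trans (locs t) (cong (λ ts → end (sc ts) (items ts)) et)) (λ s _ → locs s))
        (bufs-update e) inter′ nonCom refl)
      (OthersNormal-update (λ s _ → ns s))
      (SameTrace-trans (≡⇒ (++-assoc F R _))
        (SameTrace-trans (move-commit reach′ inter′ nonCom (update-same mem x v) (bufs-update e) p final F own balance)
          (SameTrace-trans (commit-to-issue (Frozen.cut Fr) (Restored.agree back) (cong (λ ts → length (ep ts)) et) (R ++ rest))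
            (≡⇒ (trans (cong (_++ R ++ rest) (flat-cong E same)) (sym (++-assoc (flat (pending th′) E) R rest)))))))
      where
      th′ : States
      th′ = th ⟨ t ↦ ⟨ l , b′ , its ⟩ ⟩
      reach′ : Reach _ E (mem ⟨ x ↦ v ⟩) th′
      reach′ = step reach (λ s _ → ns s) et commit-early update
      inter′ : Interleaves R th′
      inter′ = update-elim (λ s ts → proj s R ≡ map act (items ts))
        (trans (inter t) (cong (λ ts → map act (items ts)) et)) (λ s _ → inter s)
      Fr : Frozen _ E mem th t [] x v b′
      Fr = freeze [] b′ reach (cong ep et)
      back : Restored (Frozen.cut Fr) ((λ s → sc (Frozen.states Fr s)) ⟨ t ↦ Frozen.loc′ Fr ⟩)
      back = moveLeft (Frozen.cut Fr) (Frozen.leftMover Fr) (Inv.run (invariant (Frozen.reach Fr)))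
        (subst (λ l → IsWriteStep t l (Frozen.index Fr) (wr x v) (Frozen.loc′ Fr)) (sym (cong sc (at (Frozen.update⁻ Fr)))) (Frozen.writeStep Fr)) update
      own : #com P t F < #isu P t F
      own = subst (#com P t F <_) (sym (balanced reach t)) (m<m+n _ (subst (λ ts → 0 < length (ep ts)) (sym et) z<s))
      balance : ∀ s → s ≢ t → #isu P s F ≡ #com P s F + pending th′ s
      balance s s≢t = trans (balanced reach s) (cong (λ ts → #com P s F + length (ep ts)) (sym (update-other th t _ s≢t)))
      same : ∀ s → (pending th ⟨ t ↦ length b′ ⟩) s ≡ pending th′ s
      same = update-elim {th = th} (λ s ts → (pending th ⟨ t ↦ length b′ ⟩) s ≡ length (ep ts))
        (update-same (pending th) t _) (λ s s≢t → update-other (pending th) t _ s≢t)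

    -- The write enters the history only now. Its issue is the first deferred action of `t` and
    -- moves to the front, and the commit is brought next to it.
    at-commit : ∀ {l it its} → th t ≡ ⟨ l , [] , it ∷ its ⟩ → op it ≡ wr x v → b ≡ writes its →
      Advanced σ′ t ((F ++ R) ++ com t x v ∷ rest) rest
    at-commit {l} {it} {its} et eo e = go (proj-head R (trans (inter t) (cong (λ ts → map act (items ts)) et)))
      where
      th′ : States
      th′ = th ⟨ t ↦ ⟨ tgt it , [] , its ⟩ ⟩
      reach′ : Reach _ ((t , wr x v) ∷ E) (mem ⟨ x ↦ v ⟩) th′
      reach′ = step reach (λ s _ → ns s) et (commit-late eo) update
      same : ∀ s → pending th s ≡ pending th′ s
      same = update-elim {th = th} (λ s ts → pending th s ≡ length (ep ts)) (cong (λ ts → length (ep ts)) et) (λ _ _ → refl)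
      go : ∃[ R₁ ] ∃[ R₂ ] R ≡ R₁ ++ act it ∷ R₂ × threadOf P (act it) ≡ t ×
        All (λ c → threadOf P c ≢ t) R₁ × proj t (R₁ ++ R₂) ≡ map act its × (∀ s → s ≢ t → proj s (R₁ ++ R₂) ≡ proj s R) →
        Advanced σ′ t ((F ++ R) ++ com t x v ∷ rest) rest
      go (R₁ , R₂ , refl , ea , al , e₁ , e₂) = advanced
        (config {deferred = R₁ ++ R₂} reach′
          (update-elim (λ s ts → (pc s , reg s) ≡ end (sc ts) (items ts))
            (trans (locs t) (cong (λ ts → end (sc ts) (items ts)) et)) (λ s _ → locs s))
          (bufs-update e) inter′ nonCom′ refl)
        (OthersNormal-update (λ s _ → ns s))
        (SameTrace-trans (≡⇒ (trans (++-assoc F (R₁ ++ act it ∷ R₂) _) (cong (F ++_) (++-assoc R₁ (act it ∷ R₂) _))))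
          (SameTrace-trans (moveFront F R₁ (act it) (R₂ ++ com t x v ∷ rest) (proj₁ (++⁻ R₁ nonCom)) (issue-nonCom t (op it))
              (subst (λ u → All (λ c → threadOf P c ≢ u) R₁) (sym ea) al))
            (SameTrace-trans (≡⇒ (trans (cong (λ z → F ++ act it ∷ z) (sym (++-assoc R₁ R₂ _)))
                (cong (λ o → F ++ issue t o ∷ (R₁ ++ R₂) ++ com t x v ∷ rest) eo)))
              (SameTrace-trans (place-write reach′ inter′ nonCom′ (update-same mem x v) (bufs-update e) p final refl reach (cong ep et) same)
                (≡⇒ (sym (++-assoc (flat (pending th′) ((t , wr x v) ∷ E)) (R₁ ++ R₂) rest)))))))
        where
        tail : ∀ {a as} → All NonCom (a ∷ as) → All NonCom as
        tail (_ ∷ ns) = ns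
        nonCom′ : All NonCom (R₁ ++ R₂)
        nonCom′ = ++⁺ (proj₁ (++⁻ R₁ nonCom)) (tail (proj₂ (++⁻ R₁ nonCom)))
        inter′ : Interleaves (R₁ ++ R₂) th′
        inter′ = update-elim (λ s ts → proj s (R₁ ++ R₂) ≡ map act (items ts)) e₁ (λ s s≢t → trans (e₂ s s≢t) (inter s))

    by-state : ∀ ts → th t ≡ ts → Normal ts → (x , v) ∷ b ≡ ep ts ++ writes (items ts) →
      Advanced σ′ t ((F ++ R) ++ com t x v ∷ rest) rest
    by-state ⟨ l , (y , w) ∷ b′ , its ⟩ et _ refl = early et refl
    by-state ⟨ l , [] , [] ⟩ et _ ()
    by-state ⟨ l , [] , it ∷ its ⟩ et (late {x = y} {w} eo _) e = go (trans e (cong (λ o → wrote o ++ writes its) eo))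
      where
      go : (x , v) ∷ b ≡ (y , w) ∷ writes its → Advanced σ′ t ((F ++ R) ++ com t x v ∷ rest) rest
      go refl = at-commit et eo refl

  advance : ∀ {σ L as σ′ rest σf} (c : Config σ L) → (∀ s → Normal (Config.states c s)) → TSOStep P σ as σ′ →
    TSOPath P σ′ rest σf → (∀ s → TSOState.buf σf s ≡ []) → ∃[ t ] Advanced σ′ t (L ++ as ++ rest) rest
  advance c ns st p final = go st c ns p
    where
    go : ∀ {σ L as σ′ rest} → TSOStep P σ as σ′ → (c : Config σ L) → (∀ s → Normal (Config.states c s)) →
      TSOPath P σ′ rest _ → ∃[ t ] Advanced σ′ t (L ++ as ++ rest) rest
    go (write {pc} {reg = reg} {buf = buf} {t = t} i q r) c ns p = t , defer (item i _ (write q r)) c ns refl (loc₁-same pc reg t) (loc₁-other pc reg t)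
      (update-same buf t _) (λ s s≢ → update-other buf t _ s≢) _
    go (commit eb) c ns p = _ , commit-step c ns eb p final
    go (assign {pc} {reg = reg} {t = t} i q r) c ns p = t , defer (item i _ (assign q r)) c ns refl (loc₂-same pc reg t) (loc₂-other pc reg t)
      (sym (++-identityʳ _)) (λ _ _ → refl) _
    go (read {pc} {reg = reg} {t = t} i {x = x} {v} q r e) c ns p = t , defer (item i (rd x v) (read q r)) c ns refl (loc₂-same pc reg t) (loc₂-other pc reg t)
      (sym (++-identityʳ _)) (λ _ _ → refl) (sym e)
    go (fence {pc} {reg = reg} {t = t} i q r eb) c ns p = t , synchronise c ns eb
      (subst (LStep _ _ _ i tau) (sym (loc₁-same pc reg t)) (fence q r)) (loc₁-other pc reg t) p final
    go (cas-success {pc} {reg = reg} {t = t} i q r eb e) c ns p = t , synchronise c ns eb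
      (subst (LStep _ _ _ i _) (sym (loc₂-same pc reg t)) (cas-success q r e)) (loc₂-other pc reg t) p final
    go (cas-failure {pc} {reg = reg} {t = t} i q r eb e) c ns p = t , synchronise c ns eb
      (subst (LStep _ _ _ i _) (sym (loc₂-same pc reg t)) (cas-failure q r refl e)) (loc₂-other pc reg t) p final
    go (skip {pc} {reg = reg} {t = t} i q r) c ns p = t , defer (item i _ (skip q r)) c ns refl (loc₁-same pc reg t) (loc₁-other pc reg t)
      (sym (++-identityʳ _)) (λ _ _ → refl) _
    go (assume {pc} {reg = reg} {t = t} i q r e) c ns p = t , defer (item i _ (assume q r e)) c ns refl (loc₁-same pc reg t) (loc₁-other pc reg t)
      (sym (++-identityʳ _)) (λ _ _ → refl) _

  simulate : WriteAtomic P → ∀ {σ L π σf} (c : Config σ L) → (∀ s → Normal (Config.states c s)) →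
    TSOPath P σ π σf → (∀ s → TSOState.buf σf s ≡ []) →
    ∃[ E ] ∃[ l ] Run E l × L ++ π ⇒ concat (labelsOf E)
  simulate atomic {L = L} (config {_} {E} {th} {R} reach locs bufs inter nonCom refl) ns [] final =
    E , _ , Inv.run (invariant reach) ,
    ≡⇒ (trans (++-identityʳ _) (trans (cong (flat (pending th) E ++_) (no-actions R λ t →
          trans (inter t) (cong (λ ts → map act (items ts)) (empty t))))
      (trans (++-identityʳ _) (flat-concat (pending th) E (λ t → cong (λ ts → length (ep ts)) (empty t))))))
    where
    empty : ∀ t → th t ≡ ⟨ sc (th t) , [] , [] ⟩
    empty t = flushed (th t) (ns t) (trans (sym (final t)) (bufs t))
    no-actions : ∀ R → (∀ t → proj t R ≡ []) → R ≡ []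
    no-actions []      _ = refl
    no-actions (a ∷ R) e with proj-[] (a ∷ R) (e (threadOf P a))
    ... | n ∷ _ = ⊥-elim (n refl)
  simulate atomic c ns (st ∷ p) final with advance c ns st p final
  ... | t , advanced c₁ ns₁ tr₁ with drain atomic t _ c₁ refl ns₁
  ... | drained c₂ ns₂ tr₂ with simulate atomic c₂ ns₂ p final
  ... | E , l , r , tr₃ = E , l , r , SameTrace-trans tr₁ (SameTrace-trans (tr₂ _) tr₃)

  robust : WriteAtomic P → Robust P
  robust atomic π (σf , p , final)
    with simulate atomic {L = []} (config {deferred = []} (init (λ _ → refl)) (λ _ → refl) (λ _ → refl) (λ _ → refl) [] refl)
           (λ _ → idle) p final
  ... | E , l , r , tr with Run⇒SCPath r
  ... | es , s , q , e , _ = concat (labelsOf E) , (es , s , q , cong concat e) , tr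

theorem1 : {V : ValueDomain} (P : Program V) → WriteAtomic P → Robust P
theorem1 P = Simulation.robust P
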